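{- Let $H$ be a multigraph with minimum degree $\delta(H) \geq 7$ and let $G$ be the line graph of $H$. Then $\chi_l(G) \leq \max\{\omega(G), \Delta(G)-1\}$.
   Context: Multigraphs are finite and may have parallel edges but no loops; the degree of a vertex of a multigraph counts incident edges with multiplicity. The line graph of a multigraph $H$ is the simple graph with vertex set $E(H)$ in which two distinct edges of $H$ are adjacent iff they share at least one endpoint (so parallel edges are adjacent). $\chi_l$ is the list chromatic number (choice number), $\omega$ the clique number, and $\Delta$ the maximum degree. -}

module Defs where

open import Level using (0ℓ)
open import Data.Nat.Base
open import Data.Nat.Properties as ℕ using (≤-trans)
open import Data.Fin.Base as Fin using (Fin; zero; suc; toℕ; combine; finToFun; funToFin; remQuot)
open import Data.Fin.Properties as Fin using (all?; any?; toℕ-injective; finToFun-funToFin; injective⇒≤)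
open import Data.Fin.Subset as Subset using (Subset; ∣_∣)
open import Data.Fin.Subset.Properties as Subset using (anySubset?; ∣p∣≤n; ∣⊥∣≡0)
open import Data.List.Base as List using (List; []; _∷_; length; lookup; tabulate; filter; map; allFin)
open import Data.List.Properties using (length-tabulate)
open import Data.List.Extrema.Nat using (max; min)
open import Data.List.Membership.Propositional using (_∈_; _∉_)
open import Data.List.Membership.Propositional.Properties using (∈-tabulate⁻; ∈-lookup)
open import Data.List.Membership.DecPropositional ℕ._≟_ using (_∈?_)
open import Data.List.Relation.Unary.All as All using (All)
open import Data.List.Relation.Unary.AllPairs using (_∷_)
open import Data.List.Relation.Unary.Any as Any using (here; there)
open import Data.List.Relation.Unary.Any.Properties using (lookup-index)
open import Data.List.Relation.Unary.Unique.Propositional using (Unique)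
import Data.List.Relation.Unary.Unique.Propositional.Properties as Unique
open import Data.Product.Base using (∃; _×_; _,_; proj₁; proj₂)
open import Data.Sum.Base using (_⊎_)
open import Function.Base using (_∘_)
open import Function.Definitions using (Injective)
open import Relation.Binary.Core using (Rel)
open import Relation.Binary.Definitions using (Symmetric; Irreflexive; Decidable)
open import Relation.Binary.PropositionalEquality
open import Relation.Nullary
open import Relation.Nullary.Decidable using (map′; _×-dec_; _→-dec_; _⊎-dec_; ¬?; decidable-stable)
import Relation.Unary as U

IsLeast IsGreatest : (ℕ → Set) → ℕ → Set
IsLeast    P k = P k × (∀ {j} → P j → k ≤ j)
IsGreatest P k = P k × (∀ {j} → P j → j ≤ k)

least : ∀ {P : ℕ → Set} → U.Decidable P → ∀ b → P b → ∃ (IsLeast P)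
least P? zero Pb = 0 , Pb , λ _ → z≤n
least {P} P? (suc b) Pb with P? 0
... | yes P0 = 0 , P0 , λ _ → z≤n
... | no ¬P0 with least {P ∘ suc} (P? ∘ suc) b Pb
...   | k , Pk , lb = suc k , Pk , lb′
  where
  lb′ : ∀ {j} → P j → suc k ≤ j
  lb′ {zero}  P0 = contradiction P0 ¬P0
  lb′ {suc j} Pj = s≤s (lb Pj)

greatest : ∀ {P : ℕ → Set} → U.Decidable P → P 0 →
           ∀ b → (∀ {j} → P j → j ≤ b) → ∃ (IsGreatest P)
greatest P? P0 zero ub = 0 , P0 , ub
greatest {P} P? P0 (suc b) ub with P? (suc b)
... | yes Pb = suc b , Pb , ub
... | no ¬Pb = greatest P? P0 b λ {j} Pj →
        s≤s⁻¹ (ℕ.≤∧≢⇒< (ub Pj) λ { refl → ¬Pb Pj })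

record SimpleGraph : Set₁ where
  field
    order      : ℕ
    Adj        : Rel (Fin order) 0ℓ
    adj?       : Decidable Adj
    adj-sym    : Symmetric Adj
    adj-irrefl : Irreflexive _≡_ Adj

  Vertex : Set
  Vertex = Fin order

  degree : Vertex → ℕ
  degree v = length (filter (adj? v) (allFin order))

  IsClique : Subset order → Set
  IsClique S = ∀ u v → u Subset.∈ S → v Subset.∈ S → u ≢ v → Adj u v

  HasClique : ℕ → Set
  HasClique k = ∃ λ S → IsClique S × ∣ S ∣ ≡ k

  IsProper : (Vertex → ℕ) → Set
  IsProper c = ∀ {u v} → Adj u v → c u ≢ c v

  -- A set of k colours is a duplicate-free list of length k.
  Choosable : ℕ → Set
  Choosable k =
    (L : Vertex → List ℕ) →
    (∀ v → Unique (L v)) →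
    (∀ v → length (L v) ≡ k) →
    ∃ λ (c : Vertex → ℕ) → (∀ v → c v ∈ L v) × IsProper c

open SimpleGraph using (degree; HasClique; Choosable)

-- The maximum degree of the graph without vertices is 0.
Δ : SimpleGraph → ℕ
Δ G = max 0 (map (degree G) (allFin (SimpleGraph.order G)))

module _ (G : SimpleGraph) where
  open SimpleGraph G hiding (degree; HasClique; Choosable)

  hasClique? : U.Decidable (HasClique G)
  hasClique? k = anySubset? λ S →
    all? (λ u → all? λ v →
      (u Subset.∈? S) →-dec (v Subset.∈? S) →-dec ¬? (u Fin.≟ v) →-dec adj? u v)
    ×-dec (∣ S ∣ ℕ.≟ k)

  cliqueNumber : ∃ (IsGreatest (HasClique G))
  cliqueNumber = greatest hasClique?
    (Subset.⊥ , (λ u v u∈ → contradiction u∈ Subset.∉⊥) , ∣⊥∣≡0 order)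
    order
    λ { (S , _ , refl) → ∣p∣≤n S }

ω : SimpleGraph → ℕ
ω G = proj₁ (cliqueNumber G)

-- Every graph is choosable with lists as long as its order

lookup-injective : ∀ {xs : List ℕ} → Unique xs → Injective _≡_ _≡_ (lookup xs)
lookup-injective (x∉ ∷ u) {zero}  {zero}  eq = refl
lookup-injective (x∉ ∷ u) {zero}  {suc j} eq = contradiction eq (All.lookup x∉ (∈-lookup j))
lookup-injective (x∉ ∷ u) {suc i} {zero}  eq = contradiction (sym eq) (All.lookup x∉ (∈-lookup i))
lookup-injective (x∉ ∷ u) {suc i} {suc j} eq = cong suc (lookup-injective u eq)

cast-injective : ∀ {m n} (eq : m ≡ n) → Injective _≡_ _≡_ (Fin.cast eq)
cast-injective eq {i} {j} p =
  toℕ-injective (trans (sym (Fin.toℕ-cast eq i)) (trans (cong toℕ p) (Fin.toℕ-cast eq j)))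

index-cong⁻ : ∀ {x y : ℕ} {zs} (p : x ∈ zs) (q : y ∈ zs) →
              Any.index p ≡ Any.index q → x ≡ y
index-cong⁻ {zs = zs} p q eq =
  trans (lookup-index p) (trans (cong (lookup zs) eq) (sym (lookup-index q)))

fresh : ∀ {xs : List ℕ} ys → Unique xs → length ys < length xs →
        ∃ λ x → x ∈ xs × x ∉ ys
fresh {xs} ys u ys<xs with any? (λ i → ¬? (lookup xs i ∈? ys))
... | yes (i , x∉) = lookup xs i , ∈-lookup i , x∉
... | no all∈ = contradiction ys<xs (ℕ.≤⇒≯ (injective⇒≤ {f = Any.index ∘ f∈} λ {i} {j} eq →
        lookup-injective u (index-cong⁻ (f∈ i) (f∈ j) eq)))
  where
  f∈ : ∀ i → lookup xs i ∈ ys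
  f∈ i = decidable-stable (lookup xs i ∈? ys) λ ∉ → all∈ (i , ∉)

distinctChoice : ∀ n (L : Fin n → List ℕ) used →
  (∀ v → Unique (L v)) → (∀ v → n + length used ≤ length (L v)) →
  ∃ λ (c : Fin n → ℕ) → (∀ v → c v ∈ L v × c v ∉ used) × Injective _≡_ _≡_ c
distinctChoice zero L used u big = (λ ()) , (λ ()) , λ { {()} }
distinctChoice (suc n) L used u big
  with x , x∈ , x∉ ← fresh used (u zero) (≤-trans (s≤s (ℕ.m≤n+m _ n)) (big zero))
  with c , c∈ , inj ← distinctChoice n (L ∘ suc) (x ∷ used) (u ∘ suc)
         (λ v → ≤-trans (ℕ.≤-reflexive (ℕ.+-suc n _)) (big (suc v)))
  = c′ , ok , inj′
  where
  c′ : Fin (suc n) → ℕ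
  c′ zero    = x
  c′ (suc v) = c v
  ok : ∀ v → c′ v ∈ L v × c′ v ∉ used
  ok zero    = x∈ , x∉
  ok (suc v) = proj₁ (c∈ v) , proj₂ (c∈ v) ∘ there
  inj′ : Injective _≡_ _≡_ c′
  inj′ {zero}  {zero}  _  = refl
  inj′ {zero}  {suc v} eq = contradiction (here (sym eq)) (proj₂ (c∈ v))
  inj′ {suc u} {zero}  eq = contradiction (here eq) (proj₂ (c∈ u))
  inj′ {suc u} {suc v} eq = cong suc (inj eq)

order-choosable : ∀ G → Choosable G (SimpleGraph.order G)
order-choosable G L u len
  with c , c∈ , inj ← distinctChoice _ L [] u
         (λ v → ℕ.≤-reflexive (trans (ℕ.+-identityʳ _) (sym (len v))))
  = c , proj₁ ∘ c∈ , λ a eq → SimpleGraph.adj-irrefl G (inj eq) a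

-- Choosability is decidable: order * k colours suffice to realise, up to
-- renaming, every assignment of lists of length k

normalise : ∀ {n} (h : Fin n → ℕ) → ∃ λ (f : Fin n → Fin n) →
            (∀ x → h (f x) ≡ h x) × (∀ x y → h x ≡ h y → f x ≡ f y)
normalise {n} h = f , h∘f , f-cong
  where
  pos : ∀ {a} → Fin n → Dec (∃ λ y → h y ≡ a) → Fin n
  pos _ (yes (y , _)) = y
  pos d (no _)        = d
  search : ∀ a → Dec (∃ λ y → h y ≡ a)
  search a = any? λ y → h y ℕ.≟ a
  f : Fin n → Fin n
  f x = pos x (search (h x))
  h∘f : ∀ x → h (f x) ≡ h x
  h∘f x with search (h x)
  ... | yes (_ , eq) = eq
  ... | no ∄         = refl
  pos-irr : ∀ {a} x y → h x ≡ a → (d : Dec (∃ λ z → h z ≡ a)) → pos x d ≡ pos y d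
  pos-irr x y eq (yes _) = refl
  pos-irr x y eq (no ∄)  = contradiction (x , eq) ∄
  f-cong : ∀ x y → h x ≡ h y → f x ≡ f y
  f-cong x y eq = trans (pos-irr x y refl (search (h x)))
                        (cong (λ a → pos y (search a)) eq)

module _ (G : SimpleGraph) (k : ℕ) where
  open SimpleGraph G using (order; Vertex; Adj; adj?)

  -- combine v i is the i-th position of the list at v, and f names the colours.
  Slot : Set
  Slot = Fin (order * k)

  RowInjective : (Slot → Slot) → Set
  RowInjective f = ∀ (v : Vertex) (i j : Fin k) → f (combine v i) ≡ f (combine v j) → i ≡ j

  Selects : (Slot → Slot) → (Vertex → Fin k) → Set
  Selects f g = ∀ u v → Adj u v → f (combine u (g u)) ≢ f (combine v (g v))

  BoundedChoosable : Set
  BoundedChoosable =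
    ∀ (x : Fin ((order * k) ^ (order * k))) → RowInjective (finToFun x) →
    ∃ λ (y : Fin (k ^ order)) → Selects (finToFun x) (finToFun y)

  boundedChoosable? : Dec BoundedChoosable
  boundedChoosable? = all? λ x →
    (all? λ v → all? λ i → all? λ j →
      (finToFun x (combine v i) Fin.≟ finToFun x (combine v j)) →-dec (i Fin.≟ j))
    →-dec any? λ y → all? λ u → all? λ v →
      adj? u v →-dec ¬? (finToFun x (combine u (finToFun y u)) Fin.≟ finToFun x (combine v (finToFun y v)))

  choosable⇒bounded : Choosable G k → BoundedChoosable
  choosable⇒bounded ch x inj = funToFin g , λ u v a eq → proper a (begin
      c u                                 ≡⟨ proj₂ (c-slot u) ⟩
      toℕ (f (combine u (g u)))           ≡⟨ cong (toℕ ∘ f ∘ combine u) (g≗ u) ⟨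
      toℕ (f (combine u (finToFun (funToFin g) u))) ≡⟨ cong toℕ eq ⟩
      toℕ (f (combine v (finToFun (funToFin g) v))) ≡⟨ cong (toℕ ∘ f ∘ combine v) (g≗ v) ⟩
      toℕ (f (combine v (g v)))           ≡⟨ proj₂ (c-slot v) ⟨
      c v                                 ∎)
    where
    open ≡-Reasoning
    f : Slot → Slot
    f = finToFun x
    L : Vertex → List ℕ
    L v = tabulate λ i → toℕ (f (combine v i))
    colouring : ∃ λ (c : Vertex → ℕ) → (∀ v → c v ∈ L v) × SimpleGraph.IsProper G c
    colouring = ch L (λ v → Unique.tabulate⁺ λ {i} {j} → inj v i j ∘ toℕ-injective)
                     (λ v → length-tabulate _)
    c : Vertex → ℕ
    c = proj₁ colouring
    proper : SimpleGraph.IsProper G c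
    proper = proj₂ (proj₂ colouring)
    c-slot : ∀ v → ∃ λ i → c v ≡ toℕ (f (combine v i))
    c-slot v = ∈-tabulate⁻ (proj₁ (proj₂ colouring) v)
    g : Vertex → Fin k
    g = proj₁ ∘ c-slot
    g≗ : finToFun (funToFin g) ≗ g
    g≗ = finToFun-funToFin g

  bounded⇒choosable : BoundedChoosable → Choosable G k
  bounded⇒choosable bd L uniq len = (λ v → entry v (g v)) , (λ v → ∈-lookup _) ,
      λ {u} {v} a eq → proj₂ sel u v a (begin
        finToFun x (combine u (g u)) ≡⟨ x≗ _ ⟩
        f (combine u (g u))          ≡⟨ f-cong _ _ (trans (h-combine u (g u)) (trans eq (sym (h-combine v (g v))))) ⟩
        f (combine v (g v))          ≡⟨ x≗ _ ⟨
        finToFun x (combine v (g v)) ∎)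
    where
    open ≡-Reasoning
    entry : (v : Vertex) → Fin k → ℕ
    entry v i = lookup (L v) (Fin.cast (sym (len v)) i)
    h : Slot → ℕ
    h s = entry (proj₁ (remQuot k s)) (proj₂ (remQuot {order} k s))
    h-combine : ∀ v i → h (combine v i) ≡ entry v i
    h-combine v i = cong (λ p → entry (proj₁ p) (proj₂ p)) (Fin.remQuot-combine v i)
    f : Slot → Slot
    f = proj₁ (normalise h)
    h∘f : ∀ s → h (f s) ≡ h s
    h∘f = proj₁ (proj₂ (normalise h))
    f-cong : ∀ s t → h s ≡ h t → f s ≡ f t
    f-cong = proj₂ (proj₂ (normalise h))
    x : Fin ((order * k) ^ (order * k))
    x = funToFin f
    x≗ : finToFun x ≗ f
    x≗ = finToFun-funToFin f
    row : RowInjective (finToFun x)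
    row v i j eq = cast-injective (sym (len v)) (lookup-injective (uniq v) (begin
      entry v i               ≡⟨ h-combine v i ⟨
      h (combine v i)         ≡⟨ h∘f _ ⟨
      h (f (combine v i))     ≡⟨ cong h (trans (sym (x≗ _)) (trans eq (x≗ _))) ⟩
      h (f (combine v j))     ≡⟨ h∘f _ ⟩
      h (combine v j)         ≡⟨ h-combine v j ⟩
      entry v j               ∎))
    sel : ∃ λ y → Selects (finToFun x) (finToFun y)
    sel = bd x row
    g : Vertex → Fin k
    g = finToFun (proj₁ sel)

  choosable? : Dec (Choosable G k)
  choosable? = map′ bounded⇒choosable choosable⇒bounded boundedChoosable?

listChromaticNumber : (G : SimpleGraph) → ∃ (IsLeast (Choosable G))
listChromaticNumber G =
  least (choosable? G) (SimpleGraph.order G) (order-choosable G)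

χₗ : SimpleGraph → ℕ
χₗ G = proj₁ (listChromaticNumber G)

-- Edges are labelled by Fin size, so distinct edges may have the same ends.
-- The order in which the two ends are stored plays no role.
record Multigraph : Set where
  field
    order    : ℕ
    size     : ℕ
    end₁     : Fin size → Fin order
    end₂     : Fin size → Fin order
    loopless : ∀ e → end₁ e ≢ end₂ e

  Vertex Edge : Set
  Vertex = Fin order
  Edge   = Fin size

  Incident : Vertex → Edge → Set
  Incident v e = v ≡ end₁ e ⊎ v ≡ end₂ e

  incident? : Decidable Incident
  incident? v e = (v Fin.≟ end₁ e) ⊎-dec (v Fin.≟ end₂ e)

  deg : Vertex → ℕ
  deg v = length (filter (incident? v) (allFin size))

  -- No degree exceeds size, so the default value affects only the multigraph
  -- without vertices, whose minimum degree is 0 here.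
  δ : ℕ
  δ = min size (map deg (allFin order))

open Multigraph using (δ)

lineGraph : Multigraph → SimpleGraph
lineGraph H = record
  { order      = size
  ; Adj        = λ e f → e ≢ f × ∃ λ v → Incident v e × Incident v f
  ; adj?       = λ e f → ¬? (e Fin.≟ f) ×-dec any? λ v → incident? v e ×-dec incident? v f
  ; adj-sym    = λ (e≢f , v , ve , vf) → ≢-sym e≢f , v , vf , ve
  ; adj-irrefl = λ e≡f (e≢f , _) → e≢f e≡f
  }
  where open Multigraph H

-- Let k be the bound. By induction every set R of edges can be coloured from
-- lists of size k. Inside R an edge with fewer than k neighbours can be coloured
-- last, so each edge has k or k + 1 neighbours in R and all degrees stay at
-- least 6. A few configurations can be coloured last because each of their edges
-- sees only one colour too few: either a preference order on a bipartite
-- configuration makes Galvin's kernel argument work, or two pairs of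
-- non-adjacent edges save colours. They exclude multiplicity 4 and more (cliques
-- have at most k edges) and vertices of degree at least k - 2. A nearly maximum
-- cut of what is left then satisfies, for every cut edge uv,
-- (uncut edges at u) + deg v ≤ k; its complement is coloured by induction and
-- the cut by the theorem of Borodin, Kostochka and Woodall: a bipartite
-- multigraph is edge-colourable from lists of size max (deg u) (deg v). For that
-- theorem preferences are built by peeling off sets of edges that become the
-- first choice on one side and the last choice on the other.

module Submission where

open import Defs
import Data.Nat.Properties as ℕ
open import Algebra.Properties.CommutativeMonoid.Sum ℕ.+-0-commutativeMonoid
  using (sum; sum-cong-≗; ∑-distrib-+)
open import Data.Bool.Base using (Bool; true; false; not; T; if_then_else_)
import Data.Bool.Properties as Bool
open import Data.Empty using (⊥)
open import Data.Fin.Base as Fin using (Fin; zero; suc; toℕ; splitAt)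
open import Data.Fin.Patterns
import Data.Fin.Properties as Fin
open import Data.Fin.Properties using (any?; all?)
import Data.Fin.Subset as Subset
open import Data.List.Base using (List; []; _∷_; _++_; length; filter; map; allFin; tabulate; foldr; take)
open import Data.List.Extrema.Nat using (xs≤max; min≤xs)
open import Data.List.Membership.DecPropositional ℕ._≟_ using () renaming (_∈?_ to _∈ˡ?_)
open import Data.List.Membership.Propositional using (find) renaming (_∈_ to _∈ˡ_; _∉_ to _∉ˡ_)
open import Data.List.Membership.Propositional.Properties
  using (∈-filter⁺; ∈-filter⁻; ∈-map⁺; ∈-allFin; ∈-++⁺ˡ; ∈-++⁺ʳ; ∈-++⁻; ∈-tabulate⁺)
open import Data.List.Properties
  using (length-map; length-++; length-take; length-tabulate; take++drop≡id; filter-all; filter-accept; filter-reject; filter-notAll)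
open import Data.List.Relation.Unary.All as All using (All; []; _∷_)
open import Data.List.Relation.Unary.AllPairs using ([]; _∷_)
open import Data.List.Relation.Unary.Any as Any using (here; there)
open import Data.List.Relation.Unary.Unique.Propositional using (Unique)
import Data.List.Relation.Unary.Unique.Propositional.Properties as Unique
open import Data.Nat.Base
open import Data.Nat.Induction using (<-wellFounded)
open import Data.Nat.Tactic.RingSolver using (solve-∀)
open import Data.Product.Base using (Σ; ∃; ∃₂; _×_; _,_; proj₁; proj₂; swap)
open import Data.Sum.Base as Sum using (_⊎_; inj₁; inj₂; [_,_]′)
open import Data.Unit.Base using (⊤; tt)
open import Data.Vec.Base as Vec using ([]; _∷_)
open import Data.Vec.Functional using () renaming (_++_ to _⊕_)
open import Data.Vec.Properties using (lookup∘tabulate; []=⇒lookup)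
open import Function.Base using (_∘_; id)
open import Function.Definitions using (Injective)
open import Induction.WellFounded using (Acc; acc)
open import Level using (Level)
open import Relation.Binary.Definitions using (Tri; tri<; tri≈; tri>)
open import Relation.Binary.PropositionalEquality
open import Relation.Nullary
open import Relation.Nullary.Decidable using (_×-dec_; _⊎-dec_; _→-dec_; ¬?; decidable-stable; toWitness)
open import Relation.Unary using (Decidable)

-- Most estimates rest on deg u + deg v = dG(uv) + 1 + mult(uv), where dG counts the neighbours of
-- an edge inside R. With dG ≤ k + 1 and multiplicity at most 3 this gives deg u + deg v ≤ k + 5. As
-- also deg v ≤ k - 3, a cut with at least half of the edges at each vertex meets the inequality
-- wanted unless deg u = 8, deg v = k - 3 and four edges at u are uncut. Hence the cut is only
-- nearly maximum: edges of this type weigh 7 and all others 8. A local optimum keeps the needed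
-- bounds, and where the inequality fails, such edges are found both cut and uncut at u, which makes
-- u the centre of a reducible star. The minimum degree enters through one fact: an edge of R has at
-- most one neighbour outside R. So a vertex keeps degree at least 7, or at least 6 while each of
-- its edges has at most k neighbours; both cases give the same estimates. Kernels need a bipartite
-- configuration. A triangle on a bundle of parallel edges destroys that, and there the saving on
-- non-adjacent pairs takes over. Each structural step returns a colouring of R or the property
-- wanted; this replaces a minimal counterexample.

private variable
  ℓ ℓ′ : Level
  l m n : ℕ

-- A certificate for linear arithmetic that leaves an identity to the ring solver.
linear : ∀ {A B l r} s → A ≤ B → l + B + s ≡ r + A → l ≤ r
linear {A} {B} {l} {r} s A≤B eq = ℕ.+-cancelʳ-≤ A l r (begin
  l + A     ≤⟨ ℕ.+-monoʳ-≤ l A≤B ⟩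
  l + B     ≤⟨ ℕ.m≤m+n _ s ⟩
  l + B + s ≡⟨ eq ⟩
  r + A     ∎)
  where open ℕ.≤-Reasoning

-- Decidable subsets of a finite set and their sizes

infix 4 _∈_ _⊆_
infixr 7 _∩_
infixr 6 _∪_ _∖_

record Sub (n : ℕ) : Set₁ where
  field
    Mem  : Fin n → Set
    mem? : Decidable Mem

open Sub public using (mem?)

⟪_⟫ : {P : Fin n → Set} → Decidable P → Sub n
⟪ P? ⟫ = record { mem? = P? }

_∈_ : Fin n → Sub n → Set
i ∈ A = Sub.Mem A i

_⊆_ : Sub n → Sub n → Set
A ⊆ B = ∀ {i} → i ∈ A → i ∈ B

_∩_ _∪_ _∖_ : Sub n → Sub n → Sub n
A ∩ B = ⟪ (λ i → mem? A i ×-dec mem? B i) ⟫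
A ∪ B = ⟪ (λ i → mem? A i ⊎-dec mem? B i) ⟫
A ∖ B = ⟪ (λ i → mem? A i ×-dec ¬? (mem? B i)) ⟫

full : Sub n
full = record { Mem = λ _ → ⊤ ; mem? = λ _ → yes tt }

∅ : Sub n
∅ = record { Mem = λ _ → ⊥ ; mem? = λ _ → no λ () }

⁅_⁆ : Fin n → Sub n
⁅ i ⁆ = ⟪ (Fin._≟ i) ⟫

Disjoint : Sub n → Sub n → Set
Disjoint A B = ∀ {i} → i ∈ A → i ∈ B → ⊥

𝟙 : {P : Set} → Dec P → ℕ
𝟙 (yes _) = 1
𝟙 (no  _) = 0

opaque
  ∣_∣ : Sub n → ℕ
  ∣ A ∣ = sum (λ i → 𝟙 (mem? A i))

𝟙-mono : ∀ {P Q : Set} → (P → Q) → (p : Dec P) (q : Dec Q) → 𝟙 p ≤ 𝟙 q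
𝟙-mono f (no _)  q       = z≤n
𝟙-mono f (yes _) (yes _) = ℕ.≤-refl
𝟙-mono f (yes p) (no ¬q) = contradiction (f p) ¬q

sum-mono : {f g : Fin n → ℕ} → (∀ i → f i ≤ g i) → sum f ≤ sum g
sum-mono {zero}  h = z≤n
sum-mono {suc n} h = ℕ.+-mono-≤ (h zero) (sum-mono (h ∘ suc))

opaque
  unfolding ∣_∣

  ∣∣-mono : {A B : Sub n} → A ⊆ B → ∣ A ∣ ≤ ∣ B ∣
  ∣∣-mono {A = A} {B} A⊆B = sum-mono λ i → 𝟙-mono A⊆B (mem? A i) (mem? B i)

∣∣-cong : {A B : Sub n} → A ⊆ B → B ⊆ A → ∣ A ∣ ≡ ∣ B ∣
∣∣-cong {A = A} {B} A⊆B B⊆A = ℕ.≤-antisym (∣∣-mono {A = A} {B} A⊆B) (∣∣-mono {A = B} {A} B⊆A)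

opaque
  unfolding ∣_∣

  ∣∣-split : (A B : Sub n) → ∣ A ∩ B ∣ + ∣ A ∖ B ∣ ≡ ∣ A ∣
  ∣∣-split A B = trans (sym (∑-distrib-+ {_} (λ i → 𝟙 (mem? (A ∩ B) i)) (λ i → 𝟙 (mem? (A ∖ B) i))))
                       (sum-cong-≗ λ i → split (mem? A i) (mem? B i))
    where
    split : ∀ {P Q : Set} (p : Dec P) (q : Dec Q) → 𝟙 (p ×-dec q) + 𝟙 (p ×-dec ¬? q) ≡ 𝟙 p
    split (yes _) (yes _) = refl
    split (yes _) (no _)  = refl
    split (no _)  (yes _) = refl
    split (no _)  (no _)  = refl

  ∣∣-∪∩ : (A B : Sub n) → ∣ A ∪ B ∣ + ∣ A ∩ B ∣ ≡ ∣ A ∣ + ∣ B ∣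
  ∣∣-∪∩ A B = trans (sym (∑-distrib-+ {_} (λ i → 𝟙 (mem? (A ∪ B) i)) (λ i → 𝟙 (mem? (A ∩ B) i))))
             (trans (sum-cong-≗ λ i → both (mem? A i) (mem? B i))
                    (∑-distrib-+ {_} (λ i → 𝟙 (mem? A i)) (λ i → 𝟙 (mem? B i))))
    where
    both : ∀ {P Q : Set} (p : Dec P) (q : Dec Q) → 𝟙 (p ⊎-dec q) + 𝟙 (p ×-dec q) ≡ 𝟙 p + 𝟙 q
    both (yes _) (yes _) = refl
    both (yes _) (no _)  = refl
    both (no _)  (yes _) = refl
    both (no _)  (no _)  = refl

∣∣-⊎ : {A B C : Sub n} → A ⊆ C → B ⊆ C → Disjoint A B → ∣ A ∣ + ∣ B ∣ ≤ ∣ C ∣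
∣∣-⊎ {A = A} {B} {C} A⊆C B⊆C dis = begin
  ∣ A ∣ + ∣ B ∣           ≤⟨ ℕ.+-mono-≤ (∣∣-mono {A = A} {C ∩ A} λ a → A⊆C a , a)
                                        (∣∣-mono {A = B} {C ∖ A} λ b → B⊆C b , λ a → dis a b) ⟩
  ∣ C ∩ A ∣ + ∣ C ∖ A ∣   ≡⟨ ∣∣-split C A ⟩
  ∣ C ∣                   ∎
  where open ℕ.≤-Reasoning

∣∣-cover : {A B C : Sub n} → (∀ {i} → i ∈ C → i ∈ A ⊎ i ∈ B) → ∣ C ∣ ≤ ∣ A ∣ + ∣ B ∣
∣∣-cover {A = A} {B} {C} cov = begin
  ∣ C ∣                   ≤⟨ ∣∣-mono {A = C} {A ∪ B} cov ⟩
  ∣ A ∪ B ∣               ≤⟨ ℕ.m≤m+n _ _ ⟩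
  ∣ A ∪ B ∣ + ∣ A ∩ B ∣   ≡⟨ ∣∣-∪∩ A B ⟩
  ∣ A ∣ + ∣ B ∣           ∎
  where open ℕ.≤-Reasoning

opaque
  unfolding ∣_∣

  ∣∣-positive : (A : Sub n) → 1 ≤ ∣ A ∣ → ∃ λ i → i ∈ A
  ∣∣-positive A = nonempty _ (mem? A)
    where
    nonempty : ∀ n {P : Fin n → Set} (P? : Decidable P) → 1 ≤ sum (λ i → 𝟙 (P? i)) → ∃ P
    nonempty (suc n) P? le with P? zero
    ... | yes p = zero , p
    ... | no _  with i , p ← nonempty n (P? ∘ suc) le = suc i , p

∣∣-empty : (A : Sub n) → (∀ {i} → ¬ i ∈ A) → ∣ A ∣ ≡ 0
∣∣-empty A ∅ with ∣ A ∣ in eq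
... | zero  = refl
... | suc _ with i , i∈A ← ∣∣-positive A (subst (1 ≤_) (sym eq) (s≤s z≤n)) = contradiction i∈A ∅

opaque
  unfolding ∣_∣

  ∣⁅i⁆∣ : (i : Fin n) → ∣ ⁅ i ⁆ ∣ ≡ 1
  ∣⁅i⁆∣ {suc n} zero    = cong suc (∣∣-empty {n} ⟪ (λ i → suc i Fin.≟ zero) ⟫ λ ())
  ∣⁅i⁆∣ {suc n} (suc i) = trans (∣∣-cong {n} {⟪ (λ j → suc j Fin.≟ suc i) ⟫} {⁅ i ⁆} Fin.suc-injective (cong suc))
                                (∣⁅i⁆∣ i)

∣∣-remove : {i : Fin n} (A : Sub n) → i ∈ A → ∣ A ∣ ≡ suc ∣ A ∖ ⁅ i ⁆ ∣
∣∣-remove {i = i} A i∈A = begin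
  ∣ A ∣                               ≡⟨ ∣∣-split A ⁅ i ⁆ ⟨
  ∣ A ∩ ⁅ i ⁆ ∣ + ∣ A ∖ ⁅ i ⁆ ∣       ≡⟨ cong (_+ ∣ A ∖ ⁅ i ⁆ ∣)
                                           (∣∣-cong {A = A ∩ ⁅ i ⁆} {⁅ i ⁆} proj₂ λ { refl → i∈A , refl }) ⟩
  ∣ ⁅ i ⁆ ∣ + ∣ A ∖ ⁅ i ⁆ ∣           ≡⟨ cong (_+ ∣ A ∖ ⁅ i ⁆ ∣) (∣⁅i⁆∣ i) ⟩
  suc ∣ A ∖ ⁅ i ⁆ ∣                   ∎
  where open ≡-Reasoning

∣∣-∈ : {i : Fin n} (A : Sub n) → i ∈ A → 1 ≤ ∣ A ∣
∣∣-∈ A i∈A = subst (1 ≤_) (sym (∣∣-remove A i∈A)) (s≤s z≤n)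

∣∣-< : {i : Fin n} {A B : Sub n} → A ⊆ B → i ∈ B → ¬ i ∈ A → ∣ A ∣ < ∣ B ∣
∣∣-< {i = i} {A} {B} A⊆B i∈B i∉A = begin-strict
  ∣ A ∣               ≤⟨ ∣∣-mono {A = A} {B ∖ ⁅ i ⁆} (λ a → A⊆B a , λ { refl → i∉A a }) ⟩
  ∣ B ∖ ⁅ i ⁆ ∣       <⟨ ℕ.≤-refl ⟩
  suc ∣ B ∖ ⁅ i ⁆ ∣   ≡⟨ ∣∣-remove B i∈B ⟨
  ∣ B ∣               ∎
  where open ℕ.≤-Reasoning

opaque
  unfolding ∣_∣

  ∣full∣ : ∀ n → ∣ full {n} ∣ ≡ n
  ∣full∣ zero    = refl
  ∣full∣ (suc n) = cong suc (∣full∣ n)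

∣∣≤n : (A : Sub n) → ∣ A ∣ ≤ n
∣∣≤n {n} A = subst (∣ A ∣ ≤_) (∣full∣ n) (∣∣-mono {A = A} {full} _)

opaque
  pick : ∀ m (A : Sub n) → m ≤ ∣ A ∣ →
         ∃ λ (φ : Fin m → Fin n) → Injective _≡_ _≡_ φ × (∀ i → φ i ∈ A)
  pick zero    A _ = (λ ()) , (λ { {()} }) , λ ()
  pick {n} (suc m) A m<∣A∣
    with a , a∈A ← ∣∣-positive A (ℕ.≤-trans (s≤s z≤n) m<∣A∣)
    with φ , inj , φ∈ ← pick m (A ∖ ⁅ a ⁆) (s≤s⁻¹ (subst (suc m ≤_) (∣∣-remove A a∈A) m<∣A∣))
    = ψ , ψ-inj , ψ∈
    where
    ψ : Fin (suc m) → Fin n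
    ψ zero    = a
    ψ (suc i) = φ i
    ψ∈ : ∀ i → ψ i ∈ A
    ψ∈ zero    = a∈A
    ψ∈ (suc i) = proj₁ (φ∈ i)
    ψ-inj : Injective _≡_ _≡_ ψ
    ψ-inj {zero}  {zero}  _  = refl
    ψ-inj {zero}  {suc j} eq = contradiction (sym eq) (proj₂ (φ∈ j))
    ψ-inj {suc i} {zero}  eq = contradiction eq (proj₂ (φ∈ i))
    ψ-inj {suc i} {suc j} eq = cong suc (inj eq)

∣∣-≥ : (φ : Fin m → Fin n) → Injective _≡_ _≡_ φ → (A : Sub n) → (∀ i → φ i ∈ A) → m ≤ ∣ A ∣
∣∣-≥ {zero}  φ inj A φ∈ = z≤n
∣∣-≥ {suc m} φ inj A φ∈ = subst (suc m ≤_) (sym (∣∣-remove A (φ∈ zero)))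
  (s≤s (∣∣-≥ (φ ∘ suc) (Fin.suc-injective ∘ inj) (A ∖ ⁅ φ zero ⁆)
    λ i → φ∈ (suc i) , λ eq → contradiction (inj eq) λ ()))

∣∣-injection : (φ : Fin m → Fin n) → Injective _≡_ _≡_ φ → (B : Sub m) (A : Sub n) →
               (∀ {i} → i ∈ B → φ i ∈ A) → ∣ B ∣ ≤ ∣ A ∣
∣∣-injection φ inj B A B→A with ψ , ψ-inj , ψ∈ ← pick ∣ B ∣ B ℕ.≤-refl =
  ∣∣-≥ (φ ∘ ψ) (ψ-inj ∘ inj) A (B→A ∘ ψ∈)

pick-two : (A : Sub n) → 2 ≤ ∣ A ∣ → ∃₂ λ i j → i ≢ j × i ∈ A × j ∈ A
pick-two A le with φ , inj , φ∈ ← pick 2 A le =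
  φ zero , φ (suc zero) , (λ eq → contradiction (inj eq) λ ()) , φ∈ zero , φ∈ (suc zero)

-- Local search and lists of colours

opaque
  -- Replaces the choice of a maximum over a finite set: the states may be functions or carry
  -- proofs, and `Opt` need only say that one kind of improvement fails. The gap `b ∸ f s`
  -- decreases.
  climb : {S : Set ℓ} {Opt : S → Set ℓ′} (f : S → ℕ) (b : ℕ) → (∀ s → f s ≤ b) →
          (∀ s → (∃ λ s′ → f s < f s′) ⊎ Opt s) → S → Σ S Opt
  climb {S = S} {Opt} f b f≤b step s₀ = go s₀ (<-wellFounded _)
    where
    go : ∀ s → Acc _<_ (b ∸ f s) → Σ S Opt
    go s (acc rec) with step s
    ... | inj₂ opt        = s , opt
    ... | inj₁ (s′ , lt) = go s′ (rec (ℕ.∸-monoʳ-< lt (f≤b s′)))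

-- In the applications `A` is a colouring that ends the induction step and `P` the structural
-- property that holds when no index supplies one.
∀-or : ∀ {A : Set} {P : Fin n → Set} → (∀ i → A ⊎ P i) → A ⊎ (∀ i → P i)
∀-or {zero}  h = inj₂ λ ()
∀-or {suc n} h with h zero | ∀-or (h ∘ suc)
... | inj₁ a | _      = inj₁ a
... | inj₂ _ | inj₁ a = inj₁ a
... | inj₂ p | inj₂ q = inj₂ λ { zero → p ; (suc i) → q i }

opaque
  without : ℕ → List ℕ → List ℕ
  without α = filter (λ c → ¬? (c ℕ.≟ α))

  without-unique : ∀ {α xs} → Unique xs → Unique (without α xs)
  without-unique {α} = Unique.filter⁺ λ c → ¬? (c ℕ.≟ α)

  ∈-without⁻ : ∀ {α c xs} → c ∈ˡ without α xs → c ∈ˡ xs × c ≢ α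
  ∈-without⁻ {α} = ∈-filter⁻ λ c → ¬? (c ℕ.≟ α)

  without-∉ : ∀ {α xs} → α ∉ˡ xs → without α xs ≡ xs
  without-∉ {α} α∉ = filter-all (λ c → ¬? (c ℕ.≟ α)) (All.tabulate λ { c∈ refl → α∉ c∈ })

  without-length : ∀ {α xs} → Unique xs → length xs ≤ suc (length (without α xs))
  without-length {α} {[]}     _        = z≤n
  without-length {α} {x ∷ xs} (x∉ ∷ u) with x ℕ.≟ α
  ... | no  x≢α  = s≤s (ℕ.≤-trans (without-length {α} u)
                     (ℕ.≤-reflexive (cong length (sym (filter-accept (λ c → ¬? (c ℕ.≟ α)) {xs = xs} x≢α)))))
  ... | yes refl = s≤s (ℕ.≤-reflexive (cong length (sym
                     (trans (filter-reject (λ c → ¬? (c ℕ.≟ x)) {xs = xs} (λ x≢x → x≢x refl))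
                            (without-∉ {x} {xs} λ x∈ → All.lookup x∉ x∈ refl)))))

infixl 6 _−_

_−_ : List ℕ → List ℕ → List ℕ
xs − ys = foldr without xs ys

−-unique : ∀ {xs} ys → Unique xs → Unique (xs − ys)
−-unique []       u = u
−-unique (y ∷ ys) u = without-unique (−-unique ys u)

−-length : ∀ {xs} ys → Unique xs → length xs ≤ length ys + length (xs − ys)
−-length []       u = ℕ.≤-refl
−-length {xs} (y ∷ ys) u = begin
  length xs                                    ≤⟨ −-length ys u ⟩
  length ys + length (xs − ys)                 ≤⟨ ℕ.+-monoʳ-≤ (length ys) (without-length {y} (−-unique ys u)) ⟩
  length ys + suc (length (xs − (y ∷ ys)))     ≡⟨ ℕ.+-suc _ _ ⟩
  suc (length ys) + length (xs − (y ∷ ys))     ∎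
  where open ℕ.≤-Reasoning

∈-−⁻ : ∀ {xs c} ys → c ∈ˡ xs − ys → c ∈ˡ xs × c ∉ˡ ys
∈-−⁻ []       c∈ = c∈ , λ ()
∈-−⁻ {xs} (y ∷ ys) c∈ with c∈′ , c≢y ← ∈-without⁻ {y} {xs = xs − ys} c∈ | c∈xs , c∉ys ← ∈-−⁻ ys (proj₁ (∈-without⁻ {y} {xs = xs − ys} c∈)) =
  c∈xs , λ { (here c≡y) → c≢y c≡y ; (there c∈ys) → c∉ys c∈ys }

element : ∀ (xs : List ℕ) → 0 < length xs → ∃ (_∈ˡ xs)
element (x ∷ _) _ = x , here refl

bounded : (f : Fin n → ℕ) → ∃ λ b → ∀ i → f i ≤ b
bounded {zero}  f = 0 , λ ()
bounded {suc n} f with b , ≤b ← bounded (f ∘ suc) = f zero ⊔ b ,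
  λ { zero → ℕ.m≤m⊔n _ _ ; (suc i) → ℕ.≤-trans (≤b i) (ℕ.m≤n⊔m (f zero) b) }

-- Kernels and Galvin's colouring argument

-- Item e joins the vertices x e and y e of a bipartite graph; p and q are the
-- preferences of the two sides.
module Preferences {n l} (x y : Fin n → Fin l) (p q : Fin n → ℕ) where

  Beats : Fin n → Fin n → Set
  Beats f e = (x f ≡ x e × p e < p f) ⊎ (y f ≡ y e × q e < q f)

  beats? : ∀ f e → Dec (Beats f e)
  beats? f e = ((x f Fin.≟ x e) ×-dec (p e ℕ.<? p f)) ⊎-dec ((y f Fin.≟ y e) ×-dec (q e ℕ.<? q f))

  beaters : Sub n → Fin n → Sub n
  beaters A e = A ∩ ⟪ (λ f → beats? f e) ⟫

  Strict : Sub n → Set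
  Strict A = ∀ {e f} → e ∈ A → f ∈ A →
    (x e ≡ x f → p e ≡ p f → e ≡ f) × (y e ≡ y f → q e ≡ q f → e ≡ f)

  -- A kernel of the line graph oriented by `Beats`, in other words a stable matching in the sense
  -- of Gale and Shapley.
  record Kernel (A : Sub n) : Set₁ where
    field
      K           : Sub n
      K⊆A         : K ⊆ A
      independent : ∀ {e f} → e ∈ K → f ∈ K → x e ≡ x f ⊎ y e ≡ y f → e ≡ f
      dominating  : ∀ {e} → e ∈ A → ¬ e ∈ K → ∃ λ f → f ∈ K × Beats f e

  module _ (A : Sub n) where

    Top : Fin n → Set
    Top e = e ∈ A × (∀ f → f ∈ A → x f ≡ x e → p f ≤ p e)

    top? : ∀ e → Dec (Top e)
    top? e = mem? A e ×-dec all? λ f → mem? A f →-dec (x f Fin.≟ x e) →-dec (p f ℕ.≤? p e)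

    top-above : ∀ e → e ∈ A → ∃ λ f → Top f × x f ≡ x e
    top-above e e∈A = proj₁ f , (proj₁ (proj₂ f) , λ g g∈A gf → proj₂ best g g∈A (trans gf (proj₂ (proj₂ f)))) ,
                      proj₂ (proj₂ f)
      where
      S : Set
      S = ∃ λ f → f ∈ A × x f ≡ x e
      Max : S → Set
      Max (f , _) = ∀ g → g ∈ A → x g ≡ x e → p g ≤ p f
      step : ∀ s → (∃ λ s′ → p (proj₁ s) < p (proj₁ s′)) ⊎ Max s
      step (f , _) with any? (λ g → mem? A g ×-dec (x g Fin.≟ x e) ×-dec (p f ℕ.<? p g))
      ... | yes (g , g∈A , ge , f<g) = inj₁ ((g , g∈A , ge) , f<g)
      ... | no ∄ = inj₂ λ g g∈A ge → ℕ.≮⇒≥ λ f<g → ∄ (g , g∈A , ge , f<g)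
      best : Σ S Max
      best = climb {Opt = Max} (p ∘ proj₁) (proj₁ (bounded p)) (proj₂ (bounded p) ∘ proj₁) step (e , e∈A , refl)
      f : S
      f = proj₁ best

  opaque
    -- Of two favourites of the X-side that compete at a Y-vertex, the loser can be
    -- discarded: whatever dominates the winner there dominates the loser.
    kernel-acc : ∀ A → Acc _<_ ∣ A ∣ → Strict A → Kernel A
    kernel-acc A (acc rec) strict
      with any? (λ e → any? (λ f → top? A e ×-dec top? A f ×-dec (y e Fin.≟ y f) ×-dec (q f ℕ.<? q e)))
    ... | yes (e , f , (e∈A , e-top) , (f∈A , _) , yef , f<e) = record
      { K = K ; K⊆A = proj₁ ∘ K⊆A ; independent = independent ; dominating = dominating′ }
      where
      A′ : Sub n
      A′ = A ∖ ⁅ f ⁆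
      open Kernel (kernel-acc A′ (rec (ℕ.≤-reflexive (sym (∣∣-remove A f∈A)))) λ e∈ f∈ → strict (proj₁ e∈) (proj₁ f∈))
      loser : ∃ λ g → g ∈ K × Beats g f
      loser with mem? K e
      ... | yes e∈K = e , e∈K , inj₂ (yef , f<e)
      ... | no  e∉K with dominating (e∈A , λ { refl → ℕ.<-irrefl refl f<e }) e∉K
      ...   | g , g∈K , inj₁ (xge , e<g) = contradiction (e-top g (proj₁ (K⊆A g∈K)) xge) (ℕ.<⇒≱ e<g)
      ...   | g , g∈K , inj₂ (yge , e<g) = g , g∈K , inj₂ (trans yge yef , ℕ.<-trans f<e e<g)
      dominating′ : ∀ {g} → g ∈ A → ¬ g ∈ K → ∃ λ h → h ∈ K × Beats h g
      dominating′ {g} g∈A g∉K with g Fin.≟ f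
      ... | yes refl = loser
      ... | no  g≢f  = dominating (g∈A , g≢f) g∉K
    -- Without competing favourites, the favourites form the kernel: any other edge is beaten at its
    -- X-end by the favourite there.
    ... | no ∄ = record
      { K = ⟪ top? A ⟫ ; K⊆A = proj₁ ; independent = independent ; dominating = dominating }
      where
      independent : ∀ {e f} → Top A e → Top A f → x e ≡ x f ⊎ y e ≡ y f → e ≡ f
      independent {e} {f} (e∈A , e-top) (f∈A , f-top) (inj₁ xef) =
        proj₁ (strict e∈A f∈A) xef (ℕ.≤-antisym (f-top e e∈A xef) (e-top f f∈A (sym xef)))
      independent {e} {f} te@(e∈A , _) tf@(f∈A , _) (inj₂ yef) =
        proj₂ (strict e∈A f∈A) yef (ℕ.≤-antisym
          (ℕ.≮⇒≥ λ lt → ∄ (e , f , te , tf , yef , lt))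
          (ℕ.≮⇒≥ λ lt → ∄ (f , e , tf , te , sym yef , lt)))
      dominating : ∀ {e} → e ∈ A → ¬ Top A e → ∃ λ f → Top A f × Beats f e
      dominating {e} e∈A ¬top with f , tf@(f∈A , f-top) , xfe ← top-above A e e∈A =
        f , tf , inj₁ (xfe , ℕ.≤∧≢⇒< (f-top e e∈A (sym xfe))
          λ eq → ¬top (subst (Top A) (sym (proj₁ (strict e∈A f∈A) (sym xfe) eq)) tf))

    kernel : ∀ A → Strict A → Kernel A
    kernel A = kernel-acc A (<-wellFounded _)

  Colouring : Sub n → (Fin n → List ℕ) → Set
  Colouring A L = ∃ λ (c : Fin n → ℕ) → (∀ {e} → e ∈ A → c e ∈ˡ L e) ×
    (∀ {e f} → e ∈ A → f ∈ A → e ≢ f → x e ≡ x f ⊎ y e ≡ y f → c e ≢ c f)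

  module _ (A : Sub n) (L : Fin n → List ℕ) (uniq : ∀ e → Unique (L e)) (α : ℕ)
           (κ : Kernel (A ∩ ⟪ (λ e → α ∈ˡ? L e) ⟫)) where
    open Kernel κ

    uncoloured-shrinks : ∀ {e} → e ∈ A → α ∈ˡ L e → ∣ A ∖ K ∣ < ∣ A ∣
    uncoloured-shrinks {e} e∈A α∈ with mem? K e
    ... | yes e∈K = ∣∣-< {A = A ∖ K} {A} proj₁ e∈A λ e∈A′ → proj₂ e∈A′ e∈K
    ... | no e∉K with f , f∈K , _ ← dominating (e∈A , α∈) e∉K =
      ∣∣-< {A = A ∖ K} {A} proj₁ (proj₁ (K⊆A f∈K)) λ f∈A′ → proj₂ f∈A′ f∈K

    -- An uncoloured edge whose list contains `α` is beaten by a member of `K`, so it loses a beater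
    -- together with the colour. The other lists keep their length.
    colour-kernel-big : (∀ {e} → e ∈ A → ∣ beaters A e ∣ < length (L e)) →
                        ∀ {e} → e ∈ A ∖ K → ∣ beaters (A ∖ K) e ∣ < length (without α (L e))
    colour-kernel-big big {e} (e∈A , e∉K) with α ∈ˡ? L e
    ... | yes α∈ with f , f∈K , b ← dominating (e∈A , α∈) e∉K = s≤s⁻¹ (begin-strict
        suc ∣ beaters (A ∖ K) e ∣         ≤⟨ ∣∣-< {A = beaters (A ∖ K) e} {beaters A e}
                                              (λ ((g∈A , _) , b) → g∈A , b)
                                              (proj₁ (K⊆A f∈K) , b) (λ ((_ , f∉K) , _) → f∉K f∈K) ⟩
        ∣ beaters A e ∣                   <⟨ big e∈A ⟩
        length (L e)                      ≤⟨ without-length (uniq e) ⟩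
        suc (length (without α (L e)))    ∎)
      where open ℕ.≤-Reasoning
    ... | no α∉ = begin-strict
        ∣ beaters (A ∖ K) e ∣             ≤⟨ ∣∣-mono {A = beaters (A ∖ K) e} {beaters A e}
                                              (λ ((g∈A , _) , b) → g∈A , b) ⟩
        ∣ beaters A e ∣                   <⟨ big e∈A ⟩
        length (L e)                      ≡⟨ cong length (without-∉ α∉) ⟨
        length (without α (L e))          ∎
      where open ℕ.≤-Reasoning

    colour-kernel : Colouring (A ∖ K) (without α ∘ L) → Colouring A L
    colour-kernel (c′ , c′∈ , c′-proper) = c , c∈ , proper
      where
      c : Fin n → ℕ
      c e with mem? K e
      ... | yes _ = α
      ... | no  _ = c′ e
      c∈ : ∀ {e} → e ∈ A → c e ∈ˡ L e
      c∈ {e} e∈A with mem? K e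
      ... | yes e∈K = proj₂ (K⊆A e∈K)
      ... | no  e∉K = proj₁ (∈-without⁻ (c′∈ (e∈A , e∉K)))
      proper : ∀ {e f} → e ∈ A → f ∈ A → e ≢ f → x e ≡ x f ⊎ y e ≡ y f → c e ≢ c f
      proper {e} {f} e∈A f∈A e≢f sh with mem? K e | mem? K f
      ... | yes e∈K | yes f∈K = λ _ → e≢f (independent e∈K f∈K sh)
      ... | yes e∈K | no  f∉K = λ eq → proj₂ (∈-without⁻ (c′∈ (f∈A , f∉K))) (sym eq)
      ... | no  e∉K | yes f∈K = proj₂ (∈-without⁻ (c′∈ (e∈A , e∉K)))
      ... | no  e∉K | no  f∉K = c′-proper (e∈A , e∉K) (f∈A , f∉K) e≢f sh

  opaque
    -- The lemma of Bondy, Boppana and Siegel: a colour that occurs in some list is given to a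
    -- kernel of the edges that allow it, and every remaining edge still has more colours than
    -- beaters.
    kernel-colouring-acc : ∀ A → Acc _<_ ∣ A ∣ → Strict A → (L : Fin n → List ℕ) → (∀ e → Unique (L e)) →
                           (∀ {e} → e ∈ A → ∣ beaters A e ∣ < length (L e)) → Colouring A L
    kernel-colouring-acc A (acc rec) strict L uniq big with any? (mem? A)
    ... | no ∅ = (λ _ → 0) , (λ e∈A → contradiction (_ , e∈A) ∅) , λ e∈A → contradiction (_ , e∈A) ∅
    ... | yes (e , e∈A) with α , α∈ ← element (L e) (ℕ.≤-trans (s≤s z≤n) (big e∈A)) =
      colour-kernel A L uniq α κ
        (kernel-colouring-acc (A ∖ Kernel.K κ) (rec (uncoloured-shrinks A L uniq α κ e∈A α∈))
          (λ e∈ f∈ → strict (proj₁ e∈) (proj₁ f∈)) (without α ∘ L) (without-unique ∘ uniq)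
          (colour-kernel-big A L uniq α κ big))
      where
      κ : Kernel (A ∩ ⟪ (λ e → α ∈ˡ? L e) ⟫)
      κ = kernel (A ∩ ⟪ (λ e → α ∈ˡ? L e) ⟫) λ e∈ f∈ → strict (proj₁ e∈) (proj₁ f∈)

    kernel-colouring : ∀ A → Strict A → (L : Fin n → List ℕ) → (∀ e → Unique (L e)) →
                       (∀ {e} → e ∈ A → ∣ beaters A e ∣ < length (L e)) → Colouring A L
    kernel-colouring A = kernel-colouring-acc A (<-wellFounded _)

-- Local preferences obtained by peeling

degree : (Fin n → Fin l) → Sub n → Fin l → ℕ
degree z A u = ∣ A ∩ ⟪ (λ e → z e Fin.≟ u) ⟫ ∣

degree-mono : ∀ (z : Fin n → Fin l) {A B u} → A ⊆ B → degree z A u ≤ degree z B u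
degree-mono z {A} {B} {u} A⊆B =
  ∣∣-mono {A = A ∩ ⟪ (λ e → z e Fin.≟ u) ⟫} {B ∩ ⟪ (λ e → z e Fin.≟ u) ⟫} λ (e∈A , eq) → A⊆B e∈A , eq

Covers : (Fin n → Fin l) → Sub n → Fin l → Set
Covers z M u = ∃ λ e → e ∈ M × z e ≡ u

covers? : ∀ (z : Fin n → Fin l) M u → Dec (Covers z M u)
covers? z M u = any? λ e → mem? M e ×-dec (z e Fin.≟ u)

degree-∖ : ∀ (z : Fin n → Fin l) {A M u} → M ⊆ A → Covers z M u → degree z (A ∖ M) u < degree z A u
degree-∖ z {A} {M} {u} M⊆A (e , e∈M , eq) =
  ∣∣-< {A = (A ∖ M) ∩ ⟪ (λ e → z e Fin.≟ u) ⟫} {A ∩ ⟪ (λ e → z e Fin.≟ u) ⟫}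
    (λ ((e∈A , _) , eq) → e∈A , eq) (M⊆A e∈M , eq) λ ((_ , e∉M) , _) → e∉M e∈M

-- The bound uses the degrees at the edge itself, where Galvin's preferences, taken from a proper
-- edge colouring, give only the global maximum degree.
record LocalPreferences (x y : Fin n → Fin l) (A : Sub n) : Set where
  field
    p q    : Fin n → ℕ
    strict : Preferences.Strict x y p q A
    few    : ∀ {e} → e ∈ A → ∣ Preferences.beaters x y p q A e ∣ < degree x A (x e) ⊔ degree y A (y e)

local-swap : ∀ {x y : Fin n → Fin l} {A} → LocalPreferences y x A → LocalPreferences x y A
local-swap {x = x} {y} {A} lp = record
  { p = q ; q = p
  ; strict = λ e∈ f∈ → swap (strict e∈ f∈)
  ; few = λ {e} e∈ → begin-strict
      ∣ Preferences.beaters x y q p A e ∣   ≤⟨ ∣∣-mono {A = Preferences.beaters x y q p A e} {Preferences.beaters y x p q A e}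
                                                 (λ (f∈ , b) → f∈ , Sum.swap b) ⟩
      ∣ Preferences.beaters y x p q A e ∣   <⟨ few e∈ ⟩
      degree y A (y e) ⊔ degree x A (x e)   ≡⟨ ℕ.⊔-comm (degree y A (y e)) _ ⟩
      degree x A (x e) ⊔ degree y A (y e)   ∎ }
  where
  open LocalPreferences lp
  open ℕ.≤-Reasoning hiding (strict)

-- The edges of a peel become the favourites of their x-ends and the last
-- choices of their y-ends, which spoils only the edges at a covered x-end.
record Peel (x y : Fin n → Fin l) (A M : Sub n) : Set where
  field
    M⊆A      : M ⊆ A
    nonempty : ∃ λ e → e ∈ M
    once     : ∀ {e f} → e ∈ M → f ∈ M → x e ≡ x f → e ≡ f
    closed   : ∀ {f} → f ∈ A → Covers x M (x f) →
               degree y A (y f) < degree x A (x f) ⊎ Covers y M (y f)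

module _ {x y : Fin n → Fin l} {A M : Sub n} (peel : Peel x y A M)
         (lp : LocalPreferences x y (A ∖ M)) where
  open Peel peel
  open LocalPreferences lp
  private
    b : ℕ
    b = proj₁ (bounded p)

    p≤b : ∀ i → p i ≤ b
    p≤b = proj₂ (bounded p)

    -- `b` bounds `p` and each `toℕ e` is below `n`, so the edges of `M` come above all others in
    -- `p′` and below all others in `q′`. The summand `toℕ e` orders `M` at a y-end, where several
    -- of its edges may meet.
    p′ q′ : Fin n → ℕ
    p′ e with mem? M e
    ... | yes _ = suc (b + toℕ e)
    ... | no  _ = p e
    q′ e with mem? M e
    ... | yes _ = toℕ e
    ... | no  _ = n + q e

    open Preferences x y p′ q′ using () renaming (beaters to beaters′; Strict to Strict′; Beats to Beats′)

    strict′ : Strict′ A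
    strict′ {e} {f} e∈A f∈A with mem? M e | mem? M f
    ... | yes _   | yes _   = (λ _ eq → Fin.toℕ-injective (ℕ.+-cancelˡ-≡ b _ _ (ℕ.suc-injective eq))) ,
                              (λ _ eq → Fin.toℕ-injective eq)
    ... | yes _   | no _    = (λ _ eq → contradiction (ℕ.≤-trans (s≤s (ℕ.m≤m+n b _)) (ℕ.≤-reflexive eq)) (ℕ.≤⇒≯ (p≤b f))) ,
                              (λ _ eq → contradiction (ℕ.≤-trans (ℕ.m≤m+n n _) (ℕ.≤-reflexive (sym eq))) (ℕ.<⇒≱ (Fin.toℕ<n e)))
    ... | no _    | yes _   = (λ _ eq → contradiction (ℕ.≤-trans (s≤s (ℕ.m≤m+n b _)) (ℕ.≤-reflexive (sym eq))) (ℕ.≤⇒≯ (p≤b e))) ,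
                              (λ _ eq → contradiction (ℕ.≤-trans (ℕ.m≤m+n n _) (ℕ.≤-reflexive eq)) (ℕ.<⇒≱ (Fin.toℕ<n f)))
    ... | no  e∉M | no  f∉M = (λ xef eq → proj₁ (strict (e∈A , e∉M) (f∈A , f∉M)) xef eq) ,
                              (λ yef eq → proj₂ (strict (e∈A , e∉M) (f∈A , f∉M)) yef (ℕ.+-cancelˡ-≡ n _ _ eq))

    beats-M : ∀ {e f} → e ∈ M → Beats′ f e → y f ≡ y e × f ≢ e
    beats-M {e} {f} e∈M b with mem? M e | mem? M f
    ... | no e∉M | _ = contradiction e∈M e∉M
    beats-M {e} {f} e∈M (inj₁ (xfe , lt)) | yes _ | yes f∈M with refl ← once e∈M f∈M (sym xfe) = contradiction lt (ℕ.<-irrefl refl)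
    beats-M {e} {f} e∈M (inj₁ (xfe , lt)) | yes _ | no _    = contradiction (ℕ.≤-trans (s≤s (ℕ.m≤m+n b (toℕ e))) (ℕ.<⇒≤ lt)) (ℕ.≤⇒≯ (p≤b f))
    beats-M {e} {f} e∈M (inj₂ (yfe , lt)) | yes _ | yes _   = yfe , λ { refl → ℕ.<-irrefl refl lt }
    beats-M {e} {f} e∈M (inj₂ (yfe , lt)) | yes _ | no f∉M  = yfe , λ { refl → f∉M e∈M }

    beats-rest : ∀ {e f} → ¬ e ∈ M → f ∈ A → Beats′ f e →
                 f ∈ Preferences.beaters x y p q (A ∖ M) e ⊎ f ∈ M ∩ ⟪ (λ g → x g Fin.≟ x e) ⟫
    beats-rest {e} {f} e∉M f∈A b with mem? M e | mem? M f
    ... | yes e∈M | _ = contradiction e∈M e∉M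
    beats-rest {e} {f} e∉M f∈A (inj₁ (xfe , lt)) | no _ | yes f∈M = inj₂ (f∈M , xfe)
    beats-rest {e} {f} e∉M f∈A (inj₂ (yfe , lt)) | no _ | yes f∈M =
      contradiction (ℕ.≤-trans (ℕ.m≤m+n n _) (ℕ.<⇒≤ lt)) (ℕ.<⇒≱ (Fin.toℕ<n f))
    beats-rest {e} {f} e∉M f∈A (inj₁ (xfe , lt)) | no _ | no f∉M = inj₁ ((f∈A , f∉M) , inj₁ (xfe , lt))
    beats-rest {e} {f} e∉M f∈A (inj₂ (yfe , lt)) | no _ | no f∉M =
      inj₁ ((f∈A , f∉M) , inj₂ (yfe , ℕ.+-cancelˡ-< n _ _ lt))

    -- An edge of `M` is beaten only by other edges at its y-end. An edge with uncovered x-end gets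
    -- no new beater. An edge with covered x-end gets exactly one, but `closed` makes the maximum of
    -- its two degrees drop as well when `M` is removed.
    few′ : ∀ {e} → Dec (e ∈ M) → Dec (Covers x M (x e)) → e ∈ A →
           ∣ beaters′ A e ∣ < degree x A (x e) ⊔ degree y A (y e)
    few′ {e} (yes e∈M) _ e∈A = begin-strict
        ∣ beaters′ A e ∣                      <⟨ ∣∣-< {A = beaters′ A e} {A ∩ ⟪ (λ f → y f Fin.≟ y e) ⟫}
                                                  (λ (f∈A , b) → f∈A , proj₁ (beats-M e∈M b)) (e∈A , refl)
                                                  (λ (_ , b) → proj₂ (beats-M e∈M b) refl) ⟩
        degree y A (y e)                      ≤⟨ ℕ.m≤n⊔m (degree x A (x e)) _ ⟩
        degree x A (x e) ⊔ degree y A (y e)   ∎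
      where open ℕ.≤-Reasoning
    few′ {e} (no e∉M) (no ¬cov) e∈A = begin-strict
        ∣ beaters′ A e ∣                          ≤⟨ ∣∣-mono {A = beaters′ A e} {Preferences.beaters x y p q (A ∖ M) e}
                                                      (λ (f∈A , b) → [ id , (λ (g∈M , eq) → contradiction (_ , g∈M , eq) ¬cov) ]′
                                                                       (beats-rest e∉M f∈A b)) ⟩
        ∣ Preferences.beaters x y p q (A ∖ M) e ∣ <⟨ few (e∈A , e∉M) ⟩
        degree x (A ∖ M) (x e) ⊔ degree y (A ∖ M) (y e)
          ≤⟨ ℕ.⊔-mono-≤ (degree-mono x {A ∖ M} {A} proj₁) (degree-mono y {A ∖ M} {A} proj₁) ⟩
        degree x A (x e) ⊔ degree y A (y e)       ∎
      where open ℕ.≤-Reasoning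
    few′ {e} (no e∉M) (yes cov@(g , g∈M , xge)) e∈A = begin-strict
        ∣ beaters′ A e ∣
          ≤⟨ ∣∣-cover {A = ⁅ g ⁆} {Preferences.beaters x y p q (A ∖ M) e} {beaters′ A e}
               (λ (f∈A , b) → Sum.swap (Sum.map₂ (λ (f∈M , eq) → once f∈M g∈M (trans eq (sym xge))) (beats-rest e∉M f∈A b))) ⟩
        ∣ ⁅ g ⁆ ∣ + ∣ Preferences.beaters x y p q (A ∖ M) e ∣
          ≡⟨ cong (_+ _) (∣⁅i⁆∣ g) ⟩
        suc ∣ Preferences.beaters x y p q (A ∖ M) e ∣
          ≤⟨ few (e∈A , e∉M) ⟩
        degree x (A ∖ M) (x e) ⊔ degree y (A ∖ M) (y e)
          <⟨ ℕ.⊔-lub (ℕ.≤-trans x-drop (ℕ.m≤m⊔n _ _)) (y-drop (closed e∈A cov)) ⟩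
        degree x A (x e) ⊔ degree y A (y e) ∎
      where
      open ℕ.≤-Reasoning
      x-drop : degree x (A ∖ M) (x e) < degree x A (x e)
      x-drop = degree-∖ x {A} {M} M⊆A cov
      y-drop : degree y A (y e) < degree x A (x e) ⊎ Covers y M (y e) →
               degree y (A ∖ M) (y e) < degree x A (x e) ⊔ degree y A (y e)
      y-drop (inj₁ lt)  = ℕ.≤-trans (s≤s (degree-mono y {A ∖ M} {A} proj₁)) (ℕ.≤-trans lt (ℕ.m≤m⊔n _ _))
      y-drop (inj₂ cov) = ℕ.≤-trans (degree-∖ y {A} {M} M⊆A cov) (ℕ.m≤n⊔m (degree x A (x e)) _)

  peel-preferences : LocalPreferences x y A
  peel-preferences = record { p = p′ ; q = q′ ; strict = strict′ ; few = few′ (mem? M _) (covers? x M (x _)) }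

-- Peels from alternating walks

module HeavyVertices (x y : Fin n → Fin l) (A : Sub n) (Δ : ℕ)
  (x≤Δ : ∀ {e} → e ∈ A → degree x A (x e) ≤ Δ) (y≤Δ : ∀ {e} → e ∈ A → degree y A (y e) ≤ Δ) where

  HeavyX HeavyY : Fin l → Set
  HeavyX u = degree x A u ≡ Δ
  HeavyY u = degree y A u ≡ Δ

  -- A system of edges at the heavy Y-vertices. It is modified until its edges meet all heavy
  -- X-vertices with a heavy neighbour, or until the search for an improvement closes up; both
  -- outcomes contain a peel.
  Choice : Set
  Choice = ∃ λ (ψ : Fin l → Fin n) → ∀ v → HeavyY v → ψ v ∈ A × y (ψ v) ≡ v

  Covered : Choice → Fin l → Set
  Covered (ψ , _) u = ∃ λ v → HeavyY v × x (ψ v) ≡ u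

  covered? : ∀ ψ u → Dec (Covered ψ u)
  covered? (ψ , _) u = any? λ v → (degree y A v ℕ.≟ Δ) ×-dec (x (ψ v) Fin.≟ u)

  -- Alternating walks: along any edge of `A` to a heavy Y-vertex, then back along its chosen edge.
  -- The number of steps bounds the recursion of `augment`.
  data Reach (ψ : Choice) (u₀ : Fin l) : ℕ → Fin l → Set where
    start : ∀ {e} → e ∈ A → HeavyY (y e) → x e ≡ u₀ → Reach ψ u₀ 0 (y e)
    step  : ∀ {j v e} → Reach ψ u₀ j v → e ∈ A → HeavyY (y e) → x e ≡ x (proj₁ ψ v) → Reach ψ u₀ (suc j) (y e)

  reach-heavy : ∀ {ψ u₀ j v} → Reach ψ u₀ j v → HeavyY v
  reach-heavy (start _ hy _)  = hy
  reach-heavy (step _ _ hy _) = hy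

  -- v can be reassigned without uncovering a heavy X-vertex.
  Spare : Choice → Fin l → Set
  Spare (ψ , _) v = ¬ HeavyX (x (ψ v)) ⊎ ∃ λ w → w ≢ v × HeavyY w × x (ψ w) ≡ x (ψ v)

  spare? : ∀ ψ v → Dec (Spare ψ v)
  spare? (ψ , _) v = ¬? (degree x A (x (ψ v)) ℕ.≟ Δ) ⊎-dec
    any? λ w → ¬? (w Fin.≟ v) ×-dec (degree y A w ℕ.≟ Δ) ×-dec (x (ψ w) Fin.≟ x (ψ v))

  module Reassign (ψ : Choice) {e : Fin n} (e∈A : e ∈ A) where
    reassign : Fin l → Fin n
    reassign w with w Fin.≟ y e
    ... | yes _ = e
    ... | no  _ = proj₁ ψ w

    reassign-same : ∀ {w} → w ≡ y e → reassign w ≡ e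
    reassign-same {w} eq with w Fin.≟ y e
    ... | yes _  = refl
    ... | no neq = contradiction eq neq

    reassign-other : ∀ {w} → w ≢ y e → reassign w ≡ proj₁ ψ w
    reassign-other {w} neq with w Fin.≟ y e
    ... | yes eq = contradiction eq neq
    ... | no _   = refl

    ψ′ : Choice
    ψ′ = reassign , valid
      where
      valid : ∀ v → HeavyY v → reassign v ∈ A × y (reassign v) ≡ v
      valid v hv with v Fin.≟ y e
      ... | yes eq = e∈A , sym eq
      ... | no _   = proj₂ ψ v hv

    still-covered : Spare ψ (y e) → ∀ u → HeavyX u → Covered ψ u → Covered ψ′ u
    still-covered spare u hu (w , hw , eq) with w Fin.≟ y e
    ... | no w≢ = w , hw , trans (cong x (reassign-other w≢)) eq
    still-covered (inj₁ light) u hu (w , hw , refl) | yes refl = contradiction hu light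
    still-covered (inj₂ (w′ , w′≢ , hw′ , eq′)) u hu (w , hw , eq) | yes refl =
      w′ , hw′ , trans (cong x (reassign-other w′≢)) (trans eq′ eq)

    -- Only a step that leaves `y e` along its old edge is destroyed by the reassignment, and the
    -- part of the walk before it is a shorter walk to `y e`.
    reach′ : ∀ {u₀ j w} → Reach ψ u₀ j w → Reach ψ′ u₀ j w ⊎ ∃ λ i → i < j × Reach ψ u₀ i (y e)
    reach′ (start a h eq) = inj₁ (start a h eq)
    reach′ (step {j} {v} r a h eq) with v Fin.≟ y e
    ... | yes refl = inj₂ (j , ℕ.≤-refl , r)
    ... | no v≢ with reach′ r
    ...   | inj₁ r′             = inj₁ (step r′ a h (trans eq (cong x (sym (reassign-other v≢)))))
    ...   | inj₂ (i , i<j , r′) = inj₂ (i , ℕ.m<n⇒m<1+n i<j , r′)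

  -- Reassigning the last vertex of the walk to the edge `e` by which it was reached makes the
  -- previous vertex `v` spare, since both then cover `x (ψ v)`. Spareness thus moves back along the
  -- walk to its start, whose new edge covers `u₀`. If the reassignment breaks the walk, a shorter
  -- one is used instead.
  augment : ∀ b {j} → j ≤ b → ∀ ψ {u₀ v} → Reach ψ u₀ j v → Spare ψ v →
            ∃ λ ψ′ → (∀ u → HeavyX u → Covered ψ u → Covered ψ′ u) × Covered ψ′ u₀
  augment b j≤b ψ (start {e} e∈A hy xe) spare =
    ψ′ , still-covered spare , (y e , hy , trans (cong x (reassign-same refl)) xe)
    where open Reassign ψ e∈A
  augment (suc b) (s≤s j≤b) ψ (step {v = v} {e} r e∈A hy eq) spare with v Fin.≟ y e
  ... | yes refl = augment b j≤b ψ r spare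
  ... | no v≢ with Reassign.reach′ ψ e∈A r
  ...   | inj₂ (i , i<j , r′) = augment b (ℕ.≤-trans (ℕ.<⇒≤ i<j) j≤b) ψ r′ spare
  ...   | inj₁ r′
    with ψ″ , keep , cov ← augment b j≤b (Reassign.ψ′ ψ e∈A) r′
           (inj₂ (y e , ≢-sym v≢ , hy , trans (cong x (Reassign.reassign-same ψ e∈A refl))
             (trans eq (cong x (sym (Reassign.reassign-other ψ e∈A v≢))))))
    = ψ″ , (λ u hu c → keep u hu (Reassign.still-covered ψ e∈A spare u hu c)) , cov

  module _ (ψ : Choice) (u₀ : Fin l) where

    Reached : Set₁
    Reached = ∃ λ (V : Sub l) → ∀ v → v ∈ V → ∃ λ j → Reach ψ u₀ j v

    Closed : Reached → Set
    Closed (V , _) = ∀ e → e ∈ A → HeavyY (y e) → x e ≡ u₀ ⊎ (∃ λ v → v ∈ V × x e ≡ x (proj₁ ψ v)) → y e ∈ V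

    closure : Σ Reached Closed
    closure = climb {Opt = Closed} (λ (V , _) → ∣ V ∣) l (λ (V , _) → ∣∣≤n V) extend (∅ , λ _ ())
      where
      extend : ∀ s → (∃ λ s′ → ∣ proj₁ s ∣ < ∣ proj₁ s′ ∣) ⊎ Closed s
      extend (V , reached) with any? (λ e → mem? A e ×-dec (degree y A (y e) ℕ.≟ Δ) ×-dec
          ((x e Fin.≟ u₀) ⊎-dec any? λ v → mem? V v ×-dec (x e Fin.≟ x (proj₁ ψ v))) ×-dec ¬? (mem? V (y e)))
      ... | no ∄ = inj₂ λ e e∈A hy r → decidable-stable (mem? V (y e)) λ ∉V → ∄ (e , e∈A , hy , r , ∉V)
      ... | yes (e , e∈A , hy , r , ∉V) =
        inj₁ ((V ∪ ⁅ y e ⁆ , reached′) , ∣∣-< {A = V} {V ∪ ⁅ y e ⁆} inj₁ (inj₂ refl) ∉V)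
        where
        reach-y : x e ≡ u₀ ⊎ (∃ λ v → v ∈ V × x e ≡ x (proj₁ ψ v)) → ∃ λ j → Reach ψ u₀ j (y e)
        reach-y (inj₁ eq)             = 0 , start e∈A hy eq
        reach-y (inj₂ (v , v∈V , eq)) with j , rv ← reached v v∈V = suc j , step rv e∈A hy eq
        reached′ : ∀ v → v ∈ V ∪ ⁅ y e ⁆ → ∃ λ j → Reach ψ u₀ j v
        reached′ v (inj₁ v∈V)  = reached v v∈V
        reached′ v (inj₂ refl) = reach-y r

  Target : Fin l → Set
  Target u = HeavyX u × ∃ λ e → e ∈ A × x e ≡ u × HeavyY (y e)

  target? : ∀ u → Dec (Target u)
  target? u = (degree x A u ℕ.≟ Δ) ×-dec any? λ e → mem? A e ×-dec (x e Fin.≟ u) ×-dec (degree y A (y e) ℕ.≟ Δ)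

  value : Choice → ℕ
  value ψ = ∣ ⟪ (λ u → (degree x A u ℕ.≟ Δ) ×-dec covered? ψ u) ⟫ ∣

  Goal : Choice → Set₁
  Goal ψ = (∃ λ M → Peel x y A M) ⊎ (∀ u → Target u → Covered ψ u)

  -- A spare vertex among the reached ones allows an augmentation. If there is none, the chosen
  -- edges of the reached vertices end in distinct heavy X-vertices, and an edge of `A` at such an
  -- X-vertex leads either to a light Y-vertex or to a reached one. These are the conditions of a
  -- peel from the X-side.
  improve-at : ∀ ψ {u₀} → Target u₀ → ¬ Covered ψ u₀ → Σ (Reached ψ u₀) (Closed ψ u₀) →
               (∃ λ ψ′ → value ψ < value ψ′) ⊎ ∃ λ M → Peel x y A M
  improve-at ψ {u₀} (hu₀ , e₀ , e₀∈A , xe₀ , hye₀) ¬cov ((V , reached) , closed)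
    with any? (λ v → mem? V v ×-dec spare? ψ v)
  ... | yes (v , v∈V , spare) with j , r ← reached v v∈V with ψ′ , keep , cov ← augment j ℕ.≤-refl ψ r spare =
    inj₁ (ψ′ , ∣∣-< {A = ⟪ (λ u → (degree x A u ℕ.≟ Δ) ×-dec covered? ψ u) ⟫} {⟪ (λ u → (degree x A u ℕ.≟ Δ) ×-dec covered? ψ′ u) ⟫}
                 (λ (hu , c) → hu , keep _ hu c) (hu₀ , cov) λ (_ , c) → ¬cov c)
  ... | no ∄spare = inj₂ (M , record
    { M⊆A      = M⊆A
    ; nonempty = proj₁ ψ (y e₀) , in-M (closed e₀ e₀∈A hye₀ (inj₁ xe₀))
    ; once     = once
    ; closed   = closed′ })
    where
    M : Sub n
    M = ⟪ (λ e → mem? V (y e) ×-dec (proj₁ ψ (y e) Fin.≟ e)) ⟫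
    heavy : ∀ {v} → v ∈ V → HeavyY v
    heavy v∈V = reach-heavy (proj₂ (reached _ v∈V))
    M⊆A : M ⊆ A
    M⊆A {e} (v∈V , eq) = subst (_∈ A) eq (proj₁ (proj₂ ψ (y e) (heavy v∈V)))
    in-M : ∀ {v} → v ∈ V → proj₁ ψ v ∈ M
    in-M {v} v∈V = subst (_∈ V) (sym yψ) v∈V , cong (proj₁ ψ) yψ
      where
      yψ : y (proj₁ ψ v) ≡ v
      yψ = proj₂ (proj₂ ψ v (heavy v∈V))
    once : ∀ {e f} → e ∈ M → f ∈ M → x e ≡ x f → e ≡ f
    once {e} {f} (ye∈V , ψe) (yf∈V , ψf) xef with y f Fin.≟ y e
    ... | yes eq = trans (sym ψe) (trans (cong (proj₁ ψ) (sym eq)) ψf)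
    ... | no neq = contradiction (y e , ye∈V , inj₂ (y f , neq , heavy yf∈V ,
                     trans (cong x ψf) (trans (sym xef) (cong x (sym ψe))))) ∄spare
    closed′ : ∀ {f} → f ∈ A → Covers x M (x f) → degree y A (y f) < degree x A (x f) ⊎ Covers y M (y f)
    closed′ {f} f∈A (g , (yg∈V , ψg) , xgf) with degree y A (y f) ℕ.≟ Δ
    ... | yes hyf = inj₂ (proj₁ ψ (y f) , in-M yf∈V , proj₂ (proj₂ ψ (y f) hyf))
      where
      yf∈V : y f ∈ V
      yf∈V = closed f f∈A hyf (inj₂ (y g , yg∈V , trans (sym xgf) (cong x (sym ψg))))
    ... | no ¬hyf = inj₁ (subst (degree y A (y f) <_) (sym hxf) (ℕ.≤∧≢⇒< (y≤Δ f∈A) ¬hyf))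
      where
      hxf : HeavyX (x f)
      hxf = decidable-stable (degree x A (x f) ℕ.≟ Δ) λ ¬hxf → ∄spare (y g , yg∈V ,
              inj₁ λ h → ¬hxf (subst HeavyX (trans (cong x ψg) xgf) h))

  improve : ∀ ψ → (∃ λ ψ′ → value ψ < value ψ′) ⊎ Goal ψ
  improve ψ with any? (λ u → target? u ×-dec ¬? (covered? ψ u))
  ... | no ∄ = inj₂ (inj₂ λ u t → decidable-stable (covered? ψ u) λ ¬cov → ∄ (u , t , ¬cov))
  ... | yes (u₀ , t , ¬cov) = Sum.map₂ inj₁ (improve-at ψ t ¬cov (closure ψ u₀))

  initial : ∀ {e₀} → e₀ ∈ A → HeavyY (y e₀) → Choice
  initial {e₀} e₀∈A hye₀ = (λ v → proj₁ (choose v)) , λ v → proj₂ (choose v)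
    where
    choose : ∀ v → ∃ λ e → HeavyY v → e ∈ A × y e ≡ v
    choose v with degree y A v ℕ.≟ Δ
    ... | no ¬hv = e₀ , λ hv → contradiction hv ¬hv
    ... | yes hv with e , e∈ , eq ← ∣∣-positive (A ∩ ⟪ (λ e → y e Fin.≟ v) ⟫)
                     (subst (1 ≤_) (trans hye₀ (sym hv)) (∣∣-∈ (A ∩ ⟪ (λ e → y e Fin.≟ y e₀) ⟫) (e₀∈A , refl)))
                = e , λ _ → e∈ , eq

  -- Without a heavy X-vertex left to cover, the chosen edges peel from the Y-side.
  heavy-peel : ∀ {e₀} → e₀ ∈ A → HeavyY (y e₀) → (∃ λ M → Peel x y A M) ⊎ (∃ λ M → Peel y x A M)
  heavy-peel {e₀} e₀∈A hye₀ with climb {Opt = Goal} value l (λ ψ → ∣∣≤n _) improve (initial e₀∈A hye₀)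
  ... | _ , inj₁ peel = inj₁ peel
  ... | (ψ , valid) , inj₂ all-covered = inj₂ (M , record
    { M⊆A      = λ { {e} (hv , eq) → subst (_∈ A) eq (proj₁ (valid (y e) hv)) }
    ; nonempty = ψ (y e₀) , in-M hye₀
    ; once     = λ { {e} {f} (_ , ψe) (_ , ψf) yef → trans (sym ψe) (trans (cong ψ yef) ψf) }
    ; closed   = closed })
    where
    M : Sub n
    M = ⟪ (λ e → (degree y A (y e) ℕ.≟ Δ) ×-dec (ψ (y e) Fin.≟ e)) ⟫
    in-M : ∀ {v} → HeavyY v → ψ v ∈ M
    in-M {v} hv = subst HeavyY (sym yψ) hv , cong ψ yψ
      where
      yψ : y (ψ v) ≡ v
      yψ = proj₂ (valid v hv)
    closed : ∀ {f} → f ∈ A → Covers y M (y f) → degree x A (x f) < degree y A (y f) ⊎ Covers x M (x f)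
    closed {f} f∈A (g , (hyg , _) , ygf) with degree x A (x f) ℕ.≟ Δ
    ... | no ¬hx = inj₁ (subst (degree x A (x f) <_) (sym (subst HeavyY ygf hyg)) (ℕ.≤∧≢⇒< (x≤Δ f∈A) ¬hx))
    ... | yes hx with v , hv , eq ← all-covered (x f) (hx , f , f∈A , refl , subst HeavyY ygf hyg) =
      inj₂ (ψ v , in-M hv , eq)

-- Peels are removed until `A` is empty. They are found at the largest degree `D` that occurs at an
-- end of an edge of `A`; the two sides may take turns.
local-preferences-acc : ∀ (x y : Fin n → Fin l) A → Acc _<_ ∣ A ∣ → LocalPreferences x y A
local-preferences-acc {n} x y A (acc rec) with any? (mem? A)
... | no empty = record { p = λ _ → 0 ; q = λ _ → 0 ; strict = λ e∈A → contradiction (_ , e∈A) empty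
                        ; few = λ e∈A → contradiction (_ , e∈A) empty }
... | yes (e₀ , e₀∈A) = [ (λ (M , peel) → peel-preferences peel (local-preferences-acc x y (A ∖ M) (rec (smaller peel))))
                        , (λ (M , peel) → local-swap (peel-preferences peel (local-preferences-acc y x (A ∖ M) (rec (smaller peel)))))
                        ]′ find-peel
  where
  S : Set
  S = ∃ λ e → e ∈ A
  top : S → ℕ
  top (e , _) = degree x A (x e) ⊔ degree y A (y e)
  Max : S → Set
  Max s = ∀ t → top t ≤ top s
  step : ∀ s → (∃ λ t → top s < top t) ⊎ Max s
  step s with any? (λ e → mem? A e ×-dec (top s ℕ.<? degree x A (x e) ⊔ degree y A (y e)))
  ... | yes (e , e∈A , lt) = inj₁ ((e , e∈A) , lt)
  ... | no ∄ = inj₂ λ (e , e∈A) → ℕ.≮⇒≥ λ lt → ∄ (e , e∈A , lt)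
  best : Σ S Max
  best = climb {Opt = Max} top (n ⊔ n) (λ _ → ℕ.⊔-mono-≤ (∣∣≤n _) (∣∣≤n _)) step (e₀ , e₀∈A)
  e₁ : Fin n
  e₁ = proj₁ (proj₁ best)
  e₁∈A : e₁ ∈ A
  e₁∈A = proj₂ (proj₁ best)
  D : ℕ
  D = top (proj₁ best)
  x≤D : ∀ {e} → e ∈ A → degree x A (x e) ≤ D
  x≤D e∈A = ℕ.≤-trans (ℕ.m≤m⊔n _ _) (proj₂ best (_ , e∈A))
  y≤D : ∀ {e} → e ∈ A → degree y A (y e) ≤ D
  y≤D e∈A = ℕ.≤-trans (ℕ.m≤n⊔m _ _) (proj₂ best (_ , e∈A))
  find-peel : (∃ λ M → Peel x y A M) ⊎ (∃ λ M → Peel y x A M)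
  find-peel with any? (λ e → mem? A e ×-dec (degree y A (y e) ℕ.≟ D))
  ... | yes (e , e∈A , hy) = HeavyVertices.heavy-peel x y A D x≤D y≤D e∈A hy
  -- Now `D` is attained only on the X-side, and every edge at `x e₁` has a y-end of smaller degree,
  -- so `e₁` alone is a peel.
  ... | no ∄ = inj₁ (⁅ e₁ ⁆ , record
    { M⊆A      = λ { refl → e₁∈A }
    ; nonempty = e₁ , refl
    ; once     = λ { refl refl _ → refl }
    ; closed   = λ { {f} f∈A (_ , refl , eq) → inj₁ (subst (degree y A (y f) <_) (trans (sym heavy) (cong (degree x A) eq))
                                                      (light f∈A)) } })
    where
    light : ∀ {e} → e ∈ A → degree y A (y e) < D
    light e∈A = ℕ.≤∧≢⇒< (y≤D e∈A) λ eq → ∄ (_ , e∈A , eq)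
    heavy : degree x A (x e₁) ≡ D
    heavy with ℕ.⊔-sel (degree x A (x e₁)) (degree y A (y e₁))
    ... | inj₁ eq = sym eq
    ... | inj₂ eq = contradiction (sym eq) (ℕ.<⇒≢ (light e₁∈A))
  smaller : ∀ {z w : Fin n → Fin _} {M} → Peel z w A M → ∣ A ∖ M ∣ < ∣ A ∣
  smaller {M = M} peel with e , e∈M ← Peel.nonempty peel =
    ∣∣-< {A = A ∖ M} {A} proj₁ (Peel.M⊆A peel e∈M) λ e∈ → proj₂ e∈ e∈M

opaque
  local-preferences : ∀ (x y : Fin n → Fin l) A → LocalPreferences x y A
  local-preferences x y A = local-preferences-acc x y A (<-wellFounded _)

-- The theorem of Borodin, Kostochka and Woodall on bipartite multigraphs.
bipartite-colouring : ∀ (x y : Fin n → Fin l) (A : Sub n) (L : Fin n → List ℕ) → (∀ e → Unique (L e)) →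
  (∀ {e} → e ∈ A → degree x A (x e) ⊔ degree y A (y e) ≤ length (L e)) →
  ∃ λ (c : Fin n → ℕ) → (∀ {e} → e ∈ A → c e ∈ˡ L e) ×
    (∀ {e f} → e ∈ A → f ∈ A → e ≢ f → x e ≡ x f ⊎ y e ≡ y f → c e ≢ c f)
bipartite-colouring x y A L uniq big =
  Preferences.kernel-colouring x y p q A strict L uniq λ e∈A → ℕ.≤-trans (few e∈A) (big e∈A)
  where open LocalPreferences (local-preferences x y A)

-- Saving colours on two non-adjacent pairs

opaque
  unfolding without

  ∈-without⁺ : ∀ {α c xs} → c ∈ˡ xs → c ≢ α → c ∈ˡ without α xs
  ∈-without⁺ {α} = ∈-filter⁺ λ c → ¬? (c ℕ.≟ α)

  without-shrinks : ∀ {α xs} → α ∈ˡ xs → length (without α xs) < length xs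
  without-shrinks {α} {xs} α∈ = filter-notAll (λ c → ¬? (c ℕ.≟ α)) xs (Any.map (λ α≡ c≢ → c≢ (sym α≡)) α∈)

∈-−⁺ : ∀ {xs c} ys → c ∈ˡ xs → c ∉ˡ ys → c ∈ˡ xs − ys
∈-−⁺ []       c∈ _   = c∈
∈-−⁺ (y ∷ ys) c∈ c∉ = ∈-without⁺ (∈-−⁺ ys c∈ (c∉ ∘ there)) (c∉ ∘ here)

−-shrinks : ∀ {xs} ys → Unique ys → (∀ {c} → c ∈ˡ ys → c ∈ˡ xs) → length (xs − ys) + length ys ≤ length xs
−-shrinks []            _        _     = ℕ.≤-reflexive (ℕ.+-identityʳ _)
−-shrinks {xs} (y ∷ ys) (y∉ ∷ u) ys⊆xs = begin
  length (xs − (y ∷ ys)) + suc (length ys)     ≡⟨ ℕ.+-suc _ _ ⟩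
  suc (length (xs − (y ∷ ys))) + length ys     ≤⟨ ℕ.+-monoˡ-≤ (length ys) (without-shrinks
                                                    (∈-−⁺ ys (ys⊆xs (here refl)) λ y∈ → All.lookup y∉ y∈ refl)) ⟩
  length (xs − ys) + length ys                 ≤⟨ −-shrinks ys u (ys⊆xs ∘ there) ⟩
  length xs                                    ∎
  where open ℕ.≤-Reasoning

common? : ∀ xs ys → (∃ λ c → c ∈ˡ xs × c ∈ˡ ys) ⊎ (∀ {c} → c ∈ˡ xs → c ∉ˡ ys)
common? xs ys with Any.any? (λ c → c ∈ˡ? ys) xs
... | yes p = inj₁ (find p)
... | no ∄  = inj₂ λ c∈xs c∈ys → ∄ (Any.map (λ { refl → c∈ys }) c∈xs)

escape? : ∀ xs ys → (∃ λ c → c ∈ˡ xs × c ∉ˡ ys) ⊎ (∀ {c} → c ∈ˡ xs → c ∈ˡ ys)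
escape? xs ys with Any.any? (λ c → ¬? (c ∈ˡ? ys)) xs
... | yes p = inj₁ (find p)
... | no ∄  = inj₂ λ {c} c∈xs → decidable-stable (c ∈ˡ? ys) λ c∉ys → ∄ (Any.map (λ { refl → c∉ys }) c∈xs)

fresh-∪ : ∀ {xs ys} zs → Unique xs → Unique ys → (∀ {c} → c ∈ˡ xs → c ∉ˡ ys) → length zs < length xs + length ys →
          ∃ λ c → (c ∈ˡ xs ⊎ c ∈ˡ ys) × c ∉ˡ zs
fresh-∪ {xs} {ys} zs u v dis lt
  with c , c∈ , c∉ ← fresh zs (Unique.++⁺ u v λ (c∈xs , c∈ys) → dis c∈xs c∈ys) (subst (length zs <_) (sym (length-++ xs)) lt)
  = c , ∈-++⁻ xs c∈ , c∉

-- X and Y are the lists of two vertices that are adjacent to the non-adjacent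
-- pairs p, q and r, s and coloured after them.
record Saving (P Q R S X Y : List ℕ) : Set where
  field
    p q r s               : ℕ
    p∈ : p ∈ˡ P
    q∈ : q ∈ˡ Q
    r∈ : r ∈ˡ R
    s∈ : s ∈ˡ S
    p≢r : p ≢ r
    p≢s : p ≢ s
    q≢r : q ≢ r
    q≢s : q ≢ s
    X′ Y′ : List ℕ
    X′≤2 : length X′ ≤ 2
    Y′≤3 : length Y′ ≤ 3
    blocksX : All (λ c → c ∈ˡ X → c ∈ˡ X′) (p ∷ q ∷ r ∷ s ∷ [])
    blocksY : All (λ c → c ∈ˡ Y → c ∈ˡ Y′) (p ∷ q ∷ r ∷ s ∷ [])

module _ {P Q R S X Y : List ℕ} (σ : Saving P Q R S X Y) where
  open Saving σ

  swap-pq : Saving Q P R S X Y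
  swap-pq with bp ∷ bq ∷ br ∷ bs ∷ [] ← blocksX | bp′ ∷ bq′ ∷ br′ ∷ bs′ ∷ [] ← blocksY = record
    { p∈ = q∈ ; q∈ = p∈ ; r∈ = r∈ ; s∈ = s∈ ; p≢r = q≢r ; p≢s = q≢s ; q≢r = p≢r ; q≢s = p≢s
    ; X′≤2 = X′≤2 ; Y′≤3 = Y′≤3
    ; blocksX = bq ∷ bp ∷ br ∷ bs ∷ [] ; blocksY = bq′ ∷ bp′ ∷ br′ ∷ bs′ ∷ [] }

  swap-rs : Saving P Q S R X Y
  swap-rs with bp ∷ bq ∷ br ∷ bs ∷ [] ← blocksX | bp′ ∷ bq′ ∷ br′ ∷ bs′ ∷ [] ← blocksY = record
    { p∈ = p∈ ; q∈ = q∈ ; r∈ = s∈ ; s∈ = r∈ ; p≢r = p≢s ; p≢s = p≢r ; q≢r = q≢s ; q≢s = q≢r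
    ; X′≤2 = X′≤2 ; Y′≤3 = Y′≤3
    ; blocksX = bp ∷ bq ∷ bs ∷ br ∷ [] ; blocksY = bp′ ∷ bq′ ∷ bs′ ∷ br′ ∷ [] }

  swap-pairs : Saving R S P Q X Y
  swap-pairs with bp ∷ bq ∷ br ∷ bs ∷ [] ← blocksX | bp′ ∷ bq′ ∷ br′ ∷ bs′ ∷ [] ← blocksY = record
    { p∈ = r∈ ; q∈ = s∈ ; r∈ = p∈ ; s∈ = q∈
    ; p≢r = ≢-sym p≢r ; p≢s = ≢-sym q≢r ; q≢r = ≢-sym p≢s ; q≢s = ≢-sym q≢s
    ; X′≤2 = X′≤2 ; Y′≤3 = Y′≤3
    ; blocksX = br ∷ bs ∷ bp ∷ bq ∷ [] ; blocksY = br′ ∷ bs′ ∷ bp′ ∷ bq′ ∷ [] }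

private
  1st : ∀ {a : ℕ} {xs} → a ∈ˡ a ∷ xs
  1st = here refl
  2nd : ∀ {a b : ℕ} {xs} → b ∈ˡ a ∷ b ∷ xs
  2nd = there 1st
  3rd : ∀ {a b c : ℕ} {xs} → c ∈ˡ a ∷ b ∷ c ∷ xs
  3rd = there 2nd

module _ {X Y : List ℕ} (l : ℕ) (X≤l : length X ≤ l) where

  private
    pair-with : ∀ {P Q R S c d} → Unique S → 3 ≤ length S → c ∈ˡ P → c ∈ˡ Q → d ∈ˡ R → d ≢ c → d ∉ˡ X →
                Saving P Q R S X Y
    pair-with {c = c} {d} uS 3≤S c∈P c∈Q d∈R d≢c d∉X
      with s , s∈S , s∉ ← fresh (c ∷ []) uS (ℕ.≤-trans (s≤s (s≤s z≤n)) 3≤S) = record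
      { p∈ = c∈P ; q∈ = c∈Q ; r∈ = d∈R ; s∈ = s∈S
      ; p≢r = ≢-sym d≢c ; p≢s = λ { refl → s∉ 1st } ; q≢r = ≢-sym d≢c ; q≢s = λ { refl → s∉ 1st }
      ; X′ = c ∷ s ∷ [] ; Y′ = c ∷ d ∷ s ∷ [] ; X′≤2 = ℕ.≤-refl ; Y′≤3 = ℕ.≤-refl
      ; blocksX = (λ _ → 1st) ∷ (λ _ → 1st) ∷ (λ d∈X → contradiction d∈X d∉X) ∷ (λ _ → 2nd) ∷ []
      ; blocksY = (λ _ → 1st) ∷ (λ _ → 1st) ∷ (λ _ → 2nd) ∷ (λ _ → 3rd) ∷ [] }

  -- `c` serves both `P` and `Q`. If it misses `X`, any `r` and `s` other than `c` will do. If not,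
  -- either `R` and `S` share another colour, or without `c` they are disjoint and have at least `l`
  -- colours, against fewer than `l` in `X`, so one of `r`, `s` can be taken outside `X`.
  saving-common : ∀ {P Q R S c} → Unique R → Unique S → 3 ≤ length R → 3 ≤ length S → 2 + l ≤ length R + length S →
                  c ∈ˡ P → c ∈ˡ Q → Saving P Q R S X Y
  saving-common {R = R} {S} {c} uR uS 3≤R 3≤S RS c∈P c∈Q with c ∈ˡ? X
  ... | no c∉X with r , r∈R , r∉ ← fresh (c ∷ []) uR (ℕ.≤-trans (s≤s (s≤s z≤n)) 3≤R)
                  | s , s∈S , s∉ ← fresh (c ∷ []) uS (ℕ.≤-trans (s≤s (s≤s z≤n)) 3≤S) = record
      { p∈ = c∈P ; q∈ = c∈Q ; r∈ = r∈R ; s∈ = s∈S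
      ; p≢r = λ { refl → r∉ 1st } ; p≢s = λ { refl → s∉ 1st } ; q≢r = λ { refl → r∉ 1st } ; q≢s = λ { refl → s∉ 1st }
      ; X′ = r ∷ s ∷ [] ; Y′ = c ∷ r ∷ s ∷ [] ; X′≤2 = ℕ.≤-refl ; Y′≤3 = ℕ.≤-refl
      ; blocksX = (λ c∈X → contradiction c∈X c∉X) ∷ (λ c∈X → contradiction c∈X c∉X) ∷ (λ _ → 1st) ∷ (λ _ → 2nd) ∷ []
      ; blocksY = (λ _ → 1st) ∷ (λ _ → 1st) ∷ (λ _ → 2nd) ∷ (λ _ → 3rd) ∷ [] }
  ... | yes c∈X with common? (without c R) (without c S)
  ...   | inj₁ (d , d∈R , d∈S) = record
      { p∈ = c∈P ; q∈ = c∈Q ; r∈ = proj₁ (∈-without⁻ d∈R) ; s∈ = proj₁ (∈-without⁻ d∈S)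
      ; p≢r = c≢d ; p≢s = c≢d ; q≢r = c≢d ; q≢s = c≢d
      ; X′ = c ∷ d ∷ [] ; Y′ = c ∷ d ∷ [] ; X′≤2 = ℕ.≤-refl ; Y′≤3 = s≤s (s≤s z≤n)
      ; blocksX = (λ _ → 1st) ∷ (λ _ → 1st) ∷ (λ _ → 2nd) ∷ (λ _ → 2nd) ∷ []
      ; blocksY = (λ _ → 1st) ∷ (λ _ → 1st) ∷ (λ _ → 2nd) ∷ (λ _ → 2nd) ∷ [] }
      where
      c≢d : c ≢ d
      c≢d = ≢-sym (proj₂ (∈-without⁻ d∈R))
  ...   | inj₂ dis with fresh-∪ (without c X) (without-unique uR) (without-unique uS) dis
                          (ℕ.≤-trans (ℕ.≤-trans (without-shrinks c∈X) X≤l) (drop (without-length uR) (without-length uS) RS))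
    where
    drop : ∀ {a b a′ b′} → a ≤ suc a′ → b ≤ suc b′ → 2 + l ≤ a + b → l ≤ a′ + b′
    drop {a′ = a′} {b′} a≤ b≤ le = s≤s⁻¹ (s≤s⁻¹ (ℕ.≤-trans le (ℕ.≤-trans (ℕ.+-mono-≤ a≤ b≤)
      (ℕ.≤-reflexive (cong suc (ℕ.+-suc a′ b′))))))
  ...     | d , inj₁ d∈R , d∉ with d∈R , d≢c ← ∈-without⁻ d∈R =
            pair-with uS 3≤S c∈P c∈Q d∈R d≢c λ d∈X → d∉ (∈-without⁺ d∈X d≢c)
  ...     | d , inj₂ d∈S , d∉ with d∈S , d≢c ← ∈-without⁻ d∈S =
            swap-rs (pair-with uR 3≤R c∈P c∈Q d∈S d≢c λ d∈X → d∉ (∈-without⁺ d∈X d≢c))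

  module _ {R S : List ℕ} (uR : Unique R) (uS : Unique S) (3≤R : 3 ≤ length R) (3≤S : 3 ≤ length S)
           (RS : 2 + l ≤ length R + length S) (R∩S : ∀ {c} → c ∈ˡ R → c ∉ˡ S) where

    private
      other : ∀ c → ∃ λ d → (d ∈ˡ R ⊎ d ∈ˡ S) × d ∉ˡ c ∷ X
      other c = fresh-∪ (c ∷ X) uR uS R∩S (ℕ.≤-trans (s≤s (s≤s X≤l)) RS)

      -- `c` and `d` miss `X`, which leaves two blocking colours there. For `Y` it is enough that
      -- one of `c`, `c′` is harmless.
      from-R : ∀ {P Q R S c c′ d} → Unique S → 3 ≤ length S → c ∈ˡ P → c′ ∈ˡ Q → d ∈ˡ R → c ∉ˡ X → d ∉ˡ c ∷ X → d ≢ c′ →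
               c ∉ˡ Y ⊎ c′ ∉ˡ Y → Saving P Q R S X Y
      from-R {c = c} {c′} {d} uS 3≤S c∈P c′∈Q d∈R c∉X d∉ d≢c′ out
        with s , s∈S , s∉ ← fresh (c ∷ c′ ∷ []) uS 3≤S = record
        { p∈ = c∈P ; q∈ = c′∈Q ; r∈ = d∈R ; s∈ = s∈S
        ; p≢r = λ { refl → d∉ 1st } ; p≢s = λ { refl → s∉ 1st } ; q≢r = ≢-sym d≢c′ ; q≢s = λ { refl → s∉ 2nd }
        ; X′ = c′ ∷ s ∷ [] ; Y′ = proj₁ (blocked out) ; X′≤2 = ℕ.≤-refl ; Y′≤3 = proj₁ (proj₂ (blocked out))
        ; blocksX = (λ c∈X → contradiction c∈X c∉X) ∷ (λ _ → 1st) ∷ (λ d∈X → contradiction (there d∈X) d∉) ∷ (λ _ → 2nd) ∷ []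
        ; blocksY = proj₂ (proj₂ (blocked out)) }
        where
        blocked : c ∉ˡ Y ⊎ c′ ∉ˡ Y → ∃ λ Y′ → length Y′ ≤ 3 × All (λ a → a ∈ˡ Y → a ∈ˡ Y′) (c ∷ c′ ∷ d ∷ s ∷ [])
        blocked (inj₁ c∉Y)  = c′ ∷ d ∷ s ∷ [] , ℕ.≤-refl ,
                (λ c∈Y → contradiction c∈Y c∉Y) ∷ (λ _ → 1st) ∷ (λ _ → 2nd) ∷ (λ _ → 3rd) ∷ []
        blocked (inj₂ c′∉Y) = c ∷ d ∷ s ∷ [] , ℕ.≤-refl ,
                (λ _ → 1st) ∷ (λ c′∈Y → contradiction c′∈Y c′∉Y) ∷ (λ _ → 2nd) ∷ (λ _ → 3rd) ∷ []

      from-both : ∀ {P Q c c′ d} → c ∈ˡ P → c′ ∈ˡ Q → d ∈ˡ R ⊎ d ∈ˡ S → c ∉ˡ X → d ∉ˡ c ∷ X → d ≢ c′ →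
                  c ∉ˡ Y ⊎ c′ ∉ˡ Y → Saving P Q R S X Y
      from-both c∈P c′∈Q (inj₁ d∈R) c∉X d∉ d≢c′ out = from-R uS 3≤S c∈P c′∈Q d∈R c∉X d∉ d≢c′ out
      from-both c∈P c′∈Q (inj₂ d∈S) c∉X d∉ d≢c′ out = swap-rs (from-R uR 3≤R c∈P c′∈Q d∈S c∉X d∉ d≢c′ out)

      missing : ∀ {P Q c} → Unique Q → 3 ≤ length Q → c ∈ˡ P → c ∉ˡ X → c ∉ˡ Y → Saving P Q R S X Y
      missing {c = c} uQ 3≤Q c∈P c∉X c∉Y
        with d , d∈ , d∉ ← other c
        with c′ , c′∈Q , c′∉ ← fresh (d ∷ []) uQ (ℕ.≤-trans (s≤s (s≤s z≤n)) 3≤Q)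
        = from-both c∈P c′∈Q d∈ c∉X d∉ (λ { refl → c′∉ 1st }) (inj₁ c∉Y)

      -- If `c′` misses `X` too, it misses both lists. Otherwise it lies in `X`, and so differs from
      -- the colour `d` of `R` or `S` that was chosen outside `X`.
      crossing : ∀ {P Q c c′} → Unique P → 3 ≤ length P → c ∈ˡ P → c′ ∈ˡ Q → c ∉ˡ X → c′ ∉ˡ Y → Saving P Q R S X Y
      crossing {c = c} {c′} uP 3≤P c∈P c′∈Q c∉X c′∉Y with c′ ∈ˡ? X
      ... | no c′∉X = swap-pq (missing uP 3≤P c′∈Q c′∉X c′∉Y)
      ... | yes c′∈X with d , d∈ , d∉ ← other c =
        from-both c∈P c′∈Q d∈ c∉X d∉ (λ { refl → d∉ (there c′∈X) }) (inj₂ c′∉Y)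

    -- By size, P ∪ Q has a colour outside `X` and one outside `Y`. If such colours can be found in
    -- different sets, `crossing` applies. Otherwise one of the sets is contained in both `X` and
    -- `Y`, and the last two inequalities are made for this case.
    saving-disjoint : ∀ {P Q} → Unique P → Unique Q → 3 ≤ length P → 3 ≤ length Q → (∀ {c} → c ∈ˡ P → c ∉ˡ Q) →
                      length Y ≤ l → 2 + l ≤ length P + length Q →
                      l + l < length P + length Q + length P → l + l < length P + length Q + length Q →
                      Saving P Q R S X Y
    saving-disjoint {P} {Q} uP uQ 3≤P 3≤Q P∩Q Y≤l PQ PQP PQQ
      with c , c∈ , c∉X ← fresh-∪ X uP uQ P∩Q (ℕ.≤-trans (s≤s X≤l) (ℕ.<⇒≤ PQ)) = by-side c∈ c∉X
      where
      half : ∀ {P Q c} → Unique P → Unique Q → 3 ≤ length P → 3 ≤ length Q → (∀ {c} → c ∈ˡ P → c ∉ˡ Q) →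
             2 + l ≤ length P + length Q → l + l < length P + length Q + length Q →
             c ∈ˡ P → c ∉ˡ X → Saving P Q R S X Y
      half {P} {Q} {c} uP uQ 3≤P 3≤Q P∩Q PQ PQQ c∈P c∉X with escape? Q Y
      ... | inj₁ (c′ , c′∈Q , c′∉Y) = crossing uP 3≤P c∈P c′∈Q c∉X c′∉Y
      ... | inj₂ Q⊆Y with escape? Q X
      ...   | inj₁ (c₁ , c₁∈Q , c₁∉X)
              with fresh-∪ Y uP uQ P∩Q (ℕ.≤-trans (s≤s Y≤l) (ℕ.<⇒≤ PQ))
      ...     | c′ , inj₁ c′∈P , c′∉Y = swap-pq (crossing uQ 3≤Q c₁∈Q c′∈P c₁∉X c′∉Y)
      ...     | c′ , inj₂ c′∈Q , c′∉Y = contradiction (Q⊆Y c′∈Q) c′∉Y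
      -- Since Q ⊆ X ∩ Y, the lists `X` and `Y − Q` have at most 2l - |Q| < |P| + |Q| colours
      -- together. A colour beyond them must come from `P`, and it misses both `X` and `Y`.
      half {P} {Q} {c} uP uQ 3≤P 3≤Q P∩Q PQ PQQ c∈P c∉X | inj₂ Q⊆Y | inj₂ Q⊆X
        with fresh-∪ (X ++ (Y − Q)) uP uQ P∩Q
               (subst (_< length P + length Q) (sym (length-++ X)) (ℕ.+-cancelʳ-< (length Q) _ _ (ℕ.≤-<-trans
                 (ℕ.≤-trans (ℕ.≤-reflexive (ℕ.+-assoc (length X) _ _)) (ℕ.+-mono-≤ X≤l (ℕ.≤-trans (−-shrinks Q uQ Q⊆Y) Y≤l))) PQQ)))
      ... | c′ , inj₂ c′∈Q , c′∉ = contradiction (∈-++⁺ˡ (Q⊆X c′∈Q)) c′∉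
      ... | c′ , inj₁ c′∈P , c′∉ = missing uQ 3≤Q c′∈P (c′∉ ∘ ∈-++⁺ˡ)
              λ c′∈Y → c′∉ (∈-++⁺ʳ X (∈-−⁺ Q c′∈Y (P∩Q c′∈P)))
      by-side : ∀ {c} → c ∈ˡ P ⊎ c ∈ˡ Q → c ∉ˡ X → Saving P Q R S X Y
      by-side (inj₁ c∈P) c∉X = half uP uQ 3≤P 3≤Q P∩Q PQ PQQ c∈P c∉X
      by-side (inj₂ c∈Q) c∉X = swap-pq (half uQ uP 3≤Q 3≤P (λ c∈Q c∈P → P∩Q c∈P c∈Q)
        (subst (2 + l ≤_) (ℕ.+-comm (length P) _) PQ)
        (subst (λ t → l + l < t + length P) (ℕ.+-comm (length P) _) PQP) c∈Q c∉X)

saving : ∀ {P Q R S X Y} l → Unique P → Unique Q → Unique R → Unique S →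
         3 ≤ length P → 3 ≤ length Q → 3 ≤ length R → 3 ≤ length S → length X ≤ l → length Y ≤ l →
         2 + l ≤ length P + length Q → 2 + l ≤ length R + length S →
         l + l < length P + length Q + length P → l + l < length P + length Q + length Q →
         Saving P Q R S X Y
saving {P} {Q} {R} {S} l uP uQ uR uS 3≤P 3≤Q 3≤R 3≤S X≤l Y≤l PQ RS PQP PQQ with common? P Q | common? R S
... | inj₁ (c , c∈P , c∈Q) | _ = saving-common l X≤l uR uS 3≤R 3≤S RS c∈P c∈Q
... | inj₂ _ | inj₁ (c , c∈R , c∈S) = swap-pairs (saving-common l X≤l uP uQ 3≤P 3≤Q PQ c∈R c∈S)
... | inj₂ P∩Q | inj₂ R∩S = saving-disjoint l X≤l uR uS 3≤R 3≤S RS R∩S uP uQ 3≤P 3≤Q P∩Q Y≤l PQ PQP PQQ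

-- Joined families and numerical estimates

opaque
  unfolding ∣_∣

  length-filter-allFin : {P : Fin n → Set} (P? : Decidable P) → length (filter P? (allFin n)) ≡ ∣ ⟪ P? ⟫ ∣
  length-filter-allFin {n} P? = go P? id
    where
    go : ∀ {m k} {P : Fin m → Set} (P? : Decidable P) (f : Fin k → Fin m) →
         length (filter P? (tabulate f)) ≡ sum (λ i → 𝟙 (P? (f i)))
    go {k = zero}  P? f = refl
    go {k = suc k} P? f with P? (f zero)
    ... | yes _ = cong suc (go P? (f ∘ suc))
    ... | no  _ = go P? (f ∘ suc)

module _ {A : Set} {a : Fin m → A} {b : Fin n → A} where

  ⊕-all : (P : A → Set) → (∀ i → P (a i)) → (∀ j → P (b j)) → ∀ k → P ((a ⊕ b) k)
  ⊕-all P pa pb k with splitAt m k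
  ... | inj₁ i = pa i
  ... | inj₂ j = pb j

  ⊕-injective : Injective _≡_ _≡_ a → Injective _≡_ _≡_ b → (∀ i j → a i ≢ b j) → Injective _≡_ _≡_ (a ⊕ b)
  ⊕-injective inj-a inj-b dis {i} {j} eq with splitAt m i in i-eq | splitAt m j in j-eq
  ... | inj₁ i′ | inj₁ j′ with refl ← inj-a eq = trans (sym (Fin.splitAt⁻¹-↑ˡ i-eq)) (Fin.splitAt⁻¹-↑ˡ j-eq)
  ... | inj₁ i′ | inj₂ j′ = contradiction eq (dis i′ j′)
  ... | inj₂ i′ | inj₁ j′ = contradiction (sym eq) (dis j′ i′)
  ... | inj₂ i′ | inj₂ j′ with refl ← inj-b eq = trans (sym (Fin.splitAt⁻¹-↑ʳ i-eq)) (Fin.splitAt⁻¹-↑ʳ j-eq)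

fin1-injective : ∀ {A : Set} {a : Fin 1 → A} → Injective _≡_ _≡_ a
fin1-injective {x = 0F} {0F} _ = refl

two : ∀ {A : Set} → A → A → Fin 2 → A
two a b 0F = a
two a b 1F = b

two-all : ∀ {A : Set} {a b : A} (P : A → Set) → P a → P b → ∀ i → P (two a b i)
two-all P pa pb 0F = pa
two-all P pa pb 1F = pb

pattern 6+_ i = suc (suc (suc (suc (suc (suc i)))))

-- The size conditions of `saving` for `l` equal to 4 + j. For j ≥ 2 the sums have enough slack to
-- let the second list be one shorter.
crossed-lengths : ∀ {j a b} → 3 + j ≤ a → 2 ≤ j × 2 + j ≤ b ⊎ 3 + j ≤ b →
                  3 ≤ a × 3 ≤ b × 6 + j ≤ a + b × (4 + j) + (4 + j) < a + b + a × (4 + j) + (4 + j) < a + b + b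
crossed-lengths {suc (suc j)} {a} {b} a≥ (inj₁ (s≤s (s≤s _) , b≥)) =
  ℕ.≤-trans (s≤s (s≤s (s≤s z≤n))) a≥ , ℕ.≤-trans (s≤s (s≤s (s≤s z≤n))) b≥ ,
  linear {5 + j + (4 + j)} {a + b} (1 + j) (ℕ.+-mono-≤ a≥ b≥) (id₁ j a b) ,
  linear {5 + j + (4 + j) + (5 + j)} {a + b + a} (1 + j) (ℕ.+-mono-≤ (ℕ.+-mono-≤ a≥ b≥) a≥) (id₂ j a b) ,
  linear {5 + j + (4 + j) + (4 + j)} {a + b + b} j (ℕ.+-mono-≤ (ℕ.+-mono-≤ a≥ b≥) b≥) (id₃ j a b)
  where
  id₁ : ∀ j a b → 6 + (2 + j) + (a + b) + (1 + j) ≡ a + b + (5 + j + (4 + j))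
  id₁ = solve-∀
  id₂ : ∀ j a b → 1 + ((4 + (2 + j)) + (4 + (2 + j))) + (a + b + a) + (1 + j) ≡ a + b + a + (5 + j + (4 + j) + (5 + j))
  id₂ = solve-∀
  id₃ : ∀ j a b → 1 + ((4 + (2 + j)) + (4 + (2 + j))) + (a + b + b) + j ≡ a + b + b + (5 + j + (4 + j) + (4 + j))
  id₃ = solve-∀
crossed-lengths {suc zero} _ (inj₁ (s≤s () , _))
crossed-lengths {j} {a} {b} a≥ (inj₂ b≥) =
  ℕ.≤-trans (s≤s (s≤s (s≤s z≤n))) a≥ , ℕ.≤-trans (s≤s (s≤s (s≤s z≤n))) b≥ ,
  linear {3 + j + (3 + j)} {a + b} j (ℕ.+-mono-≤ a≥ b≥) (id₁ j a b) ,
  linear {3 + j + (3 + j) + (3 + j)} {a + b + a} j (ℕ.+-mono-≤ (ℕ.+-mono-≤ a≥ b≥) a≥) (id₂ j a b) ,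
  linear {3 + j + (3 + j) + (3 + j)} {a + b + b} j (ℕ.+-mono-≤ (ℕ.+-mono-≤ a≥ b≥) b≥) (id₃ j a b)
  where
  id₁ : ∀ j a b → 6 + j + (a + b) + j ≡ a + b + (3 + j + (3 + j))
  id₁ = solve-∀
  id₂ : ∀ j a b → 1 + ((4 + j) + (4 + j)) + (a + b + a) + j ≡ a + b + a + (3 + j + (3 + j) + (3 + j))
  id₂ = solve-∀
  id₃ : ∀ j a b → 1 + ((4 + j) + (4 + j)) + (a + b + b) + j ≡ a + b + b + (3 + j + (3 + j) + (3 + j))
  id₃ = solve-∀

-- Linear arithmetic about an edge of line-graph degree g and multiplicity m
-- between vertices of degrees a and b.
private
  edge-a≤7 : ∀ {g m a b k} → a + b ≤ suc (g + m) → g ≤ suc k → m ≤ 3 → k ≤ 2 + b → a ≤ 7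
  edge-a≤7 {g} {m} {a} {b} {k} h₁ h₂ h₃ h₄ = linear 0 (ℕ.+-mono-≤ h₁ (ℕ.+-mono-≤ h₂ (ℕ.+-mono-≤ h₃ h₄))) (eq g m a b k)
    where
    eq : ∀ g m a b k → a + (suc (g + m) + (suc k + (3 + (2 + b)))) + 0 ≡ 7 + (a + b + (g + (m + k)))
    eq = solve-∀

  -- `s` is 1 if the vertex of degree `a` has lost no edge and 0 if it has lost one; the loss lowers
  -- the bounds for `a` and `g` alike, so `s` cancels.
  edge-3≤m : ∀ {g m a b k} s → s + 6 ≤ a → a + b ≤ suc (g + m) → g ≤ s + k → k ≤ 2 + b → 3 ≤ m
  edge-3≤m {g} {m} {a} {b} {k} s h₁ h₂ h₃ h₄ = linear 0 (ℕ.+-mono-≤ h₁ (ℕ.+-mono-≤ h₂ (ℕ.+-mono-≤ h₃ h₄))) (eq g m a b k s)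
    where
    eq : ∀ g m a b k s → 3 + (a + (suc (g + m) + (s + k + (2 + b)))) + 0 ≡ m + (s + 6 + (a + b + (g + k)))
    eq = solve-∀

  edge-2+b≤k : ∀ {g m a b k} s → s + 6 ≤ a → a + b ≤ suc (g + m) → g ≤ s + k → m ≤ 3 → 2 + b ≤ k
  edge-2+b≤k {g} {m} {a} {b} {k} s h₁ h₂ h₃ h₄ = linear 0 (ℕ.+-mono-≤ h₁ (ℕ.+-mono-≤ h₂ (ℕ.+-mono-≤ h₃ h₄))) (eq g m a b k s)
    where
    eq : ∀ g m a b k s → 2 + b + (a + (suc (g + m) + (s + k + 3))) + 0 ≡ k + (s + 6 + (a + b + (g + m)))
    eq = solve-∀

  edge-lost : ∀ {g m a b k} → 7 ≤ a → a + b ≤ suc (g + m) → g ≤ k → m ≤ 3 → k ≤ 2 + b → 1 ≤ 0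
  edge-lost {g} {m} {a} {b} {k} h₁ h₂ h₃ h₄ h₅ =
    linear 0 (ℕ.+-mono-≤ h₁ (ℕ.+-mono-≤ h₂ (ℕ.+-mono-≤ h₃ (ℕ.+-mono-≤ h₄ h₅)))) (eq g m a b k)
    where
    eq : ∀ g m a b k → 1 + (a + (suc (g + m) + (k + (3 + (2 + b))))) + 0 ≡ 7 + (a + b + (g + (m + k)))
    eq = solve-∀

  edge-5+m≤a : ∀ {g m a b k} → suc (g + m) ≤ a + b → 11 ≤ k → k ≤ g → b ≤ 7 → 5 + m ≤ a
  edge-5+m≤a {g} {m} {a} {b} {k} h₁ h₂ h₃ h₄ = linear 0 (ℕ.+-mono-≤ h₁ (ℕ.+-mono-≤ h₂ (ℕ.+-mono-≤ h₃ h₄))) (eq g m a b k)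
    where
    eq : ∀ g m a b k → 5 + m + (a + b + (k + (g + 7))) + 0 ≡ a + (suc (g + m) + (11 + (k + b)))
    eq = solve-∀

  split-2≤n : ∀ {a p q r n} → a ≤ p + (q + (r + n)) → p ≤ 3 → 5 + (q + r) ≤ a → 2 ≤ n
  split-2≤n {a} {p} {q} {r} {n} h₁ h₂ h₃ = linear 0 (ℕ.+-mono-≤ h₁ (ℕ.+-mono-≤ h₂ h₃)) (eq a p q r n)
    where
    eq : ∀ a p q r n → 2 + (p + (q + (r + n)) + (3 + a)) + 0 ≡ n + (a + (p + (5 + (q + r))))
    eq = solve-∀

private
  -- `b` and `c` stand for the numbers of cut and uncut edges at a vertex, and 7c ≤ 8b for the local
  -- optimality of a cut with weights 7 and 8. These weights are close enough to give the same
  -- bounds as a true majority of cut edges.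
  cut-c≤3 : ∀ {b c} → 7 * c ≤ 8 * b → b + c ≤ 7 → c ≤ 3
  cut-c≤3 {b} {c} h₁ h₂ = ℕ.≮⇒≥ λ 4≤c → contradiction
    (linear {7 * c + 8 * (b + c) + 15 * 4} {8 * b + 8 * 7 + 15 * c} {1} {0} 3
      (ℕ.+-mono-≤ (ℕ.+-mono-≤ h₁ (ℕ.*-monoʳ-≤ 8 h₂)) (ℕ.*-monoʳ-≤ 15 4≤c)) (eq b c)) λ ()
    where
    eq : ∀ b c → 1 + (8 * b + 8 * 7 + 15 * c) + 3 ≡ 7 * c + 8 * (b + c) + 15 * 4
    eq = solve-∀

  cut-c≤4 : ∀ {b c} → 7 * c ≤ 8 * b → b + c ≤ 8 → c ≤ 4
  cut-c≤4 {b} {c} h₁ h₂ = ℕ.≮⇒≥ λ 5≤c → contradiction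
    (linear {7 * c + 8 * (b + c) + 15 * 5} {8 * b + 8 * 8 + 15 * c} {1} {0} 10
      (ℕ.+-mono-≤ (ℕ.+-mono-≤ h₁ (ℕ.*-monoʳ-≤ 8 h₂)) (ℕ.*-monoʳ-≤ 15 5≤c)) (eq b c)) λ ()
    where
    eq : ∀ b c → 1 + (8 * b + 8 * 8 + 15 * c) + 10 ≡ 7 * c + 8 * (b + c) + 15 * 5
    eq = solve-∀

  cut-5≤b : ∀ {b c} → 7 * c ≤ 8 * b → 9 ≤ b + c → 5 ≤ b
  cut-5≤b {b} {c} h₁ h₂ = ℕ.≮⇒≥ λ b<5 → contradiction
    (linear {7 * c + 7 * 9 + 15 * b} {8 * b + 7 * (b + c) + 15 * 4} {1} {0} 2
      (ℕ.+-mono-≤ (ℕ.+-mono-≤ h₁ (ℕ.*-monoʳ-≤ 7 h₂)) (ℕ.*-monoʳ-≤ 15 (s≤s⁻¹ b<5))) (eq b c)) λ ()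
    where
    eq : ∀ b c → 1 + (8 * b + 7 * (b + c) + 15 * 4) + 2 ≡ 7 * c + 7 * 9 + 15 * b
    eq = solve-∀

  far-end : ∀ {g m a b k} → a + b ≤ suc (g + m) → g ≤ suc k → m ≤ 3 → a + b ≤ 5 + k
  far-end {g} {m} {a} {b} {k} h₁ h₂ h₃ = linear 0 (ℕ.+-mono-≤ h₁ (ℕ.+-mono-≤ h₂ h₃)) (eq g m a b k)
    where
    eq : ∀ g m a b k → a + b + (suc (g + m) + (suc k + 3)) + 0 ≡ 5 + k + (a + b + (g + m))
    eq = solve-∀

  spread : ∀ {b c a′ k} → 5 ≤ b → b + c + a′ ≤ 5 + k → c + a′ ≤ k
  spread {b} {c} {a′} {k} h₁ h₂ = linear 0 (ℕ.+-mono-≤ h₁ h₂) (eq b c a′ k)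
    where
    eq : ∀ b c a′ k → c + a′ + (b + (5 + k)) + 0 ≡ k + (5 + (b + c + a′))
    eq = solve-∀

  fits-or-extreme : ∀ {c a k} → 3 + a ≤ k → c ≤ 4 → c + a ≤ k ⊎ (3 + a ≡ k × c ≡ 4)
  fits-or-extreme {a = a} low c≤4 with ℕ.m≤n⇒m<n∨m≡n low | ℕ.m≤n⇒m<n∨m≡n c≤4
  ... | inj₁ 4+≤ | _        = inj₁ (ℕ.≤-trans (ℕ.+-monoˡ-≤ a c≤4) 4+≤)
  ... | inj₂ eq  | inj₁ c<4 = inj₁ (ℕ.≤-trans (ℕ.+-monoˡ-≤ a (s≤s⁻¹ c<4)) (ℕ.≤-reflexive eq))
  ... | inj₂ eq  | inj₂ c≡4 = inj₂ (eq , c≡4)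

  -- Here `a` and `a′` are the degrees of the ends. Up to `a` = 7 at most three edges are uncut,
  -- which `low` absorbs; from 9 on at least five are cut, which makes up for the 5 in the bound on
  -- `a + a′`. At 8 only the extreme values remain.
  cut-fits : ∀ a b c {a′ k} → Tri (a < 8) (a ≡ 8) (8 < a) → 7 * c ≤ 8 * b → b + c ≡ a → 3 + a′ ≤ k → a + a′ ≤ 5 + k →
             c + a′ ≤ k ⊎ (a ≡ 8 × 3 + a′ ≡ k × c ≡ 4)
  cut-fits a b c {a′} {k} (tri< lt _ _) h eq low far =
    inj₁ (ℕ.≤-trans (ℕ.+-monoˡ-≤ a′ (cut-c≤3 {b} {c} h (ℕ.≤-trans (ℕ.≤-reflexive eq) (s≤s⁻¹ lt)))) low)
  cut-fits a b c {a′} {k} (tri> _ _ gt) h eq low far =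
    inj₁ (spread {b} {c} {a′} {k} (cut-5≤b {b} {c} h (ℕ.≤-trans gt (ℕ.≤-reflexive (sym eq))))
      (ℕ.≤-trans (ℕ.≤-reflexive (cong (_+ a′) eq)) far))
  cut-fits a b c {a′} {k} (tri≈ _ a≡8 _) h eq low far =
    Sum.map₂ (a≡8 ,_) (fits-or-extreme low (cut-c≤4 {b} {c} h (ℕ.≤-reflexive (trans eq a≡8))))

  triple : ∀ {g m a k} → 8 + a ≤ suc (g + m) → g ≤ suc k → k ≤ 3 + a → 3 ≤ m
  triple {g} {m} {a} {k} h₁ h₂ h₃ = linear 0 (ℕ.+-mono-≤ h₁ (ℕ.+-mono-≤ h₂ h₃)) (eq g m a k)
    where
    eq : ∀ g m a k → 3 + (suc (g + m) + (suc k + (3 + a))) + 0 ≡ m + (8 + a + (g + k))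
    eq = solve-∀

  12≤k : ∀ {g m a k} s → s + 6 ≤ a → 8 + a ≤ suc (g + m) → g ≤ s + k → m ≤ 1 → 12 ≤ k
  12≤k {g} {m} {a} {k} s h₁ h₂ h₃ h₄ = linear 0 (ℕ.+-mono-≤ h₁ (ℕ.+-mono-≤ h₂ (ℕ.+-mono-≤ h₃ h₄))) (eq g m a k s)
    where
    eq : ∀ g m a k s → 12 + (a + (suc (g + m) + (s + k + 1))) + 0 ≡ k + (s + 6 + (8 + a + (g + m)))
    eq = solve-∀

cut-1≤b : ∀ {b c} → 7 * c ≤ 8 * b → 6 ≤ b + c → 1 ≤ b
cut-1≤b {zero}  {zero}  _ ()
cut-1≤b {zero}  {suc c} ()
cut-1≤b {suc b}         _ _ = s≤s z≤n

-- Ends, degrees and multiplicities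

module Incidence (H : Multigraph) where
  open Multigraph H public using (Vertex; Edge; Incident; incident?; end₁; end₂; loopless; size)
  open SimpleGraph (lineGraph H) public using (Adj; adj?; adj-sym)

  at : Vertex → Sub size
  at v = ⟪ incident? v ⟫

  nbrs : Edge → Sub size
  nbrs e = ⟪ adj? e ⟫

  d : Sub size → Vertex → ℕ
  d R v = ∣ R ∩ at v ∣

  μ : Sub size → Vertex → Vertex → ℕ
  μ R u v = ∣ R ∩ at u ∩ at v ∣

  dG : Sub size → Edge → ℕ
  dG R e = ∣ R ∩ nbrs e ∣

  Joins : Edge → Vertex → Vertex → Set
  Joins e u v = (u ≡ end₁ e × v ≡ end₂ e) ⊎ (u ≡ end₂ e × v ≡ end₁ e)

  joins-ends : ∀ e → Joins e (end₁ e) (end₂ e)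
  joins-ends e = inj₁ (refl , refl)

  joins-sym : ∀ {e u v} → Joins e u v → Joins e v u
  joins-sym (inj₁ (p , q)) = inj₂ (q , p)
  joins-sym (inj₂ (p , q)) = inj₁ (q , p)

  joins-≢ : ∀ {e u v} → Joins e u v → u ≢ v
  joins-≢ {e} (inj₁ (refl , refl)) = loopless e
  joins-≢ {e} (inj₂ (refl , refl)) = ≢-sym (loopless e)

  joins-at : ∀ {e u v} → Joins e u v → Incident u e
  joins-at (inj₁ (p , _)) = inj₁ p
  joins-at (inj₂ (p , _)) = inj₂ p

  joins-at′ : ∀ {e u v} → Joins e u v → Incident v e
  joins-at′ = joins-at ∘ joins-sym

  joins-only : ∀ {e u v z} → Joins e u v → Incident z e → z ≡ u ⊎ z ≡ v
  joins-only (inj₁ (refl , refl)) (inj₁ eq) = inj₁ eq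
  joins-only (inj₁ (refl , refl)) (inj₂ eq) = inj₂ eq
  joins-only (inj₂ (refl , refl)) (inj₁ eq) = inj₂ eq
  joins-only (inj₂ (refl , refl)) (inj₂ eq) = inj₁ eq

  at-joins : ∀ {e v} → Incident v e → ∃ λ w → Joins e v w
  at-joins {e} (inj₁ eq) = end₂ e , inj₁ (eq , refl)
  at-joins {e} (inj₂ eq) = end₁ e , inj₂ (eq , refl)

  joins-both : ∀ {e u v} → u ≢ v → Incident u e → Incident v e → Joins e u v
  joins-both u≢v (inj₁ p) (inj₁ q) = contradiction (trans p (sym q)) u≢v
  joins-both u≢v (inj₁ p) (inj₂ q) = inj₁ (p , q)
  joins-both u≢v (inj₂ p) (inj₁ q) = inj₂ (p , q)
  joins-both u≢v (inj₂ p) (inj₂ q) = contradiction (trans p (sym q)) u≢v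

  joins-other : ∀ {e u v w} → Joins e u v → Joins e u w → v ≡ w
  joins-other j j′ with joins-only j (joins-at′ j′)
  ... | inj₁ refl = contradiction refl (joins-≢ j′)
  ... | inj₂ eq   = sym eq

  adj-elim : ∀ {e f u v} → Joins e u v → Adj e f → Incident u f ⊎ Incident v f
  adj-elim j (_ , z , ze , zf) with joins-only j ze
  ... | inj₁ refl = inj₁ zf
  ... | inj₂ refl = inj₂ zf

  union-size : ∀ R {e u v} → e ∈ R → Joins e u v → ∣ (R ∩ at u) ∪ (R ∩ at v) ∣ ≡ suc (dG R e)
  union-size R {e} {u} {v} e∈R j = trans (∣∣-remove {i = e} U (inj₁ (e∈R , joins-at j)))
    (cong suc (∣∣-cong {A = U ∖ ⁅ e ⁆} {R ∩ nbrs e}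
      (λ { (inj₁ (f∈R , uf) , f≢e) → f∈R , ≢-sym f≢e , u , joins-at j , uf
         ; (inj₂ (f∈R , vf) , f≢e) → f∈R , ≢-sym f≢e , v , joins-at′ j , vf })
      (λ (f∈R , a) → Sum.map (f∈R ,_) (f∈R ,_) (adj-elim j a) , λ { refl → proj₁ a refl })))
    where
    U : Sub size
    U = (R ∩ at u) ∪ (R ∩ at v)

  -- Inclusion-exclusion for the edges at `u` and at `v`. The successor accounts for `e`, which is
  -- in the union but is not its own neighbour.
  degree-sum : ∀ R {e u v} → e ∈ R → Joins e u v → suc (dG R e + μ R u v) ≡ d R u + d R v
  degree-sum R {e} {u} {v} e∈R j = begin
    suc (dG R e) + μ R u v                                      ≡⟨ cong₂ _+_ (sym (union-size R e∈R j)) meet ⟩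
    ∣ (R ∩ at u) ∪ (R ∩ at v) ∣ + ∣ (R ∩ at u) ∩ (R ∩ at v) ∣   ≡⟨ ∣∣-∪∩ (R ∩ at u) (R ∩ at v) ⟩
    d R u + d R v                                               ∎
    where
    open ≡-Reasoning
    meet : μ R u v ≡ ∣ (R ∩ at u) ∩ (R ∩ at v) ∣
    meet = ∣∣-cong {A = R ∩ at u ∩ at v} {(R ∩ at u) ∩ (R ∩ at v)}
      (λ (r , a , b) → (r , a) , (r , b)) (λ ((r , a) , (_ , b)) → r , a , b)

  not-at : ∀ {e u v w} → Joins e u v → w ≢ u → w ≢ v → ¬ Incident w e
  not-at j ≢u ≢v inc with joins-only j inc
  ... | inj₁ eq = ≢u eq
  ... | inj₂ eq = ≢v eq

  differ : ∀ {e f w} → Incident w e → ¬ Incident w f → e ≢ f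
  differ we wf refl = wf we

  not-adjacent : ∀ {f g x y z z′} → Joins f y z → Joins g x z′ → x ≢ y → z ≢ x → z′ ≢ y → z ≢ z′ → ¬ Adj f g
  not-adjacent jf jg x≢y z≢x z′≢y z≢z′ (_ , v , vf , vg) with joins-only jf vf | joins-only jg vg
  ... | inj₁ p | inj₁ q = x≢y (trans (sym q) p)
  ... | inj₁ p | inj₂ q = z′≢y (trans (sym q) p)
  ... | inj₂ p | inj₁ q = z≢x (trans (sym p) q)
  ... | inj₂ p | inj₂ q = z≢z′ (trans (sym p) q)

  joins-free : ∀ {f u z w} → Joins f u z → ¬ Incident w f → z ≢ w
  joins-free j ¬w refl = ¬w (joins-at′ j)

  share-end : ∀ {f g u v z z′} → Joins f u z → Joins g v z′ → f ≢ g → z ≡ z′ → Adj f g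
  share-end jf jg f≢g refl = f≢g , _ , joins-at′ jf , joins-at′ jg

-- Reducible configurations

module Configurations (H : Multigraph) (k : ℕ) (L : Multigraph.Edge H → List ℕ)
                      (uniq : ∀ e → Unique (L e)) (len : ∀ e → length (L e) ≡ k) where
  open Incidence H

  Proper : (Edge → ℕ) → Sub size → Set
  Proper c R = ∀ {e f} → e ∈ R → f ∈ R → Adj e f → c e ≢ c f

  ColourableFrom : (Edge → List ℕ) → Sub size → Set
  ColourableFrom Λ R = ∃ λ (c : Edge → ℕ) → (∀ {e} → e ∈ R → c e ∈ˡ Λ e) × Proper c R

  Col : Sub size → Set
  Col = ColourableFrom L

  opaque
    extend : ∀ R F → F ⊆ R → Col (R ∖ F) →
             ((Λ : Edge → List ℕ) → (∀ e → Unique (Λ e)) → (∀ {e} → e ∈ F → k ≤ dG (R ∖ F) e + length (Λ e)) → ColourableFrom Λ F) →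
             Col R
    extend R F F⊆R (c , c∈ , c-proper) colour-F = b , b∈ , b-proper
      where
      used : Edge → List ℕ
      used e = map c (filter (mem? ((R ∖ F) ∩ nbrs e)) (allFin size))
      used-length : ∀ e → length (used e) ≡ dG (R ∖ F) e
      used-length e = trans (length-map c (filter (mem? ((R ∖ F) ∩ nbrs e)) (allFin size))) (length-filter-allFin (mem? ((R ∖ F) ∩ nbrs e)))
      Λ : Edge → List ℕ
      Λ e = L e − used e
      F-coloured : ColourableFrom Λ F
      F-coloured = colour-F Λ (λ e → −-unique {L e} (used e) (uniq e)) λ {e} _ →
        subst₂ (λ a b → a ≤ b + length (Λ e)) (len e) (used-length e) (−-length {L e} (used e) (uniq e))
      a : Edge → ℕ
      a = proj₁ F-coloured
      a∈ : ∀ {e} → e ∈ F → a e ∈ˡ Λ e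
      a∈ = proj₁ (proj₂ F-coloured)
      b : Edge → ℕ
      b e with mem? F e
      ... | yes _ = a e
      ... | no  _ = c e
      b∈ : ∀ {e} → e ∈ R → b e ∈ˡ L e
      b∈ {e} e∈R with mem? F e
      ... | yes e∈F = proj₁ (∈-−⁻ {L e} (used e) (a∈ e∈F))
      ... | no  e∉F = c∈ (e∈R , e∉F)
      clash : ∀ {e f} → e ∈ F → f ∈ R ∖ F → Adj e f → a e ≢ c f
      clash {e} {f} e∈F f∈ adj eq = proj₂ (∈-−⁻ {L e} (used e) (a∈ e∈F)) (subst (_∈ˡ used e) (sym eq)
        (∈-map⁺ c (∈-filter⁺ (mem? ((R ∖ F) ∩ nbrs e)) (∈-allFin f) (f∈ , adj))))
      b-proper : Proper b R
      b-proper {e} {f} e∈R f∈R adj with mem? F e | mem? F f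
      ... | yes e∈F | yes f∈F = proj₂ (proj₂ F-coloured) e∈F f∈F adj
      ... | yes e∈F | no  f∉F = clash e∈F (f∈R , f∉F) adj
      ... | no  e∉F | yes f∈F = λ eq → clash f∈F (e∈R , e∉F) (adj-sym adj) (sym eq)
      ... | no  e∉F | no  f∉F = c-proper (e∈R , e∉F) (f∈R , f∉F) adj

  module _ {N} (φ : Fin N → Edge) where

    image : Sub size
    image = ⟪ (λ e → any? λ i → φ i Fin.≟ e) ⟫

    linked : Fin N → Sub N
    linked i = ⟪ (λ j → adj? (φ i) (φ j)) ⟫

  Smaller : Sub size → Set₁
  Smaller R = ∀ R′ → ∣ R′ ∣ < ∣ R ∣ → Col R′

  opaque
    -- After the rest is coloured, an edge of the configuration has at most dG - linked coloured
    -- neighbours and so keeps at least k + linked - dG colours. The additive form avoids truncated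
    -- subtraction.
    reduce : ∀ {R N} (φ : Fin (suc N) → Edge) → Injective _≡_ _≡_ φ → (∀ i → φ i ∈ R) → Smaller R →
             ((Λ : Fin (suc N) → List ℕ) → (∀ i → Unique (Λ i)) → (∀ i → ∣ linked φ i ∣ + k ≤ dG R (φ i) + length (Λ i)) →
               ∃ λ (c : Fin (suc N) → ℕ) → (∀ i → c i ∈ˡ Λ i) × (∀ {i j} → Adj (φ i) (φ j) → c i ≢ c j)) →
             Col R
    reduce {R} {N} φ inj φ∈ smaller colour = extend R (image φ) F⊆R
        (smaller (R ∖ image φ) (∣∣-< {A = R ∖ image φ} {R} proj₁ (φ∈ zero) λ (_ , ∉) → ∉ (zero , refl)))
        λ Λ u big → transfer Λ (colour (Λ ∘ φ) (u ∘ φ) λ i → count i (big {φ i} (i , refl)))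
      where
      F⊆R : image φ ⊆ R
      F⊆R (i , refl) = φ∈ i
      count : ∀ i {t} → k ≤ dG (R ∖ image φ) (φ i) + t → ∣ linked φ i ∣ + k ≤ dG R (φ i) + t
      count i {t} le = begin
        ∣ linked φ i ∣ + k                                    ≤⟨ ℕ.+-monoʳ-≤ ∣ linked φ i ∣ le ⟩
        ∣ linked φ i ∣ + (dG (R ∖ image φ) (φ i) + t)         ≡⟨ ℕ.+-assoc ∣ linked φ i ∣ _ _ ⟨
        ∣ linked φ i ∣ + dG (R ∖ image φ) (φ i) + t           ≤⟨ ℕ.+-monoˡ-≤ t (ℕ.+-monoˡ-≤ _ (∣∣-injection φ inj (linked φ i)
                                                                  ((R ∩ nbrs (φ i)) ∩ image φ) λ {j} a → (φ∈ j , a) , j , refl)) ⟩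
        ∣ (R ∩ nbrs (φ i)) ∩ image φ ∣ + dG (R ∖ image φ) (φ i) + t
                                                              ≤⟨ ℕ.+-monoˡ-≤ t (∣∣-⊎ {A = (R ∩ nbrs (φ i)) ∩ image φ}
                                                                   {(R ∖ image φ) ∩ nbrs (φ i)} {R ∩ nbrs (φ i)}
                                                                   proj₁ (λ ((r , _) , a) → r , a) λ (_ , ∈F) ((_ , ∉F) , _) → ∉F ∈F) ⟩
        dG R (φ i) + t                                        ∎
        where open ℕ.≤-Reasoning
      transfer : (Λ : Edge → List ℕ) → (∃ λ (c : Fin (suc N) → ℕ) → (∀ i → c i ∈ˡ Λ (φ i)) × (∀ {i j} → Adj (φ i) (φ j) → c i ≢ c j)) →
                 ColourableFrom Λ (image φ)
      transfer Λ (c , c∈ , proper) = b , (λ { (i , refl) → subst (_∈ˡ Λ (φ i)) (sym (b-φ i)) (c∈ i) }) ,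
          λ { (i , refl) (j , refl) a eq → proper a (trans (sym (b-φ i)) (trans eq (b-φ j))) }
        where
        b : Edge → ℕ
        b e with any? (λ i → φ i Fin.≟ e)
        ... | yes (i , _) = c i
        ... | no _        = 0
        b-φ : ∀ i → b (φ i) ≡ c i
        b-φ i with any? (λ j → φ j Fin.≟ φ i)
        ... | yes (j , eq) = cong c (inj eq)
        ... | no ∄         = contradiction (i , refl) ∄

  -- The x-ends prefer edges with a large key and the y-ends edges with a small
  -- key; a loser of i is an edge adjacent to φ i that does not beat it. Two
  -- losers make up for a list that is one shorter than the degree.
  module KernelReduction (R : Sub size) {N} (φ : Fin (suc N) → Edge) (x y : Fin (suc N) → Vertex) (key : Fin (suc N) → ℕ) where

    -- The last inequality in each case excludes parallel edges: as the two ends have opposite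
    -- preferences, of two parallel edges each beats the other.
    Loses : Fin (suc N) → Fin (suc N) → Set
    Loses i j = (x j ≡ x i × key j < key i × y j ≢ y i) ⊎ (y j ≡ y i × key i < key j × x j ≢ x i)

    Beatable : Fin (suc N) → Set
    Beatable i = (dG R (φ i) ≤ k × ∃ (Loses i)) ⊎ (∃₂ λ j j′ → j ≢ j′ × Loses i j × Loses i j′)

    opaque
      kernel-reduce : Injective _≡_ _≡_ φ → Injective _≡_ _≡_ key → (∀ i → φ i ∈ R) → Smaller R → (∀ {e} → e ∈ R → dG R e ≤ suc k) →
                      (∀ i → Joins (φ i) (x i) (y i)) → (∀ i j → x i ≢ y j) → (∀ i → Beatable i) → Col R
      kernel-reduce inj key-inj φ∈ smaller dG≤ joins x≢y beatable = reduce φ inj φ∈ smaller λ Λ u big →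
        let c , c∈ , proper = kernel-colouring full strict Λ u λ {i} _ → enough Λ i (big i)
        in c , (λ i → c∈ _) , λ a → proper _ _ (λ { refl → proj₁ a refl }) (share a)
        where
        q : Fin (suc N) → ℕ
        q i = proj₁ (bounded key) ∸ key i
        open Preferences x y key q
        q-≤ : ∀ {i} → key i ≤ proj₁ (bounded key)
        q-≤ {i} = proj₂ (bounded key) i
        strict : Strict full
        strict {i} {j} _ _ = (λ _ → key-inj) , λ _ eq → key-inj (ℕ.∸-cancelˡ-≡ (q-≤ {i}) (q-≤ {j}) eq)
        share : ∀ {i j} → Adj (φ i) (φ j) → x i ≡ x j ⊎ y i ≡ y j
        share {i} {j} (_ , z , zi , zj) with joins-only (joins i) zi | joins-only (joins j) zj
        ... | inj₁ p | inj₁ q = inj₁ (trans (sym p) q)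
        ... | inj₂ p | inj₂ q = inj₂ (trans (sym p) q)
        ... | inj₁ p | inj₂ q = contradiction (trans (sym p) q) (x≢y i j)
        ... | inj₂ p | inj₁ q = contradiction (trans (sym q) p) (x≢y j i)
        linked-x : ∀ {i j} → i ≢ j → x j ≡ x i → j ∈ linked φ i
        linked-x {i} {j} i≢j eq = i≢j ∘ inj , x i , joins-at (joins i) , subst (λ z → Incident z (φ j)) eq (joins-at (joins j))
        linked-y : ∀ {i j} → i ≢ j → y j ≡ y i → j ∈ linked φ i
        linked-y {i} {j} i≢j eq = i≢j ∘ inj , y i , joins-at′ (joins i) , subst (λ z → Incident z (φ j)) eq (joins-at′ (joins j))
        beats-linked : ∀ {i} → beaters full i ⊆ linked φ i
        beats-linked (_ , inj₁ (eq , lt)) = linked-x (λ { refl → ℕ.<-irrefl refl lt }) eq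
        beats-linked (_ , inj₂ (eq , lt)) = linked-y (λ { refl → ℕ.<-irrefl refl lt }) eq
        loses-linked : ∀ {i j} → Loses i j → j ∈ linked φ i
        loses-linked (inj₁ (eq , lt , _)) = linked-x (λ { refl → ℕ.<-irrefl refl lt }) eq
        loses-linked (inj₂ (eq , lt , _)) = linked-y (λ { refl → ℕ.<-irrefl refl lt }) eq
        loses-¬beats : ∀ {i j} → Loses i j → ¬ j ∈ beaters full i
        loses-¬beats (inj₁ (_ , lt , _)) (_ , inj₁ (_ , gt)) = ℕ.<-asym lt gt
        loses-¬beats (inj₁ (_ , _ , ≢y)) (_ , inj₂ (eq , _)) = ≢y eq
        loses-¬beats (inj₂ (_ , _ , ≢x)) (_ , inj₁ (eq , _)) = ≢x eq
        loses-¬beats {i} {j} (inj₂ (_ , lt , _)) (_ , inj₂ (_ , gt)) = ℕ.<-asym gt (ℕ.∸-monoʳ-< lt (q-≤ {j}))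
        enough : (Λ : Fin (suc N) → List ℕ) → ∀ i → ∣ linked φ i ∣ + k ≤ dG R (φ i) + length (Λ i) → ∣ beaters full i ∣ < length (Λ i)
        enough Λ i big with beatable i
        ... | inj₁ (dG≤k , j , lj) = ℕ.+-cancelʳ-≤ k _ _ (begin
            suc ∣ beaters full i ∣ + k      ≤⟨ ℕ.+-monoˡ-≤ k (∣∣-< {A = beaters full i} {linked φ i} (λ {j} → beats-linked {i} {j}) (loses-linked lj) (loses-¬beats lj)) ⟩
            ∣ linked φ i ∣ + k              ≤⟨ big ⟩
            dG R (φ i) + length (Λ i)       ≤⟨ ℕ.+-monoˡ-≤ (length (Λ i)) dG≤k ⟩
            k + length (Λ i)                ≡⟨ ℕ.+-comm k _ ⟩
            length (Λ i) + k                ∎)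
          where open ℕ.≤-Reasoning
        ... | inj₂ (j , j′ , j≢j′ , lj , lj′) = ℕ.+-cancelʳ-≤ (suc k) _ _ (begin
            suc ∣ beaters full i ∣ + suc k  ≡⟨ ℕ.+-suc _ k ⟩
            suc (suc ∣ beaters full i ∣) + k ≤⟨ ℕ.+-monoˡ-≤ k two-losers ⟩
            ∣ linked φ i ∣ + k              ≤⟨ big ⟩
            dG R (φ i) + length (Λ i)       ≤⟨ ℕ.+-monoˡ-≤ (length (Λ i)) (dG≤ (φ∈ i)) ⟩
            suc k + length (Λ i)            ≡⟨ ℕ.+-comm (suc k) _ ⟩
            length (Λ i) + suc k            ∎)
          where
          open ℕ.≤-Reasoning
          two-losers : suc (suc ∣ beaters full i ∣) ≤ ∣ linked φ i ∣
          two-losers = ℕ.≤-trans (s≤s (∣∣-< {A = beaters full i} {linked φ i ∖ ⁅ j ⁆}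
                    (λ b → beats-linked b , λ { refl → loses-¬beats lj b })
                    (loses-linked lj′ , ≢-sym j≢j′) (loses-¬beats lj′)))
                  (ℕ.≤-reflexive (sym (∣∣-remove {i = j} (linked φ i) (loses-linked lj))))

  module _ (R : Sub size) where

    Class : ∀ {m} → (Fin m → Edge) → Vertex → Vertex → Set
    Class e u v = Injective _≡_ _≡_ e × (∀ i → e i ∈ R) × (∀ i → Joins (e i) u v)

    Pendant : ∀ {m} → (Fin m → Edge) → Vertex → (Fin m → Vertex) → Set
    Pendant e u z = Injective _≡_ _≡_ e × (∀ i → e i ∈ R) × (∀ i → Joins (e i) u (z i))

    pendant₂ : ∀ {a b u za zb} → a ≢ b → a ∈ R → b ∈ R → Joins a u za → Joins b u zb →
               Pendant (two a b) u (two za zb)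
    pendant₂ {a} {b} a≢b a∈ b∈ ja jb = inj , two-all (_∈ R) a∈ b∈ , λ { 0F → ja ; 1F → jb }
      where
      inj : Injective _≡_ _≡_ (two a b)
      inj {0F} {0F} _  = refl
      inj {0F} {1F} eq = contradiction eq a≢b
      inj {1F} {0F} eq = contradiction (sym eq) a≢b
      inj {1F} {1F} _  = refl

    pick-pendants : ∀ {u} (S : Sub size) → S ⊆ R ∩ at u → 2 ≤ ∣ S ∣ →
                    ∃₂ λ f z → Pendant {2} f u z × (∀ i → f i ∈ S)
    pick-pendants S S⊆ le with f , f′ , f≢f′ , f∈ , f′∈ ← pick-two S le
      with z , jf ← at-joins (proj₂ (S⊆ f∈)) | z′ , jf′ ← at-joins (proj₂ (S⊆ f′∈)) =
      two f f′ , two z z′ , pendant₂ f≢f′ (proj₁ (S⊆ f∈)) (proj₁ (S⊆ f′∈)) jf jf′ , two-all (_∈ S) f∈ f′∈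

    pick-class : ∀ m {u v} → u ≢ v → m ≤ μ R u v → ∃ λ (e : Fin m → Edge) → Class e u v
    pick-class m {u} {v} u≢v le with e , inj , e∈ ← pick m (R ∩ at u ∩ at v) le =
      e , inj , proj₁ ∘ e∈ , λ i → joins-both u≢v (proj₁ (proj₂ (e∈ i))) (proj₂ (proj₂ (e∈ i)))

  module _ (R : Sub size) (smaller : Smaller R) (dG≤ : ∀ {e} → e ∈ R → dG R e ≤ suc k) where

    separated : ∀ {N} {lab : Fin N → Vertex × Vertex} (X : Vertex → Set) → (∀ i → X (proj₁ (lab i)) × ¬ X (proj₂ (lab i))) →
                ∀ i j → proj₁ (lab i) ≢ proj₂ (lab j)
    separated X sep i j eq = proj₂ (sep j) (subst X eq (proj₁ (sep i)))

    private
      -- Keys in the order of the blocks that _⊕_ joins below; only their relative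
      -- order matters, and it gives every edge the losers it needs.
      fat-key : Fin 6 → ℕ
      fat-key = Vec.lookup (0 ∷ 1 ∷ 4 ∷ 5 ∷ 2 ∷ 3 ∷ [])

      fat₂-key : Fin 8 → ℕ
      fat₂-key = Vec.lookup (0 ∷ 1 ∷ 6 ∷ 7 ∷ 2 ∷ 3 ∷ 4 ∷ 5 ∷ [])

      star-key : Fin 11 → ℕ
      star-key = Vec.lookup (0 ∷ 2 ∷ 9 ∷ 1 ∷ 3 ∷ 10 ∷ 4 ∷ 5 ∷ 6 ∷ 7 ∷ 8 ∷ [])

      key-injective : ∀ {N} (key : Fin N → ℕ) → {True : _} → Injective _≡_ _≡_ key
      key-injective key {t} {i} {j} = toWitness {a? = all? λ i → all? λ j → (key i ℕ.≟ key j) →-dec (i Fin.≟ j)} t i j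

    module _ {x y : Vertex} (e : Fin 4 → Edge) (e-class : Class R e x y) where
      private
        e-inj = proj₁ e-class
        e∈ = proj₁ (proj₂ e-class)
        e-joins = proj₂ (proj₂ e-class)
        x≢y = joins-≢ (e-joins 0F)

      -- z ≢ z′ makes the configuration bipartite. Two parallel edges have keys below those of `f`
      -- and `g`, two above. The low ones beat `f` at `y` and the high ones beat `g` at `x`;
      -- conversely `f` beats the two high ones at `y` and `g` the two low ones at `x`. A parallel
      -- edge has only one loser, hence the bound on its neighbours.
      reduce-fat : ∀ {f g z z′} → f ∈ R → g ∈ R → Joins f y z → Joins g x z′ → z ≢ x → z′ ≢ y → z ≢ z′ →
                   (∀ i → dG R (e i) ≤ k) → Col R
      reduce-fat {f} {g} {z} {z′} f∈ g∈ f-joins g-joins z≢x z′≢y z≢z′ dGe≤k =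
        KernelReduction.kernel-reduce R φ (proj₁ ∘ lab) (proj₂ ∘ lab) fat-key
          (⊕-injective {a = e} e-inj (⊕-injective {a = f¹} {g¹} fin1-injective fin1-injective
              λ _ _ → differ (joins-at f-joins) (not-at g-joins (≢-sym x≢y) (≢-sym z′≢y)))
            λ i → ⊕-all {a = f¹} {g¹} (e i ≢_)
              (λ _ → differ (joins-at (e-joins i)) (not-at f-joins x≢y (≢-sym z≢x)))
              (λ _ → differ (joins-at′ (e-joins i)) (not-at g-joins (≢-sym x≢y) (≢-sym z′≢y))))
          (key-injective fat-key)
          (⊕-all {a = e} {f¹ ⊕ g¹} (_∈ R) e∈ (⊕-all {a = f¹} {g¹} (_∈ R) (λ _ → f∈) (λ _ → g∈)))
          smaller dG≤ joins (separated X sep) beatable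
        where
        f¹ g¹ : Fin 1 → Edge
        f¹ _ = f
        g¹ _ = g
        φ : Fin 6 → Edge
        φ = e ⊕ (f¹ ⊕ g¹)
        lab : Fin 6 → Vertex × Vertex
        lab = (λ (_ : Fin 4) → x , y) ⊕ ((λ (_ : Fin 1) → z , y) ⊕ (λ (_ : Fin 1) → x , z′))
        joins : ∀ i → Joins (φ i) (proj₁ (lab i)) (proj₂ (lab i))
        joins 0F = e-joins 0F
        joins 1F = e-joins 1F
        joins 2F = e-joins 2F
        joins 3F = e-joins 3F
        joins 4F = joins-sym f-joins
        joins 5F = g-joins
        X : Vertex → Set
        X v = v ≡ x ⊎ v ≡ z
        y∉X : ¬ X y
        y∉X = [ ≢-sym x≢y , joins-≢ f-joins ]′
        sep : ∀ i → X (proj₁ (lab i)) × ¬ X (proj₂ (lab i))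
        sep = ⊕-all {a = λ (_ : Fin 4) → x , y} (λ (u , v) → X u × ¬ X v) (λ _ → inj₁ refl , y∉X)
                (⊕-all {a = λ (_ : Fin 1) → z , y} {λ (_ : Fin 1) → x , z′} (λ (u , v) → X u × ¬ X v) (λ _ → inj₂ refl , y∉X)
                  (λ _ → inj₁ refl , [ ≢-sym (joins-≢ g-joins) , ≢-sym z≢z′ ]′))
        beatable : ∀ i → KernelReduction.Beatable R φ (proj₁ ∘ lab) (proj₂ ∘ lab) fat-key i
        beatable 0F = inj₁ (dGe≤k 0F , 4F , inj₂ (refl , ℕ.<ᵇ⇒< _ _ tt , z≢x))
        beatable 1F = inj₁ (dGe≤k 1F , 4F , inj₂ (refl , ℕ.<ᵇ⇒< _ _ tt , z≢x))
        beatable 2F = inj₁ (dGe≤k 2F , 5F , inj₁ (refl , ℕ.<ᵇ⇒< _ _ tt , z′≢y))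
        beatable 3F = inj₁ (dGe≤k 3F , 5F , inj₁ (refl , ℕ.<ᵇ⇒< _ _ tt , z′≢y))
        beatable 4F = inj₂ (2F , 3F , (λ ()) , inj₂ (refl , ℕ.<ᵇ⇒< _ _ tt , ≢-sym z≢x) , inj₂ (refl , ℕ.<ᵇ⇒< _ _ tt , ≢-sym z≢x))
        beatable 5F = inj₂ (0F , 1F , (λ ()) , inj₁ (refl , ℕ.<ᵇ⇒< _ _ tt , ≢-sym z′≢y) , inj₁ (refl , ℕ.<ᵇ⇒< _ _ tt , ≢-sym z′≢y))

      -- Doubling `f` and `g` gives two losers to each parallel edge as well, so that all of them
      -- may have k + 1 neighbours.
      reduce-fat₂ : ∀ {f g : Fin 2 → Edge} {z z′} → Pendant R f y z → Pendant R g x z′ → (∀ i → z i ≢ x) → (∀ i → z′ i ≢ y) →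
                    (∀ i j → z i ≢ z′ j) → Col R
      reduce-fat₂ {f} {g} {z} {z′} (f-inj , f∈ , f-joins) (g-inj , g∈ , g-joins) z≢x z′≢y z≢z′ =
        KernelReduction.kernel-reduce R φ (proj₁ ∘ lab) (proj₂ ∘ lab) fat₂-key
          (⊕-injective {a = e} e-inj (⊕-injective {a = f} {g} f-inj g-inj
              λ i j → differ (joins-at (f-joins i)) (not-at (g-joins j) (≢-sym x≢y) (≢-sym (z′≢y j))))
            λ i → ⊕-all {a = f} {g} (e i ≢_)
              (λ j → differ (joins-at (e-joins i)) (not-at (f-joins j) x≢y (≢-sym (z≢x j))))
              (λ j → differ (joins-at′ (e-joins i)) (not-at (g-joins j) (≢-sym x≢y) (≢-sym (z′≢y j)))))
          (key-injective fat₂-key)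
          (⊕-all {a = e} {f ⊕ g} (_∈ R) e∈ (⊕-all {a = f} {g} (_∈ R) f∈ g∈))
          smaller dG≤ joins (separated X sep) beatable
        where
        φ : Fin 8 → Edge
        φ = e ⊕ (f ⊕ g)
        lab : Fin 8 → Vertex × Vertex
        lab = (λ (_ : Fin 4) → x , y) ⊕ ((λ i → z i , y) ⊕ (λ i → x , z′ i))
        joins : ∀ i → Joins (φ i) (proj₁ (lab i)) (proj₂ (lab i))
        joins 0F = e-joins 0F
        joins 1F = e-joins 1F
        joins 2F = e-joins 2F
        joins 3F = e-joins 3F
        joins 4F = joins-sym (f-joins 0F)
        joins 5F = joins-sym (f-joins 1F)
        joins 6F = g-joins 0F
        joins 7F = g-joins 1F
        X : Vertex → Set
        X v = v ≡ x ⊎ ∃ λ i → v ≡ z i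
        y∉X : ¬ X y
        y∉X (inj₁ eq)       = x≢y (sym eq)
        y∉X (inj₂ (i , eq)) = joins-≢ (f-joins i) eq
        sep : ∀ i → X (proj₁ (lab i)) × ¬ X (proj₂ (lab i))
        sep = ⊕-all {a = λ (_ : Fin 4) → x , y} (λ (u , v) → X u × ¬ X v) (λ _ → inj₁ refl , y∉X)
                (⊕-all {a = λ i → z i , y} {λ i → x , z′ i} (λ (u , v) → X u × ¬ X v) (λ i → inj₂ (i , refl) , y∉X)
                  (λ i → inj₁ refl , [ ≢-sym (joins-≢ (g-joins i)) , (λ (j , eq) → z≢z′ j i (sym eq)) ]′))
        beatable : ∀ i → KernelReduction.Beatable R φ (proj₁ ∘ lab) (proj₂ ∘ lab) fat₂-key i
        beatable 0F = inj₂ (4F , 5F , (λ ()) , inj₂ (refl , ℕ.<ᵇ⇒< _ _ tt , z≢x 0F) , inj₂ (refl , ℕ.<ᵇ⇒< _ _ tt , z≢x 1F))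
        beatable 1F = inj₂ (4F , 5F , (λ ()) , inj₂ (refl , ℕ.<ᵇ⇒< _ _ tt , z≢x 0F) , inj₂ (refl , ℕ.<ᵇ⇒< _ _ tt , z≢x 1F))
        beatable 2F = inj₂ (6F , 7F , (λ ()) , inj₁ (refl , ℕ.<ᵇ⇒< _ _ tt , z′≢y 0F) , inj₁ (refl , ℕ.<ᵇ⇒< _ _ tt , z′≢y 1F))
        beatable 3F = inj₂ (6F , 7F , (λ ()) , inj₁ (refl , ℕ.<ᵇ⇒< _ _ tt , z′≢y 0F) , inj₁ (refl , ℕ.<ᵇ⇒< _ _ tt , z′≢y 1F))
        beatable 4F = inj₂ (2F , 3F , (λ ()) , inj₂ (refl , ℕ.<ᵇ⇒< _ _ tt , ≢-sym (z≢x 0F)) , inj₂ (refl , ℕ.<ᵇ⇒< _ _ tt , ≢-sym (z≢x 0F)))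
        beatable 5F = inj₂ (2F , 3F , (λ ()) , inj₂ (refl , ℕ.<ᵇ⇒< _ _ tt , ≢-sym (z≢x 1F)) , inj₂ (refl , ℕ.<ᵇ⇒< _ _ tt , ≢-sym (z≢x 1F)))
        beatable 6F = inj₂ (0F , 1F , (λ ()) , inj₁ (refl , ℕ.<ᵇ⇒< _ _ tt , ≢-sym (z′≢y 0F)) , inj₁ (refl , ℕ.<ᵇ⇒< _ _ tt , ≢-sym (z′≢y 0F)))
        beatable 7F = inj₂ (0F , 1F , (λ ()) , inj₁ (refl , ℕ.<ᵇ⇒< _ _ tt , ≢-sym (z′≢y 1F)) , inj₁ (refl , ℕ.<ᵇ⇒< _ _ tt , ≢-sym (z′≢y 1F)))

    -- The keys interleave the two lower edges of each triple, then come `g`, the pendants and the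
    -- two top edges. At `v`, where small keys win, a lower edge beats two edges outside its triple
    -- and `g` beats both top edges. At `u` and `u′`, where large keys win, a top edge beats the two
    -- pendants and a pendant beats the two lower edges.
    reduce-star : ∀ {v u u′ w : Vertex} {e e′ : Fin 3 → Edge} {g f f′ z z′} →
                  Class R e u v → Class R e′ u′ v → g ∈ R → Joins g w v → Pendant R {2} f u z → Pendant R {2} f′ u′ z′ →
                  u ≢ u′ → w ≢ u → w ≢ u′ → (∀ i → z i ≢ v × z i ≢ u′ × z i ≢ w) → (∀ i → z′ i ≢ v × z′ i ≢ u × z′ i ≢ w) →
                  Col R
    reduce-star {v} {u} {u′} {w} {e} {e′} {g} {f} {f′} {z} {z′} (e-inj , e∈ , e-joins) (e′-inj , e′∈ , e′-joins) g∈ g-joins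
                (f-inj , f∈ , f-joins) (f′-inj , f′∈ , f′-joins) u≢u′ w≢u w≢u′ z-free z′-free =
      KernelReduction.kernel-reduce R φ (proj₁ ∘ lab) (proj₂ ∘ lab) star-key
        (⊕-injective {a = e} e-inj
          (⊕-injective {a = e′} e′-inj
            (⊕-injective {a = g¹} fin1-injective
              (⊕-injective {a = f} f-inj f′-inj
                λ i j → differ (joins-at (f-joins i)) (not-at (f′-joins j) u≢u′ (≢-sym (proj₁ (proj₂ (z′-free j))))))
              λ _ → ⊕-all {a = f} {f′} (g ≢_)
                (λ j → differ (joins-at g-joins) (not-at (f-joins j) w≢u (≢-sym (proj₂ (proj₂ (z-free j))))))
                (λ j → differ (joins-at g-joins) (not-at (f′-joins j) w≢u′ (≢-sym (proj₂ (proj₂ (z′-free j)))))))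
            λ i → ⊕-all {a = g¹} (e′ i ≢_) (λ _ → differ (joins-at (e′-joins i)) (not-at g-joins (≢-sym w≢u′) u′≢v))
              (⊕-all {a = f} {f′} (e′ i ≢_)
                (λ j → differ (joins-at (e′-joins i)) (not-at (f-joins j) (≢-sym u≢u′) (≢-sym (proj₁ (proj₂ (z-free j))))))
                (λ j → differ (joins-at′ (e′-joins i)) (not-at (f′-joins j) (≢-sym u′≢v) (≢-sym (proj₁ (z′-free j)))))))
          λ i → ⊕-all {a = e′} (e i ≢_) (λ j → differ (joins-at (e-joins i)) (not-at (e′-joins j) u≢u′ u≢v))
            (⊕-all {a = g¹} (e i ≢_) (λ _ → differ (joins-at (e-joins i)) (not-at g-joins (≢-sym w≢u) u≢v))
              (⊕-all {a = f} {f′} (e i ≢_)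
                (λ j → differ (joins-at′ (e-joins i)) (not-at (f-joins j) (≢-sym u≢v) (≢-sym (proj₁ (z-free j)))))
                (λ j → differ (joins-at′ (e-joins i)) (not-at (f′-joins j) (≢-sym u′≢v) (≢-sym (proj₁ (z′-free j))))))))
        (key-injective star-key)
        (⊕-all {a = e} (_∈ R) e∈ (⊕-all {a = e′} (_∈ R) e′∈ (⊕-all {a = g¹} (_∈ R) (λ _ → g∈) (⊕-all {a = f} (_∈ R) f∈ f′∈))))
        smaller dG≤ joins (separated X sep) beatable
      where
      u≢v : u ≢ v
      u≢v = joins-≢ (e-joins 0F)
      u′≢v : u′ ≢ v
      u′≢v = joins-≢ (e′-joins 0F)
      w≢v : w ≢ v
      w≢v = joins-≢ g-joins
      g¹ : Fin 1 → Edge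
      g¹ _ = g
      φ : Fin 11 → Edge
      φ = e ⊕ (e′ ⊕ (g¹ ⊕ (f ⊕ f′)))
      ℓ₁ ℓ₂ : Fin 3 → Vertex × Vertex
      ℓ₁ _ = u , v
      ℓ₂ _ = u′ , v
      ℓ₃ : Fin 1 → Vertex × Vertex
      ℓ₃ _ = w , v
      ℓ₄ ℓ₅ : Fin 2 → Vertex × Vertex
      ℓ₄ i = u , z i
      ℓ₅ i = u′ , z′ i
      lab : Fin 11 → Vertex × Vertex
      lab = ℓ₁ ⊕ (ℓ₂ ⊕ (ℓ₃ ⊕ (ℓ₄ ⊕ ℓ₅)))
      joins : ∀ i → Joins (φ i) (proj₁ (lab i)) (proj₂ (lab i))
      joins 0F = e-joins 0F
      joins 1F = e-joins 1F
      joins 2F = e-joins 2F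
      joins 3F = e′-joins 0F
      joins 4F = e′-joins 1F
      joins 5F = e′-joins 2F
      joins 6F = g-joins
      joins 7F = f-joins 0F
      joins 8F = f-joins 1F
      joins 9F = f′-joins 0F
      joins (suc 9F) = f′-joins 1F
      X : Vertex → Set
      X a = a ≡ u ⊎ a ≡ u′ ⊎ a ≡ w
      v∉X : ¬ X v
      v∉X = [ ≢-sym u≢v , [ ≢-sym u′≢v , ≢-sym w≢v ]′ ]′
      sep : ∀ i → X (proj₁ (lab i)) × ¬ X (proj₂ (lab i))
      sep = ⊕-all {a = ℓ₁} S (λ _ → inj₁ refl , v∉X) (⊕-all {a = ℓ₂} S (λ _ → inj₂ (inj₁ refl) , v∉X)
              (⊕-all {a = ℓ₃} S (λ _ → inj₂ (inj₂ refl) , v∉X) (⊕-all {a = ℓ₄} {ℓ₅} S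
                (λ i → inj₁ refl , [ ≢-sym (joins-≢ (f-joins i)) , [ proj₁ (proj₂ (z-free i)) , proj₂ (proj₂ (z-free i)) ]′ ]′)
                (λ i → inj₂ (inj₁ refl) , [ proj₁ (proj₂ (z′-free i)) , [ ≢-sym (joins-≢ (f′-joins i)) , proj₂ (proj₂ (z′-free i)) ]′ ]′))))
        where
        S : Vertex × Vertex → Set
        S (a , b) = X a × ¬ X b
      open KernelReduction R φ (proj₁ ∘ lab) (proj₂ ∘ lab) star-key
      at-v : ∀ i j → proj₂ (lab j) ≡ proj₂ (lab i) → {T (star-key i <ᵇ star-key j)} → proj₁ (lab j) ≢ proj₁ (lab i) → Loses i j
      at-v _ _ eq {t} ≢x = inj₂ (eq , ℕ.<ᵇ⇒< _ _ t , ≢x)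
      at-u : ∀ i j → proj₁ (lab j) ≡ proj₁ (lab i) → {T (star-key j <ᵇ star-key i)} → proj₂ (lab j) ≢ proj₂ (lab i) → Loses i j
      at-u _ _ eq {t} ≢y = inj₁ (eq , ℕ.<ᵇ⇒< _ _ t , ≢y)
      beatable : ∀ i → Beatable i
      beatable 0F = inj₂ (3F , 4F , (λ ()) , at-v 0F 3F refl (≢-sym u≢u′) , at-v 0F 4F refl (≢-sym u≢u′))
      beatable 1F = inj₂ (4F , 6F , (λ ()) , at-v 1F 4F refl (≢-sym u≢u′) , at-v 1F 6F refl w≢u)
      beatable 2F = inj₂ (7F , 8F , (λ ()) , at-u 2F 7F refl (proj₁ (z-free 0F)) , at-u 2F 8F refl (proj₁ (z-free 1F)))
      beatable 3F = inj₂ (1F , 6F , (λ ()) , at-v 3F 1F refl u≢u′ , at-v 3F 6F refl w≢u′)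
      beatable 4F = inj₂ (6F , 2F , (λ ()) , at-v 4F 6F refl w≢u′ , at-v 4F 2F refl u≢u′)
      beatable 5F = inj₂ (9F , suc 9F , (λ ()) , at-u 5F 9F refl (proj₁ (z′-free 0F)) , at-u 5F (suc 9F) refl (proj₁ (z′-free 1F)))
      beatable 6F = inj₂ (2F , 5F , (λ ()) , at-v 6F 2F refl (≢-sym w≢u) , at-v 6F 5F refl (≢-sym w≢u′))
      beatable 7F = inj₂ (0F , 1F , (λ ()) , at-u 7F 0F refl (≢-sym (proj₁ (z-free 0F))) , at-u 7F 1F refl (≢-sym (proj₁ (z-free 0F))))
      beatable 8F = inj₂ (0F , 1F , (λ ()) , at-u 8F 0F refl (≢-sym (proj₁ (z-free 1F))) , at-u 8F 1F refl (≢-sym (proj₁ (z-free 1F))))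
      beatable 9F = inj₂ (3F , 4F , (λ ()) , at-u 9F 3F refl (≢-sym (proj₁ (z′-free 0F))) , at-u 9F 4F refl (≢-sym (proj₁ (z′-free 0F))))
      beatable (suc 9F) = inj₂ (3F , 4F , (λ ()) , at-u (suc 9F) 3F refl (≢-sym (proj₁ (z′-free 1F))) , at-u (suc 9F) 4F refl (≢-sym (proj₁ (z′-free 1F))))

  module _ (R : Sub size) (smaller : Smaller R) (dG≤ : ∀ {e} → e ∈ R → dG R e ≤ suc k)
           {j} {x y : Vertex} {e : Fin (2 + j) → Edge} {f g : Fin 2 → Edge} {z z′ : Fin 2 → Vertex}
           (e-class : Class R e x y) (f-pend : Pendant R f y z) (g-pend : Pendant R g x z′)
           (z≢x : ∀ i → z i ≢ x) (z′≢y : ∀ i → z′ i ≢ y) (z₀ : z 0F ≢ z′ 0F) (z₁ : z 1F ≢ z′ 1F)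
           (z₀₁ : z 0F ≡ z′ 1F) (z₁₀ : 2 ≤ j ⊎ z 1F ≡ z′ 0F) where

    private
      e-joins : ∀ i → Joins (e i) x y
      e-joins = proj₂ (proj₂ e-class)
      f-joins : ∀ i → Joins (f i) y (z i)
      f-joins = proj₂ (proj₂ f-pend)
      g-joins : ∀ i → Joins (g i) x (z′ i)
      g-joins = proj₂ (proj₂ g-pend)
      x≢y : x ≢ y
      x≢y = joins-≢ (e-joins 0F)

      φ : Fin (6 + j) → Edge
      φ = f ⊕ (g ⊕ e)

      φ-inj : Injective _≡_ _≡_ φ
      φ-inj = ⊕-injective {a = f} (proj₁ f-pend)
        (⊕-injective {a = g} {e} (proj₁ g-pend) (proj₁ e-class)
          λ i i′ eq → contradiction (joins-at′ (e-joins i′)) λ inc →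
            not-at (g-joins i) (≢-sym x≢y) (≢-sym (z′≢y i)) (subst (Incident y) (sym eq) inc))
        λ i → ⊕-all {a = g} {e} (f i ≢_)
          (λ i′ → differ (joins-at (f-joins i)) (not-at (g-joins i′) (≢-sym x≢y) (≢-sym (z′≢y i′))))
          (λ i′ eq → not-at (f-joins i) x≢y (≢-sym (z≢x i)) (subst (Incident x) (sym eq) (joins-at (e-joins i′))))

      link : ∀ {a b v} → Incident v (φ a) → Incident v (φ b) → b ∈ linked φ a ⊎ b ≡ a
      link {a} {b} {v} va vb with b Fin.≟ a
      ... | yes eq = inj₂ eq
      ... | no neq = inj₁ (neq ∘ sym ∘ φ-inj , v , va , vb)

      linked-≥ : ∀ a b c → (∀ t → t ∈ linked φ a ⊎ t ≡ a ⊎ t ≡ b ⊎ t ≡ c) → 3 + j ≤ ∣ linked φ a ∣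
      linked-≥ a b c cov = ℕ.+-cancelʳ-≤ 3 _ _ (begin
        3 + j + 3                                   ≡⟨ ℕ.+-comm (3 + j) 3 ⟩
        6 + j                                       ≡⟨ ∣full∣ (6 + j) ⟨
        ∣ full ∣                                    ≤⟨ ∣∣-cover {A = linked φ a} {⁅ a ⁆ ∪ (⁅ b ⁆ ∪ ⁅ c ⁆)} {full} (λ {t} _ → cov t) ⟩
        ∣ linked φ a ∣ + ∣ ⁅ a ⁆ ∪ (⁅ b ⁆ ∪ ⁅ c ⁆) ∣  ≤⟨ ℕ.+-monoʳ-≤ ∣ linked φ a ∣ three ⟩
        ∣ linked φ a ∣ + 3                          ∎)
        where
        open ℕ.≤-Reasoning
        ∪-≤ : ∀ (A B : Sub (6 + j)) → ∣ A ∪ B ∣ ≤ ∣ A ∣ + ∣ B ∣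
        ∪-≤ A B = ∣∣-cover {A = A} {B} {A ∪ B} id
        three : ∣ ⁅ a ⁆ ∪ (⁅ b ⁆ ∪ ⁅ c ⁆) ∣ ≤ 3
        three = ℕ.≤-trans (∪-≤ ⁅ a ⁆ (⁅ b ⁆ ∪ ⁅ c ⁆)) (ℕ.+-mono-≤ (ℕ.≤-reflexive (∣⁅i⁆∣ a))
                  (ℕ.≤-trans (∪-≤ ⁅ b ⁆ ⁅ c ⁆) (ℕ.+-mono-≤ (ℕ.≤-reflexive (∣⁅i⁆∣ b)) (ℕ.≤-reflexive (∣⁅i⁆∣ c)))))

      linked-≥₂ : ∀ a b → (∀ t → t ∈ linked φ a ⊎ t ≡ a ⊎ t ≡ b) → 4 + j ≤ ∣ linked φ a ∣
      linked-≥₂ a b cov = ℕ.+-cancelʳ-≤ 2 _ _ (begin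
        4 + j + 2                           ≡⟨ ℕ.+-comm (4 + j) 2 ⟩
        6 + j                               ≡⟨ ∣full∣ (6 + j) ⟨
        ∣ full ∣                            ≤⟨ ∣∣-cover {A = linked φ a} {⁅ a ⁆ ∪ ⁅ b ⁆} {full} (λ {t} _ → cov t) ⟩
        ∣ linked φ a ∣ + ∣ ⁅ a ⁆ ∪ ⁅ b ⁆ ∣  ≤⟨ ℕ.+-monoʳ-≤ ∣ linked φ a ∣ (ℕ.≤-trans (∣∣-cover {A = ⁅ a ⁆} {⁅ b ⁆} {⁅ a ⁆ ∪ ⁅ b ⁆} id)
                                                 (ℕ.≤-reflexive (cong₂ _+_ (∣⁅i⁆∣ a) (∣⁅i⁆∣ b)))) ⟩
        ∣ linked φ a ∣ + 2                  ∎)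
        where open ℕ.≤-Reasoning

      linked-≥₁ : ∀ a → (∀ t → t ∈ linked φ a ⊎ t ≡ a) → 5 + j ≤ ∣ linked φ a ∣
      linked-≥₁ a cov = ℕ.+-cancelʳ-≤ 1 _ _ (begin
        5 + j + 1                   ≡⟨ ℕ.+-comm (5 + j) 1 ⟩
        6 + j                       ≡⟨ ∣full∣ (6 + j) ⟨
        ∣ full ∣                    ≤⟨ ∣∣-cover {A = linked φ a} {⁅ a ⁆} {full} (λ {t} _ → cov t) ⟩
        ∣ linked φ a ∣ + ∣ ⁅ a ⁆ ∣  ≡⟨ cong (∣ linked φ a ∣ +_) (∣⁅i⁆∣ a) ⟩
        ∣ linked φ a ∣ + 1          ∎)
        where open ℕ.≤-Reasoning

      y∋f : ∀ i → Incident y (f i)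
      y∋f = joins-at ∘ f-joins
      x∋g : ∀ i → Incident x (g i)
      x∋g = joins-at ∘ g-joins
      x∋e : ∀ i → Incident x (e i)
      x∋e = joins-at ∘ e-joins
      y∋e : ∀ i → Incident y (e i)
      y∋e = joins-at′ ∘ e-joins
      z₀∋f : Incident (z 0F) (f 0F)
      z₀∋f = joins-at′ (f-joins 0F)
      z₀∋g : Incident (z 0F) (g 1F)
      z₀∋g = subst (λ v → Incident v (g 1F)) (sym z₀₁) (joins-at′ (g-joins 1F))

      linked-e : ∀ i → 5 + j ≤ ∣ linked φ (suc (suc (suc (suc i)))) ∣
      linked-e i = linked-≥₁ (suc (suc (suc (suc i)))) λ
        { 0F → link (y∋e i) (y∋f 0F) ; 1F → link (y∋e i) (y∋f 1F)
        ; 2F → link (x∋e i) (x∋g 0F) ; 3F → link (x∋e i) (x∋g 1F)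
        ; (suc (suc (suc (suc i′)))) → link (x∋e i) (x∋e i′) }

      linked-f₀ : 4 + j ≤ ∣ linked φ 0F ∣
      linked-f₀ = linked-≥₂ 0F 2F λ
        { 0F → inj₂ (inj₁ refl) ; 1F → Sum.map₂ inj₁ (link (y∋f 0F) (y∋f 1F)) ; 2F → inj₂ (inj₂ refl)
        ; 3F → Sum.map₂ inj₁ (link z₀∋f z₀∋g) ; (suc (suc (suc (suc i)))) → Sum.map₂ inj₁ (link (y∋f 0F) (y∋e i)) }

      linked-g₁ : 4 + j ≤ ∣ linked φ 3F ∣
      linked-g₁ = linked-≥₂ 3F 1F λ
        { 0F → Sum.map₂ inj₁ (link z₀∋g z₀∋f) ; 1F → inj₂ (inj₂ refl) ; 2F → Sum.map₂ inj₁ (link (x∋g 1F) (x∋g 0F))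
        ; 3F → inj₂ (inj₁ refl) ; (suc (suc (suc (suc i)))) → Sum.map₂ inj₁ (link (x∋g 1F) (x∋e i)) }

      linked-f₁ : 2 ≤ j × 3 + j ≤ ∣ linked φ 1F ∣ ⊎ 4 + j ≤ ∣ linked φ 1F ∣
      linked-f₁ = Sum.map
        (λ 2≤j → 2≤j , linked-≥ 1F 2F 3F λ
          { 0F → Sum.map₂ inj₁ (link (y∋f 1F) (y∋f 0F)) ; 1F → inj₂ (inj₁ refl) ; 2F → inj₂ (inj₂ (inj₁ refl))
          ; 3F → inj₂ (inj₂ (inj₂ refl)) ; (suc (suc (suc (suc i)))) → Sum.map₂ inj₁ (link (y∋f 1F) (y∋e i)) })
        (λ eq → linked-≥₂ 1F 3F λ
          { 0F → Sum.map₂ inj₁ (link (y∋f 1F) (y∋f 0F)) ; 1F → inj₂ (inj₁ refl)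
          ; 2F → Sum.map₂ inj₁ (link (joins-at′ (f-joins 1F)) (subst (λ v → Incident v (g 0F)) (sym eq) (joins-at′ (g-joins 0F))))
          ; 3F → inj₂ (inj₂ refl) ; (suc (suc (suc (suc i)))) → Sum.map₂ inj₁ (link (y∋f 1F) (y∋e i)) }) z₁₀

      linked-g₀ : 2 ≤ j × 3 + j ≤ ∣ linked φ 2F ∣ ⊎ 4 + j ≤ ∣ linked φ 2F ∣
      linked-g₀ = Sum.map
        (λ 2≤j → 2≤j , linked-≥ 2F 0F 1F λ
          { 0F → inj₂ (inj₂ (inj₁ refl)) ; 1F → inj₂ (inj₂ (inj₂ refl)) ; 2F → inj₂ (inj₁ refl)
          ; 3F → Sum.map₂ inj₁ (link (x∋g 0F) (x∋g 1F)) ; (suc (suc (suc (suc i)))) → Sum.map₂ inj₁ (link (x∋g 0F) (x∋e i)) })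
        (λ eq → linked-≥₂ 2F 0F λ
          { 0F → inj₂ (inj₂ refl)
          ; 1F → Sum.map₂ inj₁ (link (subst (λ v → Incident v (g 0F)) (sym eq) (joins-at′ (g-joins 0F))) (joins-at′ (f-joins 1F)))
          ; 2F → inj₂ (inj₁ refl)
          ; 3F → Sum.map₂ inj₁ (link (x∋g 0F) (x∋g 1F)) ; (suc (suc (suc (suc i)))) → Sum.map₂ inj₁ (link (x∋g 0F) (x∋e i)) }) z₁₀

      module Choose (Λ : Fin (6 + j) → List ℕ) (u : ∀ i → Unique (Λ i)) (big : ∀ i → ∣ linked φ i ∣ ≤ suc (length (Λ i))) where
        long : ∀ {n} i → suc n ≤ ∣ linked φ i ∣ → n ≤ length (Λ i)
        long i le = s≤s⁻¹ (ℕ.≤-trans le (big i))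

        long′ : ∀ i → 2 ≤ j × 3 + j ≤ ∣ linked φ i ∣ ⊎ 4 + j ≤ ∣ linked φ i ∣ → 2 ≤ j × 2 + j ≤ length (Λ i) ⊎ 3 + j ≤ length (Λ i)
        long′ i = Sum.map (λ (2≤j , le) → 2≤j , long i le) (long i)

        -- `saving` needs upper bounds for these lists, so they are cut down to the length 4 + j
        -- that is guaranteed.
        X Y : List ℕ
        X = take (4 + j) (Λ 5F)
        Y = take (4 + j) (Λ 4F)

        take-length : ∀ i → 5 + j ≤ ∣ linked φ i ∣ → length (take (4 + j) (Λ i)) ≡ 4 + j
        take-length i le = trans (length-take (4 + j) (Λ i)) (ℕ.m≤n⇒m⊓n≡m (long i le))

        take-∈ : ∀ {c} i → c ∈ˡ take (4 + j) (Λ i) → c ∈ˡ Λ i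
        take-∈ i c∈ = subst (_ ∈ˡ_) (take++drop≡id (4 + j) (Λ i)) (∈-++⁺ˡ c∈)

        σ : Saving (Λ 0F) (Λ 2F) (Λ 1F) (Λ 3F) X Y
        σ with 3≤P , 3≤Q , PQ , PQP , PQQ ← crossed-lengths (long 0F linked-f₀) (long′ 2F linked-g₀)
             | 3≤S , 3≤R , SR , _ ← crossed-lengths (long 3F linked-g₁) (long′ 1F linked-f₁) =
          saving (4 + j) (u 0F) (u 2F) (u 1F) (u 3F) 3≤P 3≤Q 3≤R 3≤S
            (ℕ.≤-reflexive (take-length 5F (linked-e 1F))) (ℕ.≤-reflexive (take-length 4F (linked-e 0F)))
            PQ (subst (6 + j ≤_) (ℕ.+-comm (length (Λ 3F)) _) SR) PQP PQQ

        open Saving σ using (p; q; r; s; p∈; q∈; r∈; s∈; p≢r; p≢s; q≢r; q≢s; X′; Y′; X′≤2; Y′≤3; blocksX; blocksY)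

        rest : ∃ λ (c : Fin j → ℕ) → (∀ i → c i ∈ˡ Λ (6+ i) × c i ∉ˡ p ∷ q ∷ r ∷ s ∷ []) × Injective _≡_ _≡_ c
        rest = distinctChoice j (λ i → Λ (6+ i)) (p ∷ q ∷ r ∷ s ∷ []) (λ i → u (6+ i))
                 λ i → ℕ.≤-trans (ℕ.≤-reflexive (ℕ.+-comm j 4)) (long (6+ i) (linked-e (suc (suc i))))

        w : Fin j → ℕ
        w = proj₁ rest

        -- The four edges of the pairs and the `j` further parallel edges are coloured already. They
        -- block at most 3 + j of the 4 + j colours here. The last edge, in `choice-v`, sees one
        -- more coloured edge but only two blocked colours from the pairs.
        choice-u : ∃ λ c → c ∈ˡ Y × c ∉ˡ Y′ ++ tabulate w
        choice-u = fresh (Y′ ++ tabulate w) (Unique.take⁺ (4 + j) (u 4F))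
          (subst₂ _<_ (sym (length-++ Y′)) (sym (take-length 4F (linked-e 0F)))
            (s≤s (ℕ.+-mono-≤ Y′≤3 (ℕ.≤-reflexive (length-tabulate w)))))

        cu : ℕ
        cu = proj₁ choice-u

        choice-v : ∃ λ c → c ∈ˡ X × c ∉ˡ X′ ++ cu ∷ tabulate w
        choice-v = fresh (X′ ++ cu ∷ tabulate w) (Unique.take⁺ (4 + j) (u 5F))
          (subst₂ _<_ (sym (length-++ X′)) (sym (take-length 5F (linked-e 1F)))
            (s≤s (ℕ.+-mono-≤ X′≤2 (s≤s (ℕ.≤-reflexive (length-tabulate w))))))

        cv : ℕ
        cv = proj₁ choice-v

        c : Fin (6 + j) → ℕ
        c 0F     = p
        c 1F     = r
        c 2F     = q
        c 3F     = s
        c 4F     = cu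
        c 5F     = cv
        c (6+ i) = w i

        c∈ : ∀ i → c i ∈ˡ Λ i
        c∈ 0F     = p∈
        c∈ 1F     = r∈
        c∈ 2F     = q∈
        c∈ 3F     = s∈
        c∈ 4F     = take-∈ 4F (proj₁ (proj₂ choice-u))
        c∈ 5F     = take-∈ 5F (proj₁ (proj₂ choice-v))
        c∈ (6+ i) = proj₁ (proj₁ (proj₂ rest) i)

        u-avoids : ∀ {a} → a ∈ˡ p ∷ q ∷ r ∷ s ∷ [] → a ≢ cu
        u-avoids a∈ refl = proj₂ (proj₂ choice-u) (∈-++⁺ˡ (All.lookup blocksY a∈ (proj₁ (proj₂ choice-u))))

        v-avoids : ∀ {a} → a ∈ˡ p ∷ q ∷ r ∷ s ∷ [] → a ≢ cv
        v-avoids a∈ refl = proj₂ (proj₂ choice-v) (∈-++⁺ˡ (All.lookup blocksX a∈ (proj₁ (proj₂ choice-v))))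

        w-avoids : ∀ {a} i → a ∈ˡ p ∷ q ∷ r ∷ s ∷ [] → a ≢ w i
        w-avoids i a∈ refl = proj₂ (proj₁ (proj₂ rest) i) a∈

        proper-< : ∀ a b → a Fin.< b → Adj (φ a) (φ b) → c a ≢ c b
        proper-< 0F 1F _ _ = p≢r
        proper-< 0F 2F _ adj = contradiction adj (not-adjacent (f-joins 0F) (g-joins 0F) x≢y (z≢x 0F) (z′≢y 0F) z₀)
        proper-< 0F 3F _ _ = p≢s
        proper-< 0F 4F _ _ = u-avoids (here refl)
        proper-< 0F 5F _ _ = v-avoids (here refl)
        proper-< 0F (6+ i) _ _ = w-avoids i (here refl)
        proper-< 1F 2F _ _ = ≢-sym q≢r
        proper-< 1F 3F _ adj = contradiction adj (not-adjacent (f-joins 1F) (g-joins 1F) x≢y (z≢x 1F) (z′≢y 1F) z₁)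
        proper-< 1F 4F _ _ = u-avoids (there (there (here refl)))
        proper-< 1F 5F _ _ = v-avoids (there (there (here refl)))
        proper-< 1F (6+ i) _ _ = w-avoids i (there (there (here refl)))
        proper-< 2F 3F _ _ = q≢s
        proper-< 2F 4F _ _ = u-avoids (there (here refl))
        proper-< 2F 5F _ _ = v-avoids (there (here refl))
        proper-< 2F (6+ i) _ _ = w-avoids i (there (here refl))
        proper-< 3F 4F _ _ = u-avoids (there (there (there (here refl))))
        proper-< 3F 5F _ _ = v-avoids (there (there (there (here refl))))
        proper-< 3F (6+ i) _ _ = w-avoids i (there (there (there (here refl))))
        proper-< 4F 5F _ _ eq = proj₂ (proj₂ choice-v) (∈-++⁺ʳ X′ (here (sym eq)))
        proper-< 4F (6+ i) _ _ eq = proj₂ (proj₂ choice-u) (∈-++⁺ʳ Y′ (subst (_∈ˡ tabulate w) (sym eq) (∈-tabulate⁺ i)))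
        proper-< 5F (6+ i) _ _ eq = proj₂ (proj₂ choice-v) (∈-++⁺ʳ X′ (there (subst (_∈ˡ tabulate w) (sym eq) (∈-tabulate⁺ i))))
        proper-< (6+ i) (6+ i′) _ (≢ , _) eq = ≢ (cong (λ i → φ (6+ i)) (proj₂ (proj₂ rest) eq))
        proper-< (suc _) 1F (s≤s ())
        proper-< (suc (suc _)) 2F (s≤s (s≤s ()))
        proper-< (suc (suc (suc _))) 3F (s≤s (s≤s (s≤s ())))
        proper-< (suc (suc (suc (suc _)))) 4F (s≤s (s≤s (s≤s (s≤s ()))))
        proper-< (suc (suc (suc (suc (suc _))))) 5F (s≤s (s≤s (s≤s (s≤s (s≤s ())))))

        proper : ∀ {a b} → Adj (φ a) (φ b) → c a ≢ c b
        proper {a} {b} adj with ℕ.<-cmp (toℕ a) (toℕ b)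
        ... | tri< lt _ _ = proper-< a b lt adj
        ... | tri≈ _ eq _ = contradiction (cong φ (Fin.toℕ-injective eq)) (proj₁ adj)
        ... | tri> _ _ gt = ≢-sym (proper-< b a gt (adj-sym adj))

    reduce-crossed : Col R
    reduce-crossed = reduce φ φ-inj φ∈ smaller λ Λ u big → let open Choose Λ u (λ i → fits i (big i)) in c , c∈ , λ {i} {i′} → proper {i} {i′}
      where
      φ∈ : ∀ i → φ i ∈ R
      φ∈ = ⊕-all {a = f} (_∈ R) (proj₁ (proj₂ f-pend)) (⊕-all {a = g} {e} (_∈ R) (proj₁ (proj₂ g-pend)) (proj₁ (proj₂ e-class)))
      fits : ∀ i {t} → ∣ linked φ i ∣ + k ≤ dG R (φ i) + t → ∣ linked φ i ∣ ≤ suc t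
      fits i {t} le = ℕ.+-cancelʳ-≤ k _ _ (ℕ.≤-trans le (ℕ.≤-trans (ℕ.+-monoˡ-≤ t (dG≤ (φ∈ i)))
        (ℕ.≤-reflexive (cong suc (ℕ.+-comm k t)))))

-- What remains when nothing is reducible

module Structure (H : Multigraph) (k : ℕ) (L : Multigraph.Edge H → List ℕ)
                 (uniq : ∀ e → Unique (L e)) (len : ∀ e → length (L e) ≡ k)
                 (nbrs≤ : ∀ e → ∣ Incidence.nbrs H e ∣ ≤ suc k)
                 (clique≤ : ∀ (C : Sub (Multigraph.size H)) →
                    (∀ {e f} → e ∈ C → f ∈ C → e ≢ f → Incidence.Adj H e f) → ∣ C ∣ ≤ k)
                 (seven : ∀ v → 7 ≤ ∣ Incidence.at H v ∣) where
  open Incidence H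
  open Configurations H k L uniq len

  module _ (R : Sub size) (smaller : Smaller R) where

    dG≤ : ∀ {e} → e ∈ R → dG R e ≤ suc k
    dG≤ {e} _ = ℕ.≤-trans (∣∣-mono {A = R ∩ nbrs e} {nbrs e} proj₂) (nbrs≤ e)

    reduce-single : ∀ {e} → e ∈ R → dG R e < k → Col R
    reduce-single {e} e∈R lt = reduce {R} {0} (λ _ → e) fin1-injective (λ _ → e∈R) smaller λ Λ u big →
      let c , c∈ = element (Λ 0F) (ℕ.+-cancelˡ-< (dG R e) 0 _ (begin-strict
            dG R e + 0                                ≡⟨ ℕ.+-identityʳ _ ⟩
            dG R e                                    <⟨ lt ⟩
            k                                         ≤⟨ ℕ.m≤n+m k _ ⟩
            ∣ linked {1} (λ _ → e) 0F ∣ + k           ≤⟨ big 0F ⟩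
            dG R e + length (Λ 0F)                    ∎))
      in (λ _ → c) , (λ { 0F → c∈ }) , λ adj → contradiction refl (proj₁ adj)
      where open ℕ.≤-Reasoning

    tight-or-reducible : Col R ⊎ (∀ e → e ∈ R → k ≤ dG R e)
    tight-or-reducible = ∀-or decide
      where
      decide : ∀ e → Col R ⊎ (e ∈ R → k ≤ dG R e)
      decide e with mem? R e | k ℕ.≤? dG R e
      ... | _       | yes le = inj₂ λ _ → le
      ... | no  e∉R | no _   = inj₂ λ e∈R → contradiction e∈R e∉R
      ... | yes e∈R | no k≰  = inj₁ (reduce-single e∈R (ℕ.≰⇒> k≰))

    module Fat {e₀ x y} (e₀∈R : e₀ ∈ R) (j₀ : Joins e₀ x y) (fat : 4 ≤ μ R x y) (k≤ : k ≤ dG R e₀) where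

      x≢y : x ≢ y
      x≢y = joins-≢ j₀

      U F G : Sub size
      U = (R ∩ at x) ∪ (R ∩ at y)
      F = (R ∩ at y) ∖ at x
      G = (R ∩ at x) ∖ at y

      ∣U∣ : ∣ U ∣ ≡ suc (dG R e₀)
      ∣U∣ = union-size R e₀∈R j₀

      Pair : Sub size → Set
      Pair C = ∃₂ λ f g → (f ∈ F × f ∈ C) × (g ∈ G × g ∈ C) × ¬ Adj f g

      -- More than k edges are no clique, and two non-adjacent edges of `U` cannot meet the same end
      -- of `e₀`: one is at `y` only, the other at `x` only.
      pair : ∀ C → C ⊆ U → k < ∣ C ∣ → Pair C
      pair C C⊆U lt with any? (λ e → any? (λ f → mem? C e ×-dec mem? C f ×-dec ¬? (e Fin.≟ f) ×-dec ¬? (adj? e f)))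
      ... | no ∄ = contradiction (clique≤ C λ {e} {f} e∈ f∈ e≢f →
              decidable-stable (adj? e f) λ ¬a → ∄ (e , f , e∈ , f∈ , e≢f , ¬a)) (ℕ.<⇒≱ lt)
      ... | yes (e , f , e∈C , f∈C , e≢f , ¬a) = sides (C⊆U e∈C) (C⊆U f∈C)
        where
        sides : e ∈ U → f ∈ U → Pair C
        sides (inj₁ (_ , xe)) (inj₁ (_ , xf)) = contradiction (e≢f , x , xe , xf) ¬a
        sides (inj₂ (_ , ye)) (inj₂ (_ , yf)) = contradiction (e≢f , y , ye , yf) ¬a
        sides (inj₁ (re , xe)) (inj₂ (rf , yf)) = f , e , (((rf , yf) , λ xf → ¬a (e≢f , x , xe , xf)) , f∈C) ,
          (((re , xe) , λ ye → ¬a (e≢f , y , ye , yf)) , e∈C) , ¬a ∘ adj-sym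
        sides (inj₂ (re , ye)) (inj₁ (rf , xf)) = e , f , (((re , ye) , λ xe → ¬a (e≢f , x , xe , xf)) , e∈C) ,
          (((rf , xf) , λ yf → ¬a (e≢f , y , ye , yf)) , f∈C) , ¬a

      ends-≢ : ∀ {f g z z′} → f ∈ F → g ∈ G → Joins f y z → Joins g x z′ → ¬ Adj f g → z ≢ z′
      ends-≢ (_ , ¬xf) ((_ , xg) , _) jf jg ¬a eq = ¬a (share-end jf jg (λ { refl → ¬xf xg }) eq)

      end-F : ∀ {f} → f ∈ F → ∃ λ z → Joins f y z × z ≢ x
      end-F ((_ , yf) , ¬xf) with z , jf ← at-joins yf = z , jf , λ { refl → ¬xf (joins-at′ jf) }

      end-G : ∀ {g} → g ∈ G → ∃ λ z → Joins g x z × z ≢ y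
      end-G ((_ , xg) , ¬yg) with z , jg ← at-joins xg = z , jg , λ { refl → ¬yg (joins-at′ jg) }

      fat₀ : dG R e₀ ≤ k → Col R
      fat₀ dG≤k
        with f , g , (f∈F , _) , (g∈G , _) , ¬a ← pair U id (subst (k <_) (sym ∣U∣) (s≤s k≤))
        with z , jf , z≢x ← end-F f∈F | z′ , jg , z′≢y ← end-G g∈G
        with e , e-class@(_ , e∈ , e-joins) ← pick-class R 4 x≢y fat =
        reduce-fat R smaller dG≤ e e-class (proj₁ (proj₁ f∈F)) (proj₁ (proj₁ g∈G)) jf jg z≢x z′≢y
          -- By `degree-sum` parallel edges have equally many neighbours, so the bound for `e₀`
          -- holds for all four.
          (ends-≢ f∈F g∈G jf jg ¬a) λ i → ℕ.≤-trans (ℕ.≤-reflexive (ℕ.suc-injective (ℕ.+-cancelʳ-≡ (μ R x y) _ _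
            (trans (degree-sum R (e∈ i) (e-joins i)) (sym (degree-sum R e₀∈R j₀)))))) dG≤k

      TwoPairs : Set
      TwoPairs = ∃₂ λ f₀ f₁ → ∃₂ λ g₀ g₁ → f₀ ∈ F × f₁ ∈ F × g₀ ∈ G × g₁ ∈ G × f₀ ≢ f₁ × g₀ ≢ g₁ ×
                 ¬ Adj f₀ g₀ × ¬ Adj f₁ g₁

      enough : k < dG R e₀ → ∀ {h} → h ∈ U → k < ∣ U ∖ ⁅ h ⁆ ∣
      enough k< h∈U = s≤s⁻¹ (subst (suc (suc k) ≤_) (trans (sym ∣U∣) (∣∣-remove U h∈U)) (s≤s k<))

      -- `U` has at least k + 2 edges, so a non-adjacent pair is left after the removal of any one
      -- of them. Such pairs do not all pass through one edge, and their bipartite structure then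
      -- yields two disjoint ones.
      two-pairs : k < dG R e₀ → TwoPairs
      two-pairs k<
        with f₀ , g₀ , (f₀∈F , f₀∈U) , (g₀∈G , g₀∈U) , ¬a₀ ← pair U id (subst (k <_) (sym ∣U∣) (ℕ.m<n⇒m<1+n k<))
        with f₁ , g₁ , (f₁∈F , _ , f₁≢) , (g₁∈G , _) , ¬a₁ ← pair (U ∖ ⁅ f₀ ⁆) proj₁ (enough k< f₀∈U)
        with g₁ Fin.≟ g₀
      ... | no g₁≢g₀ = f₀ , f₁ , g₀ , g₁ , f₀∈F , f₁∈F , g₀∈G , g₁∈G , ≢-sym f₁≢ , ≢-sym g₁≢g₀ , ¬a₀ , ¬a₁
      ... | yes refl
        with f₂ , g₂ , (f₂∈F , _) , (g₂∈G , _ , g₂≢) , ¬a₂ ← pair (U ∖ ⁅ g₀ ⁆) proj₁ (enough k< g₀∈U)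
        with f₂ Fin.≟ f₀
      ...   | no f₂≢f₀ = f₀ , f₂ , g₀ , g₂ , f₀∈F , f₂∈F , g₀∈G , g₂∈G , ≢-sym f₂≢f₀ , ≢-sym g₂≢ , ¬a₀ , ¬a₂
      ...   | yes refl = f₀ , f₁ , g₂ , g₀ , f₀∈F , f₁∈F , g₂∈G , g₀∈G , ≢-sym f₁≢ , g₂≢ , ¬a₂ , ¬a₁

      -- A far end shared by `f₀`, `g₁` or by `f₁`, `g₀` closes a triangle and calls for the saving
      -- argument. If there is none, the far ends at `x` and at `y` are disjoint and the
      -- configuration is bipartite.
      fat₁ : TwoPairs → Col R
      fat₁ (f₀ , f₁ , g₀ , g₁ , f₀∈F , f₁∈F , g₀∈G , g₁∈G , f₀≢f₁ , g₀≢g₁ , ¬a₀ , ¬a₁)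
        with z₀ , jf₀ , z₀≢x ← end-F f₀∈F | z₁ , jf₁ , z₁≢x ← end-F f₁∈F
           | z₀′ , jg₀ , z₀′≢y ← end-G g₀∈G | z₁′ , jg₁ , z₁′≢y ← end-G g₁∈G
        with e , e-class ← pick-class R 4 x≢y fat
        with z₀ Fin.≟ z₁′ | z₁ Fin.≟ z₀′
      ... | yes eq | _ =
        reduce-crossed R smaller dG≤ e-class (pendant₂ R f₀≢f₁ (proj₁ (proj₁ f₀∈F)) (proj₁ (proj₁ f₁∈F)) jf₀ jf₁)
          (pendant₂ R g₀≢g₁ (proj₁ (proj₁ g₀∈G)) (proj₁ (proj₁ g₁∈G)) jg₀ jg₁)
          (two-all (_≢ x) z₀≢x z₁≢x) (two-all (_≢ y) z₀′≢y z₁′≢y)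
          (ends-≢ f₀∈F g₀∈G jf₀ jg₀ ¬a₀) (ends-≢ f₁∈F g₁∈G jf₁ jg₁ ¬a₁) eq (inj₁ ℕ.≤-refl)
      ... | no _ | yes eq =
        reduce-crossed R smaller dG≤ e-class (pendant₂ R (≢-sym f₀≢f₁) (proj₁ (proj₁ f₁∈F)) (proj₁ (proj₁ f₀∈F)) jf₁ jf₀)
          (pendant₂ R (≢-sym g₀≢g₁) (proj₁ (proj₁ g₁∈G)) (proj₁ (proj₁ g₀∈G)) jg₁ jg₀)
          (two-all (_≢ x) z₁≢x z₀≢x) (two-all (_≢ y) z₁′≢y z₀′≢y)
          (ends-≢ f₁∈F g₁∈G jf₁ jg₁ ¬a₁) (ends-≢ f₀∈F g₀∈G jf₀ jg₀ ¬a₀) eq (inj₁ ℕ.≤-refl)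
      ... | no z₀≢z₁′ | no z₁≢z₀′ =
        reduce-fat₂ R smaller dG≤ e e-class (pendant₂ R f₀≢f₁ (proj₁ (proj₁ f₀∈F)) (proj₁ (proj₁ f₁∈F)) jf₀ jf₁)
          (pendant₂ R g₀≢g₁ (proj₁ (proj₁ g₀∈G)) (proj₁ (proj₁ g₁∈G)) jg₀ jg₁)
          (two-all (_≢ x) z₀≢x z₁≢x) (two-all (_≢ y) z₀′≢y z₁′≢y)
          λ { 0F 0F → ends-≢ f₀∈F g₀∈G jf₀ jg₀ ¬a₀ ; 0F 1F → z₀≢z₁′ ; 1F 0F → z₁≢z₀′ ; 1F 1F → ends-≢ f₁∈F g₁∈G jf₁ jg₁ ¬a₁ }

      reduce-class : Col R
      reduce-class with dG R e₀ ℕ.≤? k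
      ... | yes le = fat₀ le
      ... | no k≱  = fat₁ (two-pairs (ℕ.≰⇒> k≱))

    thin-or-reducible : (∀ e → e ∈ R → k ≤ dG R e) → Col R ⊎ (∀ e → e ∈ R → μ R (end₁ e) (end₂ e) ≤ 3)
    thin-or-reducible tight = ∀-or decide
      where
      decide : ∀ e → Col R ⊎ (e ∈ R → μ R (end₁ e) (end₂ e) ≤ 3)
      decide e with mem? R e | μ R (end₁ e) (end₂ e) ℕ.≤? 3
      ... | _       | yes le = inj₂ λ _ → le
      ... | no  e∉R | no _   = inj₂ λ e∈R → contradiction e∈R e∉R
      ... | yes e∈R | no ≰3  = inj₁ (Fat.reduce-class e∈R (joins-ends e) (ℕ.≰⇒> ≰3) (tight e e∈R))

    -- Here the pairs `f`, `g′` and `f′`, `g` are non-adjacent while both crossings are present, so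
    -- two parallel edges are enough.
    reduce-two-triangles : ∀ {x y z z′ f f′ g g′} → x ≢ y → 2 ≤ μ R x y → z ≢ z′ →
      f ∈ R → f′ ∈ R → g ∈ R → g′ ∈ R → Joins f y z → Joins f′ y z′ → Joins g x z → Joins g′ x z′ → Col R
    reduce-two-triangles x≢y 2≤μ z≢z′ f∈ f′∈ g∈ g′∈ jf jf′ jg jg′ with e , e-class ← pick-class R 2 x≢y 2≤μ =
      reduce-crossed R smaller dG≤ {0} e-class
        (pendant₂ R (λ { refl → z≢z′ (joins-other jf jf′) }) f∈ f′∈ jf jf′)
        (pendant₂ R (λ { refl → z≢z′ (sym (joins-other jg′ jg)) }) g′∈ g∈ jg′ jg)
        (two-all (_≢ _) (≢-sym (joins-≢ jg)) (≢-sym (joins-≢ jg′))) (two-all (_≢ _) (≢-sym (joins-≢ jf′)) (≢-sym (joins-≢ jf)))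
        z≢z′ (≢-sym z≢z′) refl (inj₂ refl)

  -- Lost edges and vertices of large degree

  module Tight (R : Sub size) (smaller : Smaller R) (tight : ∀ e → e ∈ R → k ≤ dG R e)
               (thin : ∀ e → e ∈ R → μ R (end₁ e) (end₂ e) ≤ 3) where

    μ-sym : ∀ u v → μ R u v ≡ μ R v u
    μ-sym u v = ∣∣-cong {A = R ∩ at u ∩ at v} {R ∩ at v ∩ at u} (λ (r , a , b) → r , b , a) (λ (r , a , b) → r , b , a)

    μ≤3 : ∀ {e u v} → e ∈ R → Joins e u v → μ R u v ≤ 3
    μ≤3 {e} e∈R (inj₁ (refl , refl)) = thin e e∈R
    μ≤3 {e} e∈R (inj₂ (refl , refl)) = subst (_≤ 3) (μ-sym (end₁ e) (end₂ e)) (thin e e∈R)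

    lost-≤k : ∀ {e l v} → e ∈ R → ¬ l ∈ R → Incident v e → Incident v l → dG R e ≤ k
    lost-≤k {e} {l} {v} e∈R l∉R ve vl = s≤s⁻¹ (ℕ.≤-trans (∣∣-< {A = R ∩ nbrs e} {nbrs e} proj₂
      ((λ { refl → l∉R e∈R }) , v , ve , vl) (l∉R ∘ proj₁)) (nbrs≤ e))

    lost-unique : ∀ {e l l′} → e ∈ R → ¬ l ∈ R → ¬ l′ ∈ R → Adj e l → Adj e l′ → l ≡ l′
    lost-unique {e} {l} {l′} e∈R l∉R l′∉R a a′ with l Fin.≟ l′
    ... | yes eq = eq
    ... | no neq = contradiction (nbrs≤ e) (ℕ.<⇒≱ (begin-strict
      suc k                       ≤⟨ s≤s (tight e e∈R) ⟩
      suc (dG R e)                ≤⟨ ∣∣-< {A = R ∩ nbrs e} {nbrs e ∖ ⁅ l ⁆} (λ (r , n) → n , λ { refl → l∉R r })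
                                       (a′ , ≢-sym neq) (l′∉R ∘ proj₁) ⟩
      ∣ nbrs e ∖ ⁅ l ⁆ ∣          <⟨ ℕ.≤-refl ⟩
      suc ∣ nbrs e ∖ ⁅ l ⁆ ∣      ≡⟨ ∣∣-remove {i = l} (nbrs e) a ⟨
      ∣ nbrs e ∣                  ∎))
      where open ℕ.≤-Reasoning

    Lost : Vertex → Set
    Lost v = ∃ λ l → ¬ l ∈ R × Incident v l

    -- An edge of `R` has at least k neighbours in `R` and at most k + 1 altogether, so at most one
    -- of the seven or more edges at `v` is lost. If one is, `lost-≤k` compensates for the smaller
    -- degree.
    vertex-cases : ∀ {e v} → e ∈ R → Incident v e → 7 ≤ d R v ⊎ (6 ≤ d R v × Lost v)
    vertex-cases {e} {v} e∈R ve with any? (λ l → ¬? (mem? R l) ×-dec incident? v l)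
    ... | no ∄ = inj₁ (ℕ.≤-trans (seven v) (∣∣-mono {A = at v} {R ∩ at v}
            λ {l} vl → decidable-stable (mem? R l) (λ l∉R → ∄ (l , l∉R , vl)) , vl))
    ... | yes (l , l∉R , vl) = inj₂ (s≤s⁻¹ (begin
            7                             ≤⟨ seven v ⟩
            ∣ at v ∣                      ≤⟨ ∣∣-cover {A = ⁅ l ⁆} {R ∩ at v} {at v} cov ⟩
            ∣ ⁅ l ⁆ ∣ + d R v             ≡⟨ cong (_+ d R v) (∣⁅i⁆∣ l) ⟩
            suc (d R v)                   ∎) , l , l∉R , vl)
      where
      open ℕ.≤-Reasoning
      cov : ∀ {i} → Incident v i → i ∈ ⁅ l ⁆ ⊎ i ∈ R ∩ at v
      cov {i} vi with mem? R i
      ... | yes i∈R = inj₂ (i∈R , vi)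
      ... | no  i∉R = inj₁ (lost-unique e∈R i∉R l∉R ((λ { refl → i∉R e∈R }) , v , ve , vi) ((λ { refl → l∉R e∈R }) , v , ve , vl))

    deg≥6 : ∀ {e v} → e ∈ R → Incident v e → 6 ≤ d R v
    deg≥6 e∈R ve = [ ℕ.<⇒≤ , proj₁ ]′ (vertex-cases e∈R ve)

    remaining : ∀ (X : Sub size) v → ∣ X ∣ ≤ ∣ X ∩ at v ∣ + ∣ X ∖ at v ∣
    remaining X v = ℕ.≤-reflexive (sym (∣∣-split X (at v)))

    module Hub {v u e₀} (e₀∈R : e₀ ∈ R) (j₀ : Joins e₀ u v) (k≤ : k ≤ 2 + d R v) where

      spoke-≤ : ∀ {e w} → e ∈ R → Joins e w v → d R w + d R v ≤ suc (dG R e + μ R w v)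
      spoke-≤ e∈R j = ℕ.≤-reflexive (sym (degree-sum R e∈R j))

      spoke-deg : ∀ {e w} → e ∈ R → Joins e w v → d R w ≤ 7
      spoke-deg {e} e∈R j = edge-a≤7 {dG R e} (spoke-≤ e∈R j) (dG≤ R smaller e∈R) (μ≤3 e∈R j) k≤

      -- In `degree-sum` for a spoke, a large degree of `v` forces multiplicity at least 3;
      -- multiplicity at most 3 in turn keeps the degree of `v` at k - 2.
      spoke-triple : ∀ {e w} → e ∈ R → Joins e w v → 3 ≤ μ R w v × 2 + d R v ≤ k
      spoke-triple {e} e∈R j with vertex-cases e∈R (joins-at j)
      ... | inj₁ 7≤ = edge-3≤m {dG R e} 1 7≤ (spoke-≤ e∈R j) (dG≤ R smaller e∈R) k≤ ,
                      edge-2+b≤k {dG R e} 1 7≤ (spoke-≤ e∈R j) (dG≤ R smaller e∈R) (μ≤3 e∈R j)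
      ... | inj₂ (6≤ , l , l∉R , wl) = edge-3≤m {dG R e} 0 6≤ (spoke-≤ e∈R j) (lost-≤k e∈R l∉R (joins-at j) wl) k≤ ,
                      edge-2+b≤k {dG R e} 0 6≤ (spoke-≤ e∈R j) (lost-≤k e∈R l∉R (joins-at j) wl) (μ≤3 e∈R j)

      spoke-not-at : ∀ (X : Sub size) w → X ⊆ R ∩ at v → ∀ {e} → e ∈ R → Joins e w v → ∣ X ∣ ≤ 3 + ∣ X ∖ at w ∣
      spoke-not-at X w X⊆ e∈R j = ℕ.≤-trans (remaining X w) (ℕ.+-monoˡ-≤ _ (ℕ.≤-trans
        (∣∣-mono {A = X ∩ at w} {R ∩ at w ∩ at v} λ (x , aw) → proj₁ (X⊆ x) , aw , proj₂ (X⊆ x)) (μ≤3 e∈R j)))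

      spoke : ∀ {e} → e ∈ R → Incident v e → ∃ λ w → Joins e w v
      spoke e∈R ve with w , j ← at-joins ve = w , joins-sym j

      other-than-u : ∃₂ λ e w → e ∈ R × Joins e w v × w ≢ u
      other-than-u with e , (e∈R , ve) , ¬ue ← ∣∣-positive ((R ∩ at v) ∖ at u)
             (ℕ.+-cancelˡ-≤ 3 1 _ (ℕ.≤-trans (ℕ.≤-trans (s≤s (s≤s (s≤s (s≤s z≤n)))) (deg≥6 e₀∈R (joins-at′ j₀)))
               (spoke-not-at (R ∩ at v) u id e₀∈R j₀)))
             with w , j ← spoke e∈R ve = e , w , e∈R , j , λ { refl → ¬ue (joins-at j) }

      -- A lost edge at v would have to be lost at every neighbour of v as well.
      v-deg≥7 : 7 ≤ d R v
      v-deg≥7 with vertex-cases e₀∈R (joins-at′ j₀)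
      ... | inj₁ 7≤ = 7≤
      ... | inj₂ (_ , l , l∉R , vl) with e , w , e∈R , j , w≢u ← other-than-u =
        contradiction (joins-only (joins-both (joins-≢ j₀) (l-at e₀∈R j₀) vl) (l-at e∈R j)) [ w≢u , joins-≢ j ]′
        where
        l-at : ∀ {e w} → e ∈ R → Joins e w v → Incident w l
        l-at {e} {w} e∈R j with vertex-cases e∈R (joins-at j)
        ... | inj₁ 7≤ = contradiction (edge-lost {dG R e} 7≤ (spoke-≤ e∈R j) (lost-≤k e∈R l∉R (joins-at′ j) vl) (μ≤3 e∈R j) k≤) λ ()
        ... | inj₂ (_ , l′ , l′∉R , wl′) with refl ← lost-unique e∈R l∉R l′∉R
                ((λ { refl → l∉R e∈R }) , v , joins-at′ j , vl) ((λ { refl → l′∉R e∈R }) , w , joins-at j , wl′) = wl′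

      module Spokes {e₁ e₂ u₁ u₂} (e₁∈R : e₁ ∈ R) (j₁ : Joins e₁ u₁ v) (e₂∈R : e₂ ∈ R) (j₂ : Joins e₂ u₂ v)
                    (u₁≢u : u₁ ≢ u) (u₂≢u : u₂ ≢ u) (u₂≢u₁ : u₂ ≢ u₁) where

        -- Three spokes of multiplicity three give `v` degree at least 9, and this degree is at most
        -- k - 2.
        11≤k : 11 ≤ k
        11≤k = ℕ.≤-trans (s≤s (s≤s (begin
          9                                                ≤⟨ ℕ.+-mono-≤ (proj₁ (spoke-triple e₀∈R j₀))
                                                                (ℕ.+-mono-≤ (proj₁ (spoke-triple e₁∈R j₁)) (proj₁ (spoke-triple e₂∈R j₂))) ⟩
          μ R u v + (μ R u₁ v + μ R u₂ v)                  ≤⟨ ℕ.+-monoʳ-≤ (μ R u v) (∣∣-⊎ {A = R ∩ at u₁ ∩ at v} {R ∩ at u₂ ∩ at v}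
                                                                {(R ∩ at v) ∖ at u} (λ (r , a , b) → (r , b) , clash u₁≢u (joins-≢ j₁) (joins-≢ j₀) a b)
                                                                (λ (r , a , b) → (r , b) , clash u₂≢u (joins-≢ j₂) (joins-≢ j₀) a b)
                                                                λ (_ , a , b) (_ , a′ , _) → clash u₂≢u₁ (joins-≢ j₂) (joins-≢ j₁) a′ b a) ⟩
          μ R u v + ∣ (R ∩ at v) ∖ at u ∣                  ≤⟨ ∣∣-⊎ {A = R ∩ at u ∩ at v} {(R ∩ at v) ∖ at u} {R ∩ at v}
                                                                (λ (r , _ , b) → r , b) proj₁ (λ (_ , a , _) (_ , ¬a) → ¬a a) ⟩
          d R v                                            ∎))) (proj₂ (spoke-triple e₀∈R j₀))
          where
          open ℕ.≤-Reasoning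
          clash : ∀ {e a b} → a ≢ b → a ≢ v → b ≢ v → Incident a e → Incident v e → ¬ Incident b e
          clash a≢b a≢v b≢v ae ve be = [ ≢-sym a≢b , b≢v ]′ (joins-only (joins-both a≢v ae ve) be)

      away : Vertex → Vertex → Vertex → Sub size
      away a b c = (((R ∩ at a) ∖ at v) ∖ at b) ∖ at c

      edge-between : ∀ a b → (∃ λ h → h ∈ R × Incident a h × Incident b h) ⊎ μ R a b ≡ 0
      edge-between a b with any? (λ h → mem? R h ×-dec incident? a h ×-dec incident? b h)
      ... | yes p = inj₁ p
      ... | no ∄  = inj₂ (∣∣-empty (R ∩ at a ∩ at b) λ h → ∄ (_ , h))

      -- An edge between `a` and `b` has at least 11 neighbours, whereas `b` has degree at most 7;
      -- the remainder has to be at `a`.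
      spokes-apart : ∀ {eₐ e_b a b} → 11 ≤ k → eₐ ∈ R → Joins eₐ a v → e_b ∈ R → Joins e_b b v → a ≢ b → 5 + μ R a b ≤ d R a
      spokes-apart {a = a} {b} 11≤k eₐ∈ jₐ e_b∈ j_b a≢b with edge-between a b
      ... | inj₂ none = subst (λ t → 5 + t ≤ d R a) (sym none) (ℕ.<⇒≤ (deg≥6 eₐ∈ (joins-at jₐ)))
      ... | inj₁ (h , h∈R , ah , bh) = edge-5+m≤a {dG R h} (ℕ.≤-reflexive (degree-sum R h∈R (joins-both a≢b ah bh)))
                                         11≤k (tight h h∈R) (spoke-deg e_b∈ j_b)

      away-count : ∀ a b c → d R a ≤ μ R a v + (μ R a b + (μ R a c + ∣ away a b c ∣))
      away-count a b c = begin
          d R a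
            ≤⟨ remaining (R ∩ at a) v ⟩
          ∣ (R ∩ at a) ∩ at v ∣ + ∣ X₁ ∣
            ≤⟨ ℕ.+-mono-≤ (∣∣-mono {A = (R ∩ at a) ∩ at v} {R ∩ at a ∩ at v} λ ((r , x) , y) → r , x , y) (remaining X₁ b) ⟩
          μ R a v + (∣ X₁ ∩ at b ∣ + ∣ X₂ ∣)
            ≤⟨ ℕ.+-monoʳ-≤ (μ R a v) (ℕ.+-mono-≤ (∣∣-mono {A = X₁ ∩ at b} {R ∩ at a ∩ at b} λ (((r , x) , _) , y) → r , x , y)
                 (ℕ.≤-trans (remaining X₂ c) (ℕ.+-monoˡ-≤ _
                   (∣∣-mono {A = X₂ ∩ at c} {R ∩ at a ∩ at c} λ ((((r , x) , _) , _) , y) → r , x , y)))) ⟩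
          μ R a v + (μ R a b + (μ R a c + ∣ away a b c ∣)) ∎
        where
        open ℕ.≤-Reasoning
        X₁ X₂ : Sub size
        X₁ = (R ∩ at a) ∖ at v
        X₂ = X₁ ∖ at b

      -- If `a` is joined to both `b` and `c`, two triangles on the parallel edges `a v` are
      -- reducible. Otherwise one of the two multiplicities is zero and `spokes-apart` pays for the
      -- other: five edges at `a` remain, at most three of them towards `v`.
      away-≥2 : ∀ {eₐ e_b e_c a b c} → 11 ≤ k → eₐ ∈ R → Joins eₐ a v → e_b ∈ R → Joins e_b b v → e_c ∈ R → Joins e_c c v →
                a ≢ b → a ≢ c → b ≢ c → Col R ⊎ 2 ≤ ∣ away a b c ∣
      away-≥2 {a = a} {b} {c} 11≤k eₐ∈ jₐ e_b∈ j_b e_c∈ j_c a≢b a≢c b≢c with edge-between a b | edge-between a c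
      ... | inj₁ (h , h∈ , ah , bh) | inj₁ (h′ , h′∈ , ah′ , ch′) = inj₁ (reduce-two-triangles R smaller (joins-≢ jₐ)
              (ℕ.≤-trans (s≤s (s≤s z≤n)) (proj₁ (spoke-triple eₐ∈ jₐ))) b≢c e_b∈ e_c∈ h∈ h′∈
              (joins-sym j_b) (joins-sym j_c) (joins-both a≢b ah bh) (joins-both a≢c ah′ ch′))
      ... | inj₂ ab≡0 | _ = inj₂ (split-2≤n {d R a} {μ R a v} {μ R a b} {μ R a c} (away-count a b c) (μ≤3 eₐ∈ jₐ)
              (subst (λ t → 5 + t ≤ d R a) (cong (_+ μ R a c) (sym ab≡0)) (spokes-apart 11≤k eₐ∈ jₐ e_c∈ j_c a≢c)))
      ... | inj₁ _ | inj₂ ac≡0 = inj₂ (split-2≤n {d R a} {μ R a v} {μ R a b} {μ R a c} (away-count a b c) (μ≤3 eₐ∈ jₐ)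
              (subst (λ t → 5 + t ≤ d R a) (trans (sym (ℕ.+-identityʳ _)) (cong (μ R a b +_) (sym ac≡0)))
                (spokes-apart 11≤k eₐ∈ jₐ e_b∈ j_b a≢b)))

      pendants-away : ∀ {a b c} → 2 ≤ ∣ away a b c ∣ →
        ∃₂ λ f z → Pendant R {2} f a z × (∀ i → z i ≢ v × z i ≢ b × z i ≢ c)
      pendants-away {a} {b} {c} le with f , z , f-pend@(_ , _ , jf) , f∈ ← pick-pendants R (away a b c) (proj₁ ∘ proj₁ ∘ proj₁) le =
        f , z , f-pend , λ i → joins-free (jf i) (proj₂ (proj₁ (proj₁ (f∈ i)))) , joins-free (jf i) (proj₂ (proj₁ (f∈ i))) ,
                               joins-free (jf i) (proj₂ (f∈ i))

      -- Degree at least 7 and multiplicities at most 3 give `v` three neighbours. Two carry the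
      -- triples and pendants of a star with centre `v`, the third supplies its single edge.
      reduce-hub : Col R
      reduce-hub with e₁ , u₁ , e₁∈R , j₁ , u₁≢u ← other-than-u = third e₁∈R j₁ u₁≢u
          (∣∣-positive (((R ∩ at v) ∖ at u) ∖ at u₁) (ℕ.+-cancelˡ-≤ 3 1 _ (ℕ.+-cancelˡ-≤ 3 4 _ (ℕ.≤-trans v-deg≥7
            (ℕ.≤-trans (spoke-not-at (R ∩ at v) u id e₀∈R j₀)
              (ℕ.+-monoʳ-≤ 3 (spoke-not-at ((R ∩ at v) ∖ at u) u₁ proj₁ e₁∈R j₁)))))))
        where
        third : ∀ {e₁ u₁} → e₁ ∈ R → Joins e₁ u₁ v → u₁ ≢ u → (∃ λ e → e ∈ ((R ∩ at v) ∖ at u) ∖ at u₁) → Col R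
        third {u₁ = u₁} e₁∈R j₁ u₁≢u (e₂ , ((e₂∈R , ve₂) , ¬ue₂) , ¬u₁e₂) with u₂ , j₂ ← spoke e₂∈R ve₂ = finish
            (away-≥2 11≤k e₀∈R j₀ e₁∈R j₁ e₂∈R j₂ (≢-sym u₁≢u) (≢-sym u₂≢u) (≢-sym u₂≢u₁))
            (away-≥2 11≤k e₁∈R j₁ e₀∈R j₀ e₂∈R j₂ u₁≢u (≢-sym u₂≢u₁) (≢-sym u₂≢u))
          where
          u₂≢u : u₂ ≢ u
          u₂≢u refl = ¬ue₂ (joins-at j₂)
          u₂≢u₁ : u₂ ≢ u₁
          u₂≢u₁ refl = ¬u₁e₂ (joins-at j₂)
          open Spokes e₁∈R j₁ e₂∈R j₂ u₁≢u u₂≢u u₂≢u₁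
          finish : Col R ⊎ 2 ≤ ∣ away u u₁ u₂ ∣ → Col R ⊎ 2 ≤ ∣ away u₁ u u₂ ∣ → Col R
          finish (inj₁ col) _ = col
          finish (inj₂ _) (inj₁ col) = col
          finish (inj₂ le) (inj₂ le′)
            with f , z , f-pend , z-free ← pendants-away le | f′ , z′ , f′-pend , z′-free ← pendants-away le′
            with e , e-class ← pick-class R 3 (joins-≢ j₀) (proj₁ (spoke-triple e₀∈R j₀))
               | e′ , e′-class ← pick-class R 3 (joins-≢ j₁) (proj₁ (spoke-triple e₁∈R j₁)) =
            reduce-star R smaller (dG≤ R smaller) e-class e′-class e₂∈R j₂ f-pend f′-pend (≢-sym u₁≢u) u₂≢u u₂≢u₁ z-free z′-free

  -- Weighted cuts that are optimal under moving one vertex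

  module _ (R : Sub size) where

    -- The edges for which half of the degree does not suffice: they get weight 7
    -- in the cut, the others weight 8.
    Bad : Sub size
    Bad = ⟪ (λ e → ((d R (end₁ e) ℕ.≟ 8) ×-dec (3 + d R (end₂ e) ℕ.≟ k)) ⊎-dec
                   ((d R (end₂ e) ℕ.≟ 8) ×-dec (3 + d R (end₁ e) ℕ.≟ k))) ⟫

    cut : (Vertex → Bool) → Sub size
    cut σ = R ∩ ⟪ (λ e → ¬? (σ (end₁ e) Bool.≟ σ (end₂ e))) ⟫

    cut⇒ : ∀ σ {e u v} → Joins e u v → e ∈ cut σ → σ u ≢ σ v
    cut⇒ σ (inj₁ (refl , refl)) (_ , ≢) = ≢
    cut⇒ σ (inj₂ (refl , refl)) (_ , ≢) = ≢-sym ≢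

    cut⇐ : ∀ σ {e u v} → Joins e u v → e ∈ R → σ u ≢ σ v → e ∈ cut σ
    cut⇐ σ (inj₁ (refl , refl)) e∈R ≢ = e∈R , ≢
    cut⇐ σ (inj₂ (refl , refl)) e∈R ≢ = e∈R , ≢-sym ≢

    flip : Vertex → (Vertex → Bool) → Vertex → Bool
    flip v σ u with u Fin.≟ v
    ... | yes _ = not (σ u)
    ... | no  _ = σ u

    flip-same : ∀ v σ → flip v σ v ≡ not (σ v)
    flip-same v σ with v Fin.≟ v
    ... | yes _ = refl
    ... | no ≢  = contradiction refl ≢

    flip-other : ∀ {v u} σ → u ≢ v → flip v σ u ≡ σ u
    flip-other {v} {u} σ ≢ with u Fin.≟ v
    ... | yes eq = contradiction eq ≢
    ... | no _   = refl

    -- The intersection with `full` gives both summands the form to which `flip-count` applies.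
    weight : (Vertex → Bool) → ℕ
    weight σ = 7 * ∣ cut σ ∩ full ∣ + ∣ cut σ ∖ Bad ∣

    inside outside : (Vertex → Bool) → Vertex → Sub size
    inside  σ v = cut σ ∩ at v
    outside σ v = (R ∩ at v) ∖ cut σ

    flip-enters : ∀ σ {e v} → e ∈ outside σ v → e ∈ cut (flip v σ)
    flip-enters σ {v = v} ((e∈R , ve) , e∉) with w , j ← at-joins ve = cut⇐ (flip v σ) j e∈R λ eq →
      Bool.not-¬ {σ v} refl (trans (decidable-stable (σ v Bool.≟ σ w) λ ≢ → e∉ (cut⇐ σ j e∈R ≢))
        (trans (sym (flip-other σ (≢-sym (joins-≢ j)))) (trans (sym eq) (flip-same v σ))))

    flip-keeps : ∀ σ {e v} → e ∈ cut σ → ¬ Incident v e → e ∈ cut (flip v σ)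
    flip-keeps σ {e} {v} e∈@(e∈R , ≢) ¬ve = e∈R , λ eq → ≢
      (trans (sym (flip-other σ λ { refl → ¬ve (inj₁ refl) })) (trans eq (flip-other σ λ { refl → ¬ve (inj₂ refl) })))

    flip-count : ∀ σ v X → ∣ cut σ ∩ X ∣ + ∣ outside σ v ∩ X ∣ ≤ ∣ cut (flip v σ) ∩ X ∣ + ∣ inside σ v ∩ X ∣
    flip-count σ v X = begin
      ∣ C ∣ + ∣ O ∣                                 ≡⟨ cong (_+ ∣ O ∣) (∣∣-split C (at v)) ⟨
      ∣ C ∩ at v ∣ + ∣ C ∖ at v ∣ + ∣ O ∣           ≡⟨ ℕ.+-assoc ∣ C ∩ at v ∣ _ _ ⟩
      ∣ C ∩ at v ∣ + (∣ C ∖ at v ∣ + ∣ O ∣)         ≤⟨ ℕ.+-mono-≤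
          (∣∣-mono {A = C ∩ at v} {inside σ v ∩ X} λ ((c , x) , a) → (c , a) , x)
          (∣∣-⊎ {A = C ∖ at v} {O} {cut (flip v σ) ∩ X} (λ ((c , x) , ¬a) → flip-keeps σ c ¬a , x)
            (λ (o , x) → flip-enters σ o , x) λ (_ , ¬a) (((_ , a) , _) , _) → ¬a a) ⟩
      ∣ inside σ v ∩ X ∣ + ∣ cut (flip v σ) ∩ X ∣   ≡⟨ ℕ.+-comm ∣ inside σ v ∩ X ∣ _ ⟩
      ∣ cut (flip v σ) ∩ X ∣ + ∣ inside σ v ∩ X ∣   ∎
      where
      open ℕ.≤-Reasoning
      C O : Sub size
      C = cut σ ∩ X
      O = outside σ v ∩ X

    Optimal : (Vertex → Bool) → Set
    Optimal σ = ∀ v → weight (flip v σ) ≤ weight σ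

    optimal-cut : Σ (Vertex → Bool) Optimal
    optimal-cut = climb {Opt = Optimal} weight (7 * size + size)
      (λ σ → ℕ.+-mono-≤ (ℕ.*-monoʳ-≤ 7 (∣∣≤n (cut σ ∩ full))) (∣∣≤n (cut σ ∖ Bad))) improve λ _ → true
      where
      improve : ∀ σ → (∃ λ σ′ → weight σ < weight σ′) ⊎ Optimal σ
      improve σ with any? (λ v → weight σ ℕ.<? weight (flip v σ))
      ... | yes (v , lt) = inj₁ (flip v σ , lt)
      ... | no ∄         = inj₂ λ v → ℕ.≮⇒≥ λ lt → ∄ (v , lt)

    optimal-at : ∀ σ → Optimal σ → ∀ v →
                 7 * ∣ outside σ v ∣ + ∣ outside σ v ∖ Bad ∣ ≤ 7 * ∣ inside σ v ∣ + ∣ inside σ v ∖ Bad ∣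
    optimal-at σ opt v = subst₂ (λ o i → 7 * o + ∣ outside σ v ∖ Bad ∣ ≤ 7 * i + ∣ inside σ v ∖ Bad ∣)
      (∣∣-cong {A = outside σ v ∩ full} {outside σ v} proj₁ (_, tt)) (∣∣-cong {A = inside σ v ∩ full} {inside σ v} proj₁ (_, tt))
      (combine {∣ outside σ v ∩ full ∣} {∣ outside σ v ∖ Bad ∣} {∣ inside σ v ∩ full ∣} {∣ inside σ v ∖ Bad ∣}
        {∣ cut σ ∩ full ∣} {∣ cut σ ∖ Bad ∣} {∣ cut (flip v σ) ∩ full ∣} {∣ cut (flip v σ) ∖ Bad ∣} (opt v) (flip-count σ v full) (flip-count σ v ⟪ (λ e → ¬? (mem? Bad e)) ⟫))
      where
      combine : ∀ {o₁ o₂ i₁ i₂ c₁ c₂ c₁′ c₂′} → 7 * c₁′ + c₂′ ≤ 7 * c₁ + c₂ → c₁ + o₁ ≤ c₁′ + i₁ → c₂ + o₂ ≤ c₂′ + i₂ →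
                7 * o₁ + o₂ ≤ 7 * i₁ + i₂
      combine {o₁} {o₂} {i₁} {i₂} {c₁} {c₂} {c₁′} {c₂′} h₁ h₂ h₃ =
        linear 0 (ℕ.+-mono-≤ h₁ (ℕ.+-mono-≤ (ℕ.*-monoʳ-≤ 7 h₂) h₃)) (eq o₁ o₂ i₁ i₂ c₁ c₂ c₁′ c₂′)
        where
        eq : ∀ o₁ o₂ i₁ i₂ c₁ c₂ c₁′ c₂′ →
             7 * o₁ + o₂ + (7 * c₁ + c₂ + (7 * (c₁′ + i₁) + (c₂′ + i₂))) + 0 ≡
             7 * i₁ + i₂ + (7 * c₁′ + c₂′ + (7 * (c₁ + o₁) + (c₂ + o₂)))
        eq = solve-∀

    deg-split : ∀ σ v → ∣ inside σ v ∣ + ∣ outside σ v ∣ ≡ d R v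
    deg-split σ v = trans (cong (_+ ∣ outside σ v ∣)
      (∣∣-cong {A = inside σ v} {(R ∩ at v) ∩ cut σ} (λ (c , a) → (proj₁ c , a) , c) (λ ((_ , a) , c) → c , a)))
      (∣∣-split (R ∩ at v) (cut σ))

    mostly-inside : ∀ σ → Optimal σ → ∀ v → 7 * ∣ outside σ v ∣ ≤ 8 * ∣ inside σ v ∣
    mostly-inside σ opt v = begin
      7 * ∣ outside σ v ∣                              ≤⟨ ℕ.m≤m+n _ _ ⟩
      7 * ∣ outside σ v ∣ + ∣ outside σ v ∖ Bad ∣      ≤⟨ optimal-at σ opt v ⟩
      7 * ∣ inside σ v ∣ + ∣ inside σ v ∖ Bad ∣        ≤⟨ ℕ.+-monoʳ-≤ (7 * ∣ inside σ v ∣)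
                                                            (∣∣-mono {A = inside σ v ∖ Bad} {inside σ v} proj₁) ⟩
      7 * ∣ inside σ v ∣ + ∣ inside σ v ∣              ≡⟨ ℕ.+-comm (7 * ∣ inside σ v ∣) _ ⟩
      8 * ∣ inside σ v ∣                               ∎
      where open ℕ.≤-Reasoning

  -- The inequality at cut edges

  module Final (R : Sub size) (smaller : Smaller R) (tight : ∀ e → e ∈ R → k ≤ dG R e)
               (thin : ∀ e → e ∈ R → μ R (end₁ e) (end₂ e) ≤ 3)
               (low : ∀ {e u v} → e ∈ R → Joins e u v → 3 + d R v ≤ k)
               (σ : Vertex → Bool) (opt : Optimal R σ) where
    open Tight R smaller tight thin

    C : Sub size
    C = cut R σ

    Fits : Vertex → Vertex → Set
    Fits u v = ∣ outside R σ u ∣ + d R v ≤ k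

    bad-far : ∀ {e u v} → Joins e u v → d R u ≡ 8 → e ∈ Bad R → 3 + d R v ≡ k
    bad-far (inj₁ (refl , refl)) u8 (inj₁ (_ , eq)) = eq
    bad-far (inj₁ (refl , refl)) u8 (inj₂ (v8 , eq)) = trans (cong (3 +_) (trans v8 (sym u8))) eq
    bad-far (inj₂ (refl , refl)) u8 (inj₁ (v8 , eq)) = trans (cong (3 +_) (trans v8 (sym u8))) eq
    bad-far (inj₂ (refl , refl)) u8 (inj₂ (_ , eq)) = eq

    far-bad : ∀ {e u v} → Joins e u v → d R u ≡ 8 → 3 + d R v ≡ k → e ∈ Bad R
    far-bad (inj₁ (refl , refl)) u8 eq = inj₁ (u8 , eq)
    far-bad (inj₂ (refl , refl)) u8 eq = inj₂ (u8 , eq)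

    module Eight {e u v} (e∈C : e ∈ C) (j : Joins e u v) (u8 : d R u ≡ 8) (v-far : 3 + d R v ≡ k)
                 (c≡4 : ∣ outside R σ u ∣ ≡ 4) where

      -- The identity 8 + (k - 3) = dG + 1 + μ together with dG ≤ k + 1.
      triple-at : ∀ {f x} → f ∈ R → Joins f u x → 3 + d R x ≡ k → 3 ≤ μ R u x
      triple-at {f} {x} f∈R jf eq = triple {dG R f} {a = d R x}
        (ℕ.≤-reflexive (trans (cong (_+ d R x) (sym u8)) (sym (degree-sum R f∈R jf)))) (dG≤ R smaller f∈R) (ℕ.≤-reflexive (sym eq))

      b≡4 : ∣ inside R σ u ∣ ≡ 4
      b≡4 = ℕ.+-cancelʳ-≡ 4 _ _ (trans (cong (∣ inside R σ u ∣ +_) (sym c≡4)) (trans (deg-split R σ u) u8))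

      parallel-bad : Sub size
      parallel-bad = R ∩ at u ∩ at v

      parallel⊆ : parallel-bad ⊆ inside R σ u ∩ Bad R
      parallel⊆ (f∈R , uf , vf) = (cut⇐ R σ (joins-both (joins-≢ j) uf vf) f∈R (cut⇒ R σ j e∈C) , uf) ,
        far-bad (joins-both (joins-≢ j) uf vf) u8 v-far

      3≤bad-inside : 3 ≤ ∣ inside R σ u ∩ Bad R ∣
      3≤bad-inside = ℕ.≤-trans (triple-at (proj₁ e∈C) j v-far) (∣∣-mono {A = parallel-bad} {inside R σ u ∩ Bad R} parallel⊆)

      -- With four cut and four uncut edges at `u`, optimality compares only those that are not bad.
      -- At most one such edge is cut, hence at most one is uncut, and the other uncut edges are
      -- bad.
      bad-outside : ∃ λ f → f ∈ outside R σ u ∩ Bad R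
      bad-outside = ∣∣-positive (outside R σ u ∩ Bad R) (count
          (trans (∣∣-split (inside R σ u) (Bad R)) b≡4) (trans (∣∣-split (outside R σ u) (Bad R)) c≡4) 3≤bad-inside
          (subst₂ (λ c b → 7 * c + ∣ outside R σ u ∖ Bad R ∣ ≤ 7 * b + ∣ inside R σ u ∖ Bad R ∣) c≡4 b≡4 (optimal-at R σ opt u)))
        where
        count : ∀ {bb bn cb cn} → bb + bn ≡ 4 → cb + cn ≡ 4 → 3 ≤ bb → 28 + cn ≤ 28 + bn → 1 ≤ cb
        count {bb} {bn} {cb} {cn} b c h₁ h₂ = ℕ.≤-trans (s≤s z≤n) (linear {4 + (bb + bn) + (3 + (28 + cn))} {cb + cn + 4 + (bb + (28 + bn))} {3} {cb} 0
          (ℕ.+-mono-≤ (ℕ.+-mono-≤ (ℕ.≤-reflexive (sym c)) (ℕ.≤-reflexive b)) (ℕ.+-mono-≤ h₁ h₂)) (eq bb bn cb cn))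
          where
          eq : ∀ bb bn cb cn → 3 + (cb + cn + 4 + (bb + (28 + bn))) + 0 ≡ cb + (4 + (bb + bn) + (3 + (28 + cn)))
          eq = solve-∀

      extra-inside : ∃ λ g → g ∈ inside R σ u ∖ at v
      extra-inside = ∣∣-positive (inside R σ u ∖ at v) (ℕ.+-cancelˡ-≤ 3 1 _ (begin
        4                                                         ≡⟨ b≡4 ⟨
        ∣ inside R σ u ∣                                          ≤⟨ remaining (inside R σ u) v ⟩
        ∣ inside R σ u ∩ at v ∣ + ∣ inside R σ u ∖ at v ∣         ≤⟨ ℕ.+-monoˡ-≤ _ (ℕ.≤-trans
            (∣∣-mono {A = inside R σ u ∩ at v} {R ∩ at u ∩ at v} λ (((r , _) , a) , b) → r , a , b) (μ≤3 (proj₁ e∈C) j)) ⟩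
        3 + ∣ inside R σ u ∖ at v ∣                               ∎))
        where open ℕ.≤-Reasoning

      module _ {f v′ g w} (f∈ : f ∈ outside R σ u ∩ Bad R) (j′ : Joins f u v′)
               (g∈ : g ∈ inside R σ u ∖ at v) (jg : Joins g u w) where
        f∈R : f ∈ R
        f∈R = proj₁ (proj₁ (proj₁ f∈))
        g∈R : g ∈ R
        g∈R = proj₁ (proj₁ (proj₁ g∈))
        v′-far : 3 + d R v′ ≡ k
        v′-far = bad-far j′ u8 (proj₂ f∈)
        v≢v′ : v ≢ v′
        v≢v′ refl = proj₂ (proj₁ f∈) (cut⇐ R σ j′ f∈R (cut⇒ R σ j e∈C))
        w≢v : w ≢ v
        w≢v refl = proj₂ g∈ (joins-at′ jg)
        w≢v′ : w ≢ v′
        w≢v′ refl = proj₂ (proj₁ f∈) (cut⇐ R σ j′ f∈R (cut⇒ R σ jg (proj₁ (proj₁ g∈))))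

        -- Three of the four cut edges at `u` go to `v`, and all edges between `u` and `w` are cut.
        single : μ R u w ≤ 1
        single = ℕ.+-cancelˡ-≤ 3 _ 1 (begin
          3 + μ R u w                                ≤⟨ ℕ.+-monoˡ-≤ _ (triple-at (proj₁ e∈C) j v-far) ⟩
          μ R u v + μ R u w                          ≤⟨ ∣∣-⊎ {A = R ∩ at u ∩ at v} {R ∩ at u ∩ at w} {inside R σ u}
              (proj₁ ∘ parallel⊆)
              (λ (r , a , b) → cut⇐ R σ (joins-both (joins-≢ jg) a b) r (cut⇒ R σ jg (proj₁ (proj₁ g∈))) , a)
              (λ (_ , a , b) (_ , _ , c) → [ ≢-sym (joins-≢ jg) , w≢v ]′ (joins-only (joins-both (joins-≢ j) a b) c)) ⟩
          ∣ inside R σ u ∣                           ≡⟨ b≡4 ⟩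
          4                                          ∎)
          where open ℕ.≤-Reasoning

        -- Only the small multiplicity of `u w` gives this: the edge `g` needs many neighbours to
        -- account for 8 plus the degree of `w`.
        12≤k′ : 12 ≤ k
        12≤k′ with vertex-cases g∈R (joins-at′ jg) | ℕ.≤-reflexive (trans (cong (_+ d R w) (sym u8)) (sym (degree-sum R g∈R jg)))
        ... | inj₁ 7≤                    | sum = 12≤k {dG R g} 1 7≤ sum (dG≤ R smaller g∈R) single
        ... | inj₂ (6≤ , l , l∉R , wl)   | sum = 12≤k {dG R g} 0 6≤ sum (lost-≤k g∈R l∉R (joins-at′ jg) wl) single

        9≤far : ∀ {x} → 3 + d R x ≡ k → 9 ≤ d R x
        9≤far eq = ℕ.+-cancelˡ-≤ 3 9 _ (subst (12 ≤_) (sym eq) 12≤k′)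

        -- Adjacent vertices of degree k - 3 would give 2(k - 3) ≤ k + 5, against k ≥ 12. Thus
        -- pendants at `v` avoid `v′` and conversely.
        far-far : ∀ {h x y} → 3 + d R x ≡ k → 3 + d R y ≡ k → h ∈ R → Joins h x y → 1 ≤ 0
        far-far {h} {x} {y} ex ey h∈R jh = bound {d R x} {d R y} (far-end {dG R h} {μ R x y} {d R x} {d R y} (ℕ.≤-reflexive (sym (degree-sum R h∈R jh))) (dG≤ R smaller h∈R) (μ≤3 h∈R jh))
          (9≤far ex) ey
          where
          bound : ∀ {a b k} → a + b ≤ 5 + k → 9 ≤ a → 3 + b ≡ k → 1 ≤ 0
          bound {a} {b} h₁ h₂ refl = linear {a + b + 9} {5 + (3 + b) + a} 0 (ℕ.+-mono-≤ h₁ h₂) (eq a b)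
            where
            eq : ∀ a b → 1 + (5 + (3 + b) + a) + 0 ≡ 0 + (a + b + 9)
            eq = solve-∀

        μ′≤3 : ∀ x y → x ≢ y → μ R x y ≤ 3
        μ′≤3 x y x≢y with any? (mem? (R ∩ at x ∩ at y))
        ... | yes (t , t∈R , xt , yt) = μ≤3 t∈R (joins-both x≢y xt yt)
        ... | no ∄ = ℕ.≤-trans (ℕ.≤-reflexive (∣∣-empty (R ∩ at x ∩ at y) λ t → ∄ (_ , t))) z≤n
        3≤away : ∀ {h x} → Joins h u x → 3 + d R x ≡ k → w ≢ x → 3 ≤ ∣ ((R ∩ at x) ∖ at u) ∖ at w ∣
        3≤away {x = x} jh x-far w≢x = ℕ.+-cancelˡ-≤ 3 3 _ (ℕ.+-cancelˡ-≤ 3 6 _ (begin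
            9                                                 ≤⟨ 9≤far x-far ⟩
            d R x                                             ≤⟨ remaining (R ∩ at x) u ⟩
            ∣ (R ∩ at x) ∩ at u ∣ + ∣ (R ∩ at x) ∖ at u ∣
              ≤⟨ ℕ.+-mono-≤ (ℕ.≤-trans (∣∣-mono {A = (R ∩ at x) ∩ at u} {R ∩ at x ∩ at u} λ ((r , a) , b) → r , a , b)
                               (μ′≤3 x u (≢-sym (joins-≢ jh)))) (remaining ((R ∩ at x) ∖ at u) w) ⟩
            3 + (∣ ((R ∩ at x) ∖ at u) ∩ at w ∣ + ∣ ((R ∩ at x) ∖ at u) ∖ at w ∣)
              ≤⟨ ℕ.+-monoʳ-≤ 3 (ℕ.+-monoˡ-≤ _ (ℕ.≤-trans
                   (∣∣-mono {A = ((R ∩ at x) ∖ at u) ∩ at w} {R ∩ at x ∩ at w} λ (((r , a) , _) , b) → r , a , b)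
                   (μ′≤3 x w (≢-sym w≢x)))) ⟩
            3 + (3 + ∣ ((R ∩ at x) ∖ at u) ∖ at w ∣)          ∎))
            where open ℕ.≤-Reasoning

        pendants : ∀ {h x x′} → h ∈ R → Joins h u x → 3 + d R x ≡ k → 3 + d R x′ ≡ k → x ≢ x′ → w ≢ x →
          ∃₂ λ f z → Pendant R {2} f x z × (∀ i → z i ≢ u × z i ≢ x′ × z i ≢ w)
        pendants {x = x} {x′} h∈R jh x-far x′-far x≢x′ w≢x = free
            (pick-pendants R (((R ∩ at x) ∖ at u) ∖ at w) (proj₁ ∘ proj₁) (ℕ.<⇒≤ (3≤away jh x-far w≢x)))
          where
          free : (∃₂ λ f z → Pendant R {2} f x z × (∀ i → f i ∈ ((R ∩ at x) ∖ at u) ∖ at w)) →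
                 ∃₂ λ f z → Pendant R {2} f x z × (∀ i → z i ≢ u × z i ≢ x′ × z i ≢ w)
          free (f , z , f-pend@(_ , f∈R , jf) , f∈) = f , z , f-pend , λ i →
            joins-free (jf i) (proj₂ (proj₁ (f∈ i))) ,
            (λ eq → contradiction (far-far x-far x′-far (f∈R i) (subst (Joins (f i) x) eq (jf i))) λ ()) ,
            joins-free (jf i) (proj₂ (f∈ i))

        Pendants : Vertex → Vertex → Set
        Pendants x x′ = ∃₂ λ f z → Pendant R {2} f x z × (∀ i → z i ≢ u × z i ≢ x′ × z i ≢ w)

        Triple : Vertex → Set
        Triple x = ∃ λ (e : Fin 3 → Edge) → Class R e x u

        triple-class : ∀ {h x} → h ∈ R → Joins h u x → 3 + d R x ≡ k → Triple x
        triple-class {x = x} h∈R jh eq =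
          pick-class R 3 (joins-≢ (joins-sym jh)) (subst (3 ≤_) (μ-sym u x) (triple-at h∈R jh eq))

        -- The star is centred at `u`: its triples go to `v` across the cut and to `v′` on the side
        -- of `u`, and `g` is its single edge.
        reduce-eight : Pendants v v′ → Pendants v′ v → Triple v → Triple v′ → Col R
        reduce-eight (_ , _ , p-pend , z-free) (_ , _ , p′-pend , z′-free) (_ , e-class) (_ , f-class) =
          reduce-star R smaller (dG≤ R smaller) e-class f-class g∈R (joins-sym jg) p-pend p′-pend v≢v′ w≢v w≢v′ z-free z′-free

        reduce-spread : Col R
        reduce-spread = reduce-eight (pendants (proj₁ e∈C) j v-far v′-far v≢v′ w≢v) (pendants f∈R j′ v′-far v-far (≢-sym v≢v′) w≢v′)
                          (triple-class (proj₁ e∈C) j v-far) (triple-class f∈R j′ v′-far)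

      reduce-bad : Col R
      reduce-bad =
        let f , f∈ = bad-outside
            g , g∈ = extra-inside
            v′ , j′ = at-joins (proj₂ (proj₁ (proj₁ f∈)))
            w , jg = at-joins (proj₂ (proj₁ g∈))
        in reduce-spread f∈ j′ g∈ jg

    fits : ∀ {e u v} → e ∈ C → Joins e u v → Col R ⊎ Fits u v
    fits {e} {u} {v} e∈C j = [ inj₂ , (λ (u8 , v-far , c≡4) → inj₁ (Eight.reduce-bad e∈C j u8 v-far c≡4)) ]′
      (cut-fits (d R u) ∣ inside R σ u ∣ ∣ outside R σ u ∣ (ℕ.<-cmp (d R u) 8) (mostly-inside R σ opt u) (deg-split R σ u) (low (proj₁ e∈C) j)
        (far-end {dG R e} {μ R u v} {d R u} {d R v} (ℕ.≤-reflexive (sym (degree-sum R (proj₁ e∈C) j))) (dG≤ R smaller (proj₁ e∈C)) (μ≤3 (proj₁ e∈C) j)))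

  -- Colouring the cut, and the induction

  module _ (R : Sub size) (σ : Vertex → Bool) where

    x y : Edge → Vertex
    x e = if σ (end₁ e) then end₁ e else end₂ e
    y e = if σ (end₁ e) then end₂ e else end₁ e

    x-y-joins : ∀ e → Joins e (x e) (y e)
    x-y-joins e with σ (end₁ e)
    ... | true  = inj₁ (refl , refl)
    ... | false = inj₂ (refl , refl)

    x-side : ∀ {e} → e ∈ cut R σ → σ (x e) ≡ true × σ (y e) ≡ false
    x-side {e} (_ , ≢) with σ (end₁ e) in eq | σ (end₂ e) in eq′
    ... | true  | true  = contradiction refl ≢
    ... | true  | false = eq , eq′
    ... | false | true  = eq′ , eq
    ... | false | false = contradiction refl ≢

    share-end-of-cut : ∀ {e f} → e ∈ cut R σ → f ∈ cut R σ → Adj e f → x e ≡ x f ⊎ y e ≡ y f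
    share-end-of-cut {e} {f} e∈ f∈ (_ , v , ve , vf) with joins-only (x-y-joins e) ve | joins-only (x-y-joins f) vf
    ... | inj₁ p | inj₁ q = inj₁ (trans (sym p) q)
    ... | inj₂ p | inj₂ q = inj₂ (trans (sym p) q)
    ... | inj₁ p | inj₂ q = contradiction (trans (sym (proj₁ (x-side e∈))) (trans (cong σ (trans (sym p) q)) (proj₂ (x-side f∈)))) λ ()
    ... | inj₂ p | inj₁ q = contradiction (trans (sym (proj₁ (x-side f∈))) (trans (cong σ (trans (sym q) p)) (proj₂ (x-side e∈)))) λ ()

    Fitting : Set
    Fitting = ∀ e → e ∈ cut R σ → ∀ {u v} → Joins e u v → ∣ outside R σ u ∣ + d R v ≤ k

    -- A cut edge `u v` has at most out(u) + out(v) coloured neighbours, where out counts uncut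
    -- edges. Since out(u) + deg v ≤ k, at least deg v - out(v) colours remain, which is the degree
    -- of `v` in the cut; the same holds for `u`. So `bipartite-colouring` applies.
    colour-cut : Col (R ∖ cut R σ) → Fitting → Col R
    colour-cut rest fitting = extend R (cut R σ) proj₁ rest λ Λ u big →
      let c , c∈ , proper = bipartite-colouring x y (cut R σ) Λ u λ {e} e∈ → enough e∈ (big e∈)
      in c , c∈ , λ e∈ f∈ a → proper e∈ f∈ (proj₁ a) (share-end-of-cut e∈ f∈ a)
      where
      degree≤ : ∀ (z : Edge → Vertex) → (∀ e → Incident (z e) e) → ∀ v → degree z (cut R σ) v ≤ ∣ inside R σ v ∣
      degree≤ z z-at v = ∣∣-mono {A = cut R σ ∩ ⟪ (λ e → z e Fin.≟ v) ⟫} {inside R σ v} λ { {f} (f∈ , refl) → f∈ , z-at f }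
      outer : ∀ {e u v} → Joins e u v → dG (R ∖ cut R σ) e ≤ ∣ outside R σ u ∣ + ∣ outside R σ v ∣
      outer {e} {u} {v} j = ∣∣-cover {A = outside R σ u} {outside R σ v} {(R ∖ cut R σ) ∩ nbrs e}
        λ ((f∈R , f∉) , a) → Sum.map (λ uf → (f∈R , uf) , f∉) (λ vf → (f∈R , vf) , f∉) (adj-elim j a)
      one-end : ∀ {e u v t} → e ∈ cut R σ → Joins e u v → k ≤ dG (R ∖ cut R σ) e + t → ∣ inside R σ u ∣ ≤ t
      one-end {e} {u} {v} {t} e∈ j big = count (ℕ.≤-reflexive (deg-split R σ u)) (fitting e e∈ (joins-sym j)) big (outer j)
        where
        count : ∀ {b c c′ a g t k} → b + c ≤ a → c′ + a ≤ k → k ≤ g + t → g ≤ c + c′ → b ≤ t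
        count {b} {c} {c′} {a} {g} {t} {k} h₁ h₂ h₃ h₄ =
          linear 0 (ℕ.+-mono-≤ h₁ (ℕ.+-mono-≤ h₂ (ℕ.+-mono-≤ h₃ h₄))) (eq b c c′ a g t k)
          where
          eq : ∀ b c c′ a g t k → b + (a + (k + (g + t + (c + c′)))) + 0 ≡ t + (b + c + (c′ + a + (k + g)))
          eq = solve-∀
      enough : ∀ {e t} → e ∈ cut R σ → k ≤ dG (R ∖ cut R σ) e + t →
               degree x (cut R σ) (x e) ⊔ degree y (cut R σ) (y e) ≤ t
      enough {e} e∈ big = ℕ.⊔-lub
        (ℕ.≤-trans (degree≤ x (joins-at ∘ x-y-joins) (x e)) (one-end e∈ (x-y-joins e) big))
        (ℕ.≤-trans (degree≤ y (joins-at′ ∘ x-y-joins) (y e)) (one-end e∈ (joins-sym (x-y-joins e)) big))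

  both-⊎ : ∀ {A B C : Set} → A ⊎ B → A ⊎ C → A ⊎ B × C
  both-⊎ (inj₁ a) _        = inj₁ a
  both-⊎ (inj₂ b) (inj₁ a) = inj₁ a
  both-⊎ (inj₂ b) (inj₂ c) = inj₂ (b , c)

  both-ends : ∀ {e} (P : Vertex → Vertex → Set) → P (end₁ e) (end₂ e) → P (end₂ e) (end₁ e) → ∀ {u v} → Joins e u v → P u v
  both-ends P p q (inj₁ (refl , refl)) = p
  both-ends P p q (inj₂ (refl , refl)) = q

  module _ (R : Sub size) (smaller : Smaller R) (tight : ∀ e → e ∈ R → k ≤ dG R e)
           (thin : ∀ e → e ∈ R → μ R (end₁ e) (end₂ e) ≤ 3) where
    Low : Edge → Set
    Low e = e ∈ R → ∀ {u v} → Joins e u v → 3 + d R v ≤ k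

    low-or-reducible : Col R ⊎ (∀ e → Low e)
    low-or-reducible = ∀-or λ e → decide e (mem? R e)
      where
      far : ∀ {e u v} → e ∈ R → Joins e u v → Col R ⊎ 3 + d R v ≤ k
      far {v = v} e∈R j with k ℕ.≤? 2 + d R v
      ... | yes le = inj₁ (Tight.Hub.reduce-hub R smaller tight thin e∈R j le)
      ... | no k≰  = inj₂ (ℕ.≰⇒> k≰)
      decide : ∀ e → Dec (e ∈ R) → Col R ⊎ Low e
      decide e (no e∉R)  = inj₂ λ e∈R → contradiction e∈R e∉R
      decide e (yes e∈R) = Sum.map₂ (λ (p , q) _ → both-ends {e} (λ _ v → 3 + d R v ≤ k) p q)
        (both-⊎ (far e∈R (joins-ends e)) (far e∈R (joins-sym (joins-ends e))))

    module _ (low : ∀ e → Low e) (σ : Vertex → Bool) (opt : Optimal R σ) where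
      Fitting-at : Edge → Set
      Fitting-at e = e ∈ cut R σ → ∀ {u v} → Joins e u v → ∣ outside R σ u ∣ + d R v ≤ k

      fitting-or-reducible : Col R ⊎ (∀ e → Fitting-at e)
      fitting-or-reducible = ∀-or λ e → decide e (mem? (cut R σ) e)
        where
        decide : ∀ e → Dec (e ∈ cut R σ) → Col R ⊎ Fitting-at e
        decide e (no e∉)  = inj₂ λ e∈ → contradiction e∈ e∉
        decide e (yes e∈) = Sum.map₂ (λ (p , q) _ → both-ends {e} (λ u v → ∣ outside R σ u ∣ + d R v ≤ k) p q)
          (both-⊎ {B = ∣ outside R σ (end₁ e) ∣ + d R (end₂ e) ≤ k} {∣ outside R σ (end₂ e) ∣ + d R (end₁ e) ≤ k}
            (fits e∈ (joins-ends e)) (fits e∈ (joins-sym (joins-ends e))))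
          where
          fits : ∀ {u v} → e ∈ cut R σ → Joins e u v → Col R ⊎ ∣ outside R σ u ∣ + d R v ≤ k
          fits = Final.fits R smaller tight thin (λ {e} e∈R j → low e e∈R j) σ opt

      -- Makes the induction go through: the uncut edges form a smaller set only if some edge is
      -- cut, and optimality at a vertex of degree at least 6 provides one.
      cut-nonempty : ∀ {e} → e ∈ R → ∃ λ f → f ∈ inside R σ (end₁ e)
      cut-nonempty {e} e∈R = ∣∣-positive (inside R σ v) (cut-1≤b {∣ inside R σ v ∣} {∣ outside R σ v ∣}
          (mostly-inside R σ opt v) (subst (6 ≤_) (sym (deg-split R σ v)) (Tight.deg≥6 R smaller tight thin e∈R (joins-at (joins-ends e)))))
        where
        v : Vertex
        v = end₁ e

      uncut-smaller : ∀ {e} → e ∈ R → ∣ R ∖ cut R σ ∣ < ∣ R ∣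
      uncut-smaller e∈R = let f , f∈ , _ = cut-nonempty e∈R in
        ∣∣-< {i = f} {A = R ∖ cut R σ} {R} proj₁ (proj₁ f∈) λ f∉ → proj₂ f∉ f∈

    colour-tight : ∀ {e} → e ∈ R → Col R
    colour-tight e∈R = [ id , (λ low → let σ , opt = optimal-cut R in
      [ id , colour-cut R σ (smaller (R ∖ cut R σ) (uncut-smaller low σ opt e∈R)) ]′ (fitting-or-reducible low σ opt)) ]′ low-or-reducible

  colour-all : ∀ R → Acc _<_ ∣ R ∣ → Col R
  colour-all R (acc rec) = decide (any? (mem? R))
    where
    smaller : Smaller R
    smaller R′ lt = colour-all R′ (rec lt)
    decide : Dec (∃ λ e → e ∈ R) → Col R
    decide (no ∄) = (λ _ → 0) , (λ e∈R → contradiction (_ , e∈R) ∄) , λ e∈R → contradiction (_ , e∈R) ∄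
    decide (yes (_ , e∈R)) = [ id , (λ tight → [ id , (λ thin → colour-tight R smaller tight thin e∈R) ]′
      (thin-or-reducible R smaller tight)) ]′ (tight-or-reducible R smaller)

  edge-colouring : ∃ λ (c : Edge → ℕ) → (∀ e → c e ∈ˡ L e) × (∀ {e f} → Adj e f → c e ≢ c f)
  edge-colouring with c , c∈ , proper ← colour-all full (<-wellFounded _) = c , (λ e → c∈ tt) , proper tt tt

-- Translation to clique number, maximum degree and choosability

subset : Sub n → Subset.Subset n
subset A = Vec.tabulate λ i → does (mem? A i)

∈-subset⁻ : (A : Sub n) {i : Fin n} → i Subset.∈ subset A → i ∈ A
∈-subset⁻ A {i} i∈ = toWitness′ (mem? A i) (trans (sym (lookup∘tabulate (λ i → does (mem? A i)) i)) ([]=⇒lookup i∈))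
  where
  toWitness′ : ∀ {P : Set} (p : Dec P) → does p ≡ true → P
  toWitness′ (yes p) _ = p

opaque
  unfolding ∣_∣

  ∣subset∣ : (A : Sub n) → Subset.∣ subset A ∣ ≡ ∣ A ∣
  ∣subset∣ A = count (mem? A)
    where
    count : ∀ {m} {P : Fin m → Set} (P? : Decidable P) → Subset.∣ Vec.tabulate (λ i → does (P? i)) ∣ ≡ sum (λ i → 𝟙 (P? i))
    count {zero}  P? = refl
    count {suc m} P? with P? zero
    ... | yes _ = cong suc (count (P? ∘ suc))
    ... | no  _ = count (P? ∘ suc)

theorem6p6 : (H : Multigraph) → 7 ≤ Multigraph.δ H →
    let G = lineGraph H in
    χₗ G ≤ ω G ⊔ (Δ G ∸ 1)
theorem6p6 H 7≤δ = proj₂ (proj₂ (listChromaticNumber G)) {k} λ L uniq len →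
    Structure.edge-colouring H k L uniq len nbrs≤ clique≤ seven
  where
  open Incidence H using (Adj; nbrs; at; adj?; incident?)
  G : SimpleGraph
  G = lineGraph H
  k : ℕ
  k = ω G ⊔ (Δ G ∸ 1)
  nbrs≤ : ∀ e → ∣ nbrs e ∣ ≤ suc k
  nbrs≤ e = begin
    ∣ nbrs e ∣                  ≡⟨ length-filter-allFin (adj? e) ⟨
    SimpleGraph.degree G e      ≤⟨ All.lookup (xs≤max 0 (map (SimpleGraph.degree G) (allFin _))) (∈-map⁺ _ (∈-allFin e)) ⟩
    Δ G                         ≤⟨ ℕ.m≤n+m∸n (Δ G) 1 ⟩
    suc (Δ G ∸ 1)               ≤⟨ s≤s (ℕ.m≤n⊔m (ω G) _) ⟩
    suc k                       ∎
    where open ℕ.≤-Reasoning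
  clique≤ : ∀ C → (∀ {e f} → e ∈ C → f ∈ C → e ≢ f → Adj e f) → ∣ C ∣ ≤ k
  clique≤ C clique = ℕ.≤-trans (proj₂ (proj₂ (cliqueNumber G))
    (subset C , (λ e f e∈ f∈ e≢f → clique (∈-subset⁻ C e∈) (∈-subset⁻ C f∈) e≢f) , ∣subset∣ C)) (ℕ.m≤m⊔n (ω G) _)
  seven : ∀ v → 7 ≤ ∣ at v ∣
  seven v = begin
    7                           ≤⟨ 7≤δ ⟩
    Multigraph.δ H              ≤⟨ All.lookup (min≤xs (Multigraph.size H) (map (Multigraph.deg H) (allFin _))) (∈-map⁺ _ (∈-allFin v)) ⟩
    Multigraph.deg H v          ≡⟨ length-filter-allFin (incident? v) ⟩
    ∣ at v ∣                    ∎
    where open ℕ.≤-Reasoning
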